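{- Let $\widetilde{b}_n$ be the number of unlabeled bicolored graphs on $n$ vertices. Then, as $n\to\infty$, $$\widetilde{b}_n\sim\frac{c(n)}{\lfloor n/2\rfloor!\,\lceil n/2\rceil!}\,2^{n^2/4},$$ where $c(n)=\sum_{k\in\mathbb{Z}}2^{ -k^2}$ if $n$ is even and $c(n)=\sum_{k\in\mathbb{Z}}2^{ -(k+\frac12)^2}$ if $n$ is odd.
   Context: Graphs are finite and simple. A bicolored graph is a graph in which each vertex is colored green or red such that no two adjacent vertices have the same color; the colors are not interchangeable, and isomorphisms of bicolored graphs are the graph isomorphisms that preserve color. Unlabeled bicolored graphs are isomorphism classes of bicolored graphs under color-preserving isomorphism. The notation $x_n\sim y_n$ means $\lim_{n\to\infty}x_n/y_n=1$. -}

module Defs where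

open import Level using (0ℓ)
open import Data.Bool.Base using (Bool; true; false; if_then_else_)
import Data.Bool.Properties as Bool
open import Data.Nat.Base as ℕ using (ℕ; zero; suc)
import Data.Nat.Properties as ℕ
open import Data.Nat.Coprimality using (1-coprimeTo) renaming (sym to coprime-sym)
open import Data.Nat.Divisibility using (_∣?_)
open import Data.Integer.Base as ℤ using (ℤ; +_; -[1+_]; +[1+_])
import Data.Integer.Properties as ℤ
open import Data.Rational.Base
open import Data.Rational.Properties hiding (_≟_; _≤?_)
open import Data.Rational.Solver using (module +-*-Solver)
import Data.Rational.Unnormalised.Base as ℚᵘ
import Data.Rational.Unnormalised.Properties as ℚᵘ
open import Data.Fin.Base using (Fin; zero; suc)
import Data.Fin.Properties as Fin
open import Data.Fin.Permutation as Perm using (Permutation′; permutation; _⟨$⟩ʳ_; _⟨$⟩ˡ_; _∘ₚ_)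
open import Data.List.Base using (List; []; _∷_; map; concatMap; cartesianProduct; deduplicate; length; lookup; allFin)
open import Data.List.Relation.Unary.Any as Any using (Any; here; there)
import Data.List.Relation.Unary.Any.Properties as Any
import Data.List.Relation.Unary.All as All
open import Data.List.Relation.Unary.AllPairs using (_∷_)
open import Data.List.Relation.Unary.Enumerates.Setoid using (IsEnumeration)
open import Data.List.Relation.Unary.Enumerates.Setoid.Properties using (deduplicate⁺; lookup-surjective)
import Data.List.Relation.Unary.Unique.Setoid as Unique
open import Data.List.Relation.Unary.Unique.DecSetoid.Properties using (deduplicate-!)
open import Data.List.Membership.Propositional.Properties using (∈-lookup; ∈-allFin)
open import Data.Product.Base using (Σ-syntax; ∃-syntax; _×_; _,_; proj₁; proj₂)
open import Data.Sum.Base using (inj₁; inj₂)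
open import Function.Base using (_∘_)
open import Function.Bundles using (Bijection)
open import Relation.Binary.Bundles using (Setoid; DecSetoid)
open import Relation.Binary.Definitions using (DecidableEquality; Decidable)
open import Relation.Nullary.Decidable using (Dec; does; yes; no; map′; _×-dec_; _→-dec_; ¬?)
open import Relation.Nullary.Negation using (contradiction)
open import Relation.Binary.PropositionalEquality hiding (J)

record SimpleGraph (n : ℕ) : Set where
  field
    adjacent    : Fin n → Fin n → Bool
    symmetric   : ∀ i j → adjacent i j ≡ adjacent j i
    irreflexive : ∀ i → adjacent i i ≡ false

data Color : Set where
  green red : Color

record BicoloredGraph (n : ℕ) : Set where
  field
    graph  : SimpleGraph n
    color  : Fin n → Color

  open SimpleGraph graph public

  field
    proper : ∀ i j → adjacent i j ≡ true → color i ≢ color j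

open BicoloredGraph

infix 4 _≅_

_≅_ : ∀ {n} → BicoloredGraph n → BicoloredGraph n → Set
_≅_ {n} G H = Σ[ π ∈ Permutation′ n ]
  (∀ i j → adjacent G i j ≡ adjacent H (π ⟨$⟩ʳ i) (π ⟨$⟩ʳ j)) ×
  (∀ i → color G i ≡ color H (π ⟨$⟩ʳ i))

bicoloredGraphs : ℕ → Setoid 0ℓ 0ℓ
bicoloredGraphs n = record
  { Carrier       = BicoloredGraph n
  ; _≈_           = _≅_
  ; isEquivalence = record
    { refl  = Perm.id , (λ _ _ → refl) , λ _ → refl
    ; sym   = λ {G} {H} (π , a , c) → Perm.flip π
        , (λ i j → sym (trans (a (π ⟨$⟩ˡ i) (π ⟨$⟩ˡ j))
                        (cong₂ (adjacent H) (Perm.inverseʳ π) (Perm.inverseʳ π))))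
        , (λ i → sym (trans (c (π ⟨$⟩ˡ i)) (cong (color H) (Perm.inverseʳ π))))
    ; trans = λ (π , a , c) (ρ , b , d) → π ∘ₚ ρ
        , (λ i j → trans (a i j) (b (π ⟨$⟩ʳ i) (π ⟨$⟩ʳ j)))
        , (λ i → trans (c i) (d (π ⟨$⟩ʳ i)))
    }
  }

cons : ∀ {A : Set} {n} → A → (Fin n → A) → Fin (suc n) → A
cons x f zero    = x
cons x f (suc i) = f i

functions : ∀ {A : Set} n → List A → List (Fin n → A)
functions zero    xs = (λ ()) ∷ []
functions (suc n) xs = concatMap (λ x → map (cons x) (functions n xs)) xs

functions-complete : ∀ {A : Set} (R : A → A → Set) n xs (f : Fin n → A) →
  (∀ i → Any (R (f i)) xs) → Any (λ g → ∀ i → R (f i) (g i)) (functions n xs)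
functions-complete R zero    xs f h = here λ ()
functions-complete R (suc n) xs f h = Any.concatMap⁺ (λ x → map (cons x) (functions n xs))
  (Any.map (λ fx → Any.map⁺ (Any.map (λ fg → λ { zero → fx ; (suc i) → fg i })
      (functions-complete R n xs (f ∘ suc) (h ∘ suc))))
    (h zero))

allFin→Fin : ∀ n → List (Fin n → Fin n)
allFin→Fin n = functions n (allFin n)

IsIso : ∀ {n} → BicoloredGraph n → BicoloredGraph n → (Fin n → Fin n) × (Fin n → Fin n) → Set
IsIso G H (f , g) = (∀ i → f (g i) ≡ i) × (∀ i → g (f i) ≡ i) ×
  (∀ i j → adjacent G i j ≡ adjacent H (f i) (f j)) × (∀ i → color G i ≡ color H (f i))

_≟ᶜ_ : DecidableEquality Color
green ≟ᶜ green = yes refl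
green ≟ᶜ red   = no λ ()
red   ≟ᶜ green = no λ ()
red   ≟ᶜ red   = yes refl

isIso? : ∀ {n} (G H : BicoloredGraph n) p → Dec (IsIso G H p)
isIso? G H (f , g) = Fin.all? (λ i → f (g i) Fin.≟ i) ×-dec Fin.all? (λ i → g (f i) Fin.≟ i) ×-dec
  Fin.all? (λ i → Fin.all? (λ j → adjacent G i j Bool.≟ adjacent H (f i) (f j))) ×-dec
  Fin.all? (λ i → color G i ≟ᶜ color H (f i))

_≅?_ : ∀ {n} → Decidable (_≅_ {n})
_≅?_ {n} G H = map′ to from
  (Any.any? (isIso? G H) (cartesianProduct (allFin→Fin n) (allFin→Fin n)))
  where
  to : Any (IsIso G H) (cartesianProduct (allFin→Fin n) (allFin→Fin n)) → G ≅ H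
  to p with Any.satisfied p
  ... | (f , g) , fg , gf , a , c = permutation f g fg gf , a , c
  complete : (f : Fin n → Fin n) → Any (λ g → ∀ i → f i ≡ g i) (allFin→Fin n)
  complete f = functions-complete _≡_ n _ f λ i → ∈-allFin (f i)
  from : G ≅ H → Any (IsIso G H) (cartesianProduct (allFin→Fin n) (allFin→Fin n))
  from (π , a , c) = Any.map
    (λ { {f , g} (f≗ , g≗) →
         (λ i → trans (sym (f≗ (g i))) (trans (cong (π ⟨$⟩ʳ_) (sym (g≗ i))) (Perm.inverseʳ π)))
       , (λ i → trans (sym (g≗ (f i))) (trans (cong (π ⟨$⟩ˡ_) (sym (f≗ i))) (Perm.inverseˡ π)))
       , (λ i j → trans (a i j) (cong₂ (adjacent H) (f≗ i) (f≗ j)))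
       , (λ i → trans (c i) (cong (color H) (f≗ i))) })
    (Any.cartesianProduct⁺ (complete (π ⟨$⟩ʳ_)) (complete (π ⟨$⟩ˡ_)))

Candidate : ℕ → Set
Candidate n = (Fin n → Fin n → Bool) × (Fin n → Color)

IsBicolored : ∀ {n} → Candidate n → Set
IsBicolored (a , c) = (∀ i j → a i j ≡ a j i) × (∀ i → a i i ≡ false) ×
                      (∀ i j → a i j ≡ true → c i ≢ c j)

isBicolored? : ∀ {n} (p : Candidate n) → Dec (IsBicolored p)
isBicolored? (a , c) =
  Fin.all? (λ i → Fin.all? (λ j → a i j Bool.≟ a j i)) ×-dec
  Fin.all? (λ i → a i i Bool.≟ false) ×-dec
  Fin.all? (λ i → Fin.all? (λ j → (a i j Bool.≟ true) →-dec ¬? (c i ≟ᶜ c j)))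

fromCandidate : ∀ {n} → Candidate n → List (BicoloredGraph n)
fromCandidate (a , c) with isBicolored? (a , c)
... | no  _               = []
... | yes (s , irr , prp) = record
  { graph  = record { adjacent = a ; symmetric = s ; irreflexive = irr }
  ; color  = c
  ; proper = prp
  } ∷ []

candidates : ∀ n → List (Candidate n)
candidates n = cartesianProduct
  (functions n (functions n (true ∷ false ∷ []))) (functions n (green ∷ red ∷ []))

allGraphs : ∀ n → List (BicoloredGraph n)
allGraphs n = concatMap fromCandidate (candidates n)

allGraphs-complete : ∀ n → IsEnumeration (bicoloredGraphs n) (allGraphs n)
allGraphs-complete n G = Any.concatMap⁺ fromCandidate (Any.map (λ {p} → fromCandidate-complete p)
  (Any.cartesianProduct⁺
    (functions-complete (λ f g → ∀ j → f j ≡ g j) n _ (adjacent G)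
      λ i → functions-complete _≡_ n _ (adjacent G i) (bool ∘ adjacent G i))
    (functions-complete _≡_ n _ (color G) (col ∘ color G))))
  where
  bool : ∀ b → Any (b ≡_) (true ∷ false ∷ [])
  bool true  = here refl
  bool false = there (here refl)
  col : ∀ c → Any (c ≡_) (green ∷ red ∷ [])
  col green = here refl
  col red   = there (here refl)
  fromCandidate-complete : ∀ p → (∀ i j → adjacent G i j ≡ proj₁ p i j) × (∀ i → color G i ≡ proj₂ p i) →
                           Any (G ≅_) (fromCandidate p)
  fromCandidate-complete (a , c) (a≗ , c≗) with isBicolored? (a , c)
  ... | yes _ = here (Perm.id , a≗ , c≗)
  ... | no ¬p = contradiction
    ( (λ i j → trans (sym (a≗ i j)) (trans (symmetric G i j) (a≗ j i)))
    , (λ i → trans (sym (a≗ i i)) (irreflexive G i))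
    , (λ i j aij c≡ → proper G i j (trans (a≗ i j) aij) (trans (c≗ i) (trans c≡ (sym (c≗ j)))))) ¬p

module _ (S : Setoid 0ℓ 0ℓ) where

  open Setoid S using (Carrier; _≈_) renaming (sym to ≈-sym)

  lookup-injective : ∀ {xs : List Carrier} → Unique.Unique S xs →
    ∀ {i j} → lookup xs i ≈ lookup xs j → i ≡ j
  lookup-injective (_ ∷ _)  {zero}  {zero}  _  = refl
  lookup-injective (px ∷ _) {zero}  {suc j} eq = contradiction eq (All.lookup px (∈-lookup j))
  lookup-injective (px ∷ _) {suc i} {zero}  eq = contradiction (≈-sym eq) (All.lookup px (∈-lookup i))
  lookup-injective (_ ∷ u)  {suc i} {suc j} eq = cong suc (lookup-injective u eq)

unlabeledFinite : ∀ n → ∃[ m ] Bijection (setoid (Fin m)) (bicoloredGraphs n)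
unlabeledFinite n = length classes , record
  { to        = lookup classes
  ; cong      = λ { {i} refl → Setoid.refl S {lookup classes i} }
  ; bijective = lookup-injective S (deduplicate-! S? (allGraphs n))
              , lookup-surjective S (deduplicate⁺ S? (allGraphs-complete n))
  }
  where
  S = bicoloredGraphs n
  S? : DecSetoid 0ℓ 0ℓ
  S? = record { isDecEquivalence = record { isEquivalence = Setoid.isEquivalence S ; _≟_ = _≅?_ } }
  classes = deduplicate _≅?_ (allGraphs n)

b̃ : ℕ → ℕ
b̃ n = proj₁ (unlabeledFinite n)

fromℤ : ℤ → ℚ
fromℤ k = mkℚ k 0 (coprime-sym (1-coprimeTo ℤ.∣ k ∣))

fromℕ : ℕ → ℚ
fromℕ n = fromℤ (+ n)

fromℤ≡/1 : ∀ k → k / 1 ≡ fromℤ k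
fromℤ≡/1 k = ↥p/↧p≡p (fromℤ k)

fromℤ-homo-* : ∀ i j → fromℤ (i ℤ.* j) ≡ fromℤ i * fromℤ j
fromℤ-homo-* i j = sym (fromℤ≡/1 (i ℤ.* j))

fromℤ-homo-+ : ∀ i j → fromℤ (i ℤ.+ j) ≡ fromℤ i + fromℤ j
fromℤ-homo-+ i j = sym (trans
  (cong (_/ 1) (cong₂ ℤ._+_ (ℤ.*-identityʳ i) (ℤ.*-identityʳ j))) (fromℤ≡/1 (i ℤ.+ j)))

fromℕ-homo-* : ∀ m n → fromℕ (m ℕ.* n) ≡ fromℕ m * fromℕ n
fromℕ-homo-* m n = trans (cong fromℤ (ℤ.pos-* m n)) (fromℤ-homo-* (+ m) (+ n))

fromℕ-mono-≤ : ∀ {m n} → m ℕ.≤ n → fromℕ m ≤ fromℕ n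
fromℕ-mono-≤ m≤n = *≤* (ℤ.*-monoʳ-≤-nonNeg (+ 1) (ℤ.+≤+ m≤n))

a/d*d≡a : ∀ a j → (+ a / suc j) * fromℕ (suc j) ≡ fromℕ a
a/d*d≡a a j = toℚᵘ-injective (begin
  toℚᵘ ((+ a / suc j) * fromℕ (suc j))
    ≈⟨ toℚᵘ-homo-* (+ a / suc j) (fromℕ (suc j)) ⟩
  toℚᵘ (+ a / suc j) ℚᵘ.* toℚᵘ (fromℕ (suc j))
    ≈⟨ ℚᵘ.*-congʳ {toℚᵘ (fromℕ (suc j))} (toℚᵘ-fromℚᵘ (ℚᵘ.mkℚᵘ (+ a) j)) ⟩
  ℚᵘ.mkℚᵘ (+ a) j ℚᵘ.* ℚᵘ.mkℚᵘ (+ suc j) 0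
    ≈⟨ ℚᵘ.*≡* (trans (ℤ.*-identityʳ _) (cong (λ t → + a ℤ.* + t) (sym (ℕ.*-identityʳ (suc j))))) ⟩
  toℚᵘ (fromℕ a) ∎)
  where open ℚᵘ.≃-Reasoning

δ : ℕ → ℚ
δ i = mkℚ (+ 1) i (1-coprimeTo (suc i))

δ*suc : ∀ i → δ i * fromℕ (suc i) ≡ 1ℚ
δ*suc i = *-inverseˡ (fromℕ (suc i))

archimedean : ∀ ε → 0ℚ < ε → ∃[ N ] ∀ n → N ℕ.≤ n → δ n < ε
archimedean (mkℚ +[1+ p ] d _) _ = suc d , λ n N≤n → *<* (ℤ.+<+
  (subst (ℕ._< suc p ℕ.* suc n) (sym (ℕ.*-identityˡ (suc d)))
    (ℕ.<-≤-trans (ℕ.s<s N≤n) (ℕ.m≤n*m (suc n) (suc p)))))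
archimedean (mkℚ (+ 0) d _) (*<* (ℤ.+<+ ()))
archimedean (mkℚ -[1+ _ ] d _) (*<* ())

0<½*ε : ∀ {ε} → 0ℚ < ε → 0ℚ < ½ * ε
0<½*ε {ε} 0<ε = subst (_< ½ * ε) (*-zeroʳ ½) (*-monoʳ-<-pos ½ 0<ε)

½+½ : ∀ ε → ½ * ε + ½ * ε ≡ ε
½+½ ε = trans (sym (*-distribʳ-+ ε ½ ½)) (*-identityˡ ε)

∣p-q∣-sym : ∀ p q → ∣ p - q ∣ ≡ ∣ q - p ∣
∣p-q∣-sym p q = trans (sym (∣-p∣≡∣p∣ (p - q)))
  (cong ∣_∣ (+-*-Solver.solve 2 (λ a b → :- (a :- b) := b :- a) refl p q))
  where open +-*-Solver

∣p-r∣-triangle : ∀ p q r → ∣ p - r ∣ ≤ ∣ p - q ∣ + ∣ q - r ∣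
∣p-r∣-triangle p q r = subst (λ t → ∣ t ∣ ≤ ∣ p - q ∣ + ∣ q - r ∣)
  (solve 3 (λ a b c → (a :- b) :+ (b :- c) := a :- c) refl p q r)
  (∣p+q∣≤∣p∣+∣q∣ (p - q) (q - r))
  where open +-*-Solver

∣p-r∣<ε : ∀ p q r ε → ∣ p - q ∣ < ½ * ε → ∣ q - r ∣ < ½ * ε → ∣ p - r ∣ < ε
∣p-r∣<ε p q r ε pq qr = ≤-<-trans (∣p-r∣-triangle p q r)
  (subst (∣ p - q ∣ + ∣ q - r ∣ <_) (½+½ ε) (+-mono-< pq qr))

p≤∣p∣ : ∀ p → p ≤ ∣ p ∣
p≤∣p∣ p with ≤-total 0ℚ p
... | inj₁ 0≤p = ≤-reflexive (sym (0≤p⇒∣p∣≡p 0≤p))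
... | inj₂ p≤0 = ≤-trans p≤0 (0≤∣p∣ p)

∣p∣<q : ∀ {p q} → p < q → - p < q → ∣ p ∣ < q
∣p∣<q {p} {q} p<q -p<q with ∣p∣≡p∨∣p∣≡-p p
... | inj₁ e = subst (_< q) (sym e) p<q
... | inj₂ e = subst (_< q) (sym e) -p<q

p<q+r⇒p-q<r : ∀ p q r → p < q + r → p - q < r
p<q+r⇒p-q<r p q r h = subst (p - q <_)
  (solve 2 (λ b c → (b :+ c) :- b := c) refl q r) (+-monoˡ-< (- q) h)
  where open +-*-Solver

p≤q+r⇒p-q≤r : ∀ p q r → p ≤ q + r → p - q ≤ r
p≤q+r⇒p-q≤r p q r h = subst (p - q ≤_)
  (solve 2 (λ b c → (b :+ c) :- b := c) refl q r) (+-monoˡ-≤ (- q) h)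
  where open +-*-Solver

p-q<r⇒p<q+r : ∀ p q r → p - q < r → p < q + r
p-q<r⇒p<q+r p q r h = subst (_< q + r)
  (solve 2 (λ a b → b :+ (a :- b) := a) refl p q) (+-monoʳ-< q h)
  where open +-*-Solver

∣∣p∣-∣q∣∣≤∣p-q∣ : ∀ p q → ∣ ∣ p ∣ - ∣ q ∣ ∣ ≤ ∣ p - q ∣
∣∣p∣-∣q∣∣≤∣p-q∣ p q with ∣p∣≡p∨∣p∣≡-p (∣ p ∣ - ∣ q ∣)
... | inj₁ e = subst (_≤ ∣ p - q ∣) (sym e) (half p q)
  where
  half : ∀ p q → ∣ p ∣ - ∣ q ∣ ≤ ∣ p - q ∣
  half p q = p≤q+r⇒p-q≤r _ _ _ (subst (λ t → ∣ t ∣ ≤ ∣ q ∣ + ∣ p - q ∣)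
    (solve 2 (λ a b → b :+ (a :- b) := a) refl p q) (∣p+q∣≤∣p∣+∣q∣ q (p - q)))
    where open +-*-Solver
... | inj₂ e = subst₂ _≤_ (sym (trans e (solve 2 (λ a b → :- (a :- b) := b :- a) refl ∣ p ∣ ∣ q ∣)))
                 (∣p-q∣-sym q p) (half q p)
  where
  open +-*-Solver
  half : ∀ p q → ∣ p ∣ - ∣ q ∣ ≤ ∣ p - q ∣
  half p q = p≤q+r⇒p-q≤r _ _ _ (subst (λ t → ∣ t ∣ ≤ ∣ q ∣ + ∣ p - q ∣)
    (solve 2 (λ a b → b :+ (a :- b) := a) refl p q) (∣p+q∣≤∣p∣+∣q∣ q (p - q)))

IsCauchy : (ℕ → ℚ) → Set
IsCauchy s = ∀ ε → 0ℚ < ε → ∃[ N ] ∀ m n → N ℕ.≤ m → N ℕ.≤ n → ∣ s m - s n ∣ < ε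

record ℝ : Set where
  constructor mkℝ
  field
    seq    : ℕ → ℚ
    cauchy : IsCauchy seq

open ℝ public

infix  4 _<ᴿ_ _≉0
infixl 6 _+ᴿ_ _-ᴿ_
infixl 7 _*ᴿ_ _/ᴿ_
infixr 8 _^ᴿ_

fromℚ : ℚ → ℝ
fromℚ q = mkℝ (λ _ → q) λ ε 0<ε → 0 , λ _ _ _ _ →
  subst (_< ε) (cong ∣_∣ (sym (+-inverseʳ q))) 0<ε

cauchy₂ : ∀ (x y : ℝ) (z : ℕ → ℚ) →
          (∀ m n → ∣ z m - z n ∣ ≤ ∣ seq x m - seq x n ∣ + ∣ seq y m - seq y n ∣) → IsCauchy z
cauchy₂ x y z z≤ ε 0<ε with cauchy x _ (0<½*ε 0<ε) | cauchy y _ (0<½*ε 0<ε)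
... | M , p | N , q = M ℕ.⊔ N , λ m n h k → ≤-<-trans (z≤ m n) (subst (_ <_) (½+½ ε)
  (+-mono-< (p m n (ℕ.m⊔n≤o⇒m≤o M N h) (ℕ.m⊔n≤o⇒m≤o M N k))
            (q m n (ℕ.m⊔n≤o⇒n≤o M N h) (ℕ.m⊔n≤o⇒n≤o M N k))))

bounded : ∀ (x : ℝ) → ∃[ B ] 0ℚ < B × ∃[ N ] ∀ n → N ℕ.≤ n → ∣ seq x n ∣ < B
bounded x with cauchy x 1ℚ (*<* (ℤ.+<+ ℕ.z<s))
... | N , p = ∣ seq x N ∣ + 1ℚ
            , <-≤-trans (*<* (ℤ.+<+ ℕ.z<s)) (subst (_≤ ∣ seq x N ∣ + 1ℚ) (+-identityˡ 1ℚ)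
                                (+-monoˡ-≤ 1ℚ (0≤∣p∣ (seq x N))))
            , N , λ n N≤n → p-q<r⇒p<q+r _ _ _ (≤-<-trans
                (≤-trans (p≤∣p∣ _) (∣∣p∣-∣q∣∣≤∣p-q∣ (seq x n) (seq x N))) (p n N N≤n ℕ.≤-refl))

shrink : ∀ {ε B} → 0ℚ < ε → 0ℚ < B → ∃[ d ] 0ℚ < d × B * d ≡ ε
shrink {ε} {B} 0<ε 0<B = 1/ B * ε , positive⁻¹ (1/ B * ε)
                       , trans (sym (*-assoc B (1/ B) ε)) (trans (cong (_* ε) (*-inverseʳ B)) (*-identityˡ ε))
  where
  instance
    _ = positive 0<ε
    B⁺ = positive 0<B
    _ = pos⇒nonZero B
    _ = 1/pos⇒pos B
    _ = pos*pos⇒pos (1/ B) ε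

*-mono-≤-< : ∀ {p B q d} → 0ℚ ≤ q → p < B → 0ℚ < B → q < d → p * q < B * d
*-mono-≤-< {p} {B} {q} {d} 0≤q p<B 0<B q<d = ≤-<-trans
  (*-monoʳ-≤-nonNeg q (<⇒≤ p<B)) (*-monoʳ-<-pos B q<d)
  where instance _ = nonNegative 0≤q
                 _ = positive 0<B

*-difference : ∀ x₁ x₂ y₁ y₂ → x₁ * (y₁ - y₂) + y₂ * (x₁ - x₂) ≡ x₁ * y₁ - x₂ * y₂
*-difference = solve 4 (λ x₁ x₂ y₁ y₂ →
  x₁ :* (y₁ :- y₂) :+ y₂ :* (x₁ :- x₂) := x₁ :* y₁ :- x₂ :* y₂) refl
  where open +-*-Solver

*-close : ∀ x₁ x₂ y₁ y₂ A B d e ε → 0ℚ < A → 0ℚ < B → ∣ x₁ ∣ < A → ∣ y₂ ∣ < B →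
          ∣ y₁ - y₂ ∣ < d → ∣ x₁ - x₂ ∣ < e → A * d ≡ ½ * ε → B * e ≡ ½ * ε →
          ∣ x₁ * y₁ - x₂ * y₂ ∣ < ε
*-close x₁ x₂ y₁ y₂ A B d e ε 0<A 0<B x₁<A y₂<B y<d x<e Ad≡ Be≡ = begin-strict
  ∣ x₁ * y₁ - x₂ * y₂ ∣                          ≡⟨ cong ∣_∣ (*-difference x₁ x₂ y₁ y₂) ⟨
  ∣ x₁ * (y₁ - y₂) + y₂ * (x₁ - x₂) ∣            ≤⟨ ∣p+q∣≤∣p∣+∣q∣ (x₁ * (y₁ - y₂)) (y₂ * (x₁ - x₂)) ⟩
  ∣ x₁ * (y₁ - y₂) ∣ + ∣ y₂ * (x₁ - x₂) ∣        ≡⟨ cong₂ _+_ (∣p*q∣≡∣p∣*∣q∣ x₁ (y₁ - y₂)) (∣p*q∣≡∣p∣*∣q∣ y₂ (x₁ - x₂)) ⟩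
  ∣ x₁ ∣ * ∣ y₁ - y₂ ∣ + ∣ y₂ ∣ * ∣ x₁ - x₂ ∣
    <⟨ +-mono-< (*-mono-≤-< {∣ x₁ ∣} {A} (0≤∣p∣ (y₁ - y₂)) x₁<A 0<A y<d)
                (*-mono-≤-< {∣ y₂ ∣} {B} (0≤∣p∣ (x₁ - x₂)) y₂<B 0<B x<e) ⟩
  A * d + B * e                                  ≡⟨ cong₂ _+_ Ad≡ Be≡ ⟩
  ½ * ε + ½ * ε                                  ≡⟨ ½+½ ε ⟩
  ε                                              ∎
  where open ≤-Reasoning

_+ᴿ_ : ℝ → ℝ → ℝ
x +ᴿ y = mkℝ (λ n → seq x n + seq y n) (cauchy₂ x y (λ n → seq x n + seq y n) λ m n → subst
  (λ t → ∣ t ∣ ≤ ∣ seq x m - seq x n ∣ + ∣ seq y m - seq y n ∣)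
  (solve 4 (λ a b c d → (a :- c) :+ (b :- d) := (a :+ b) :- (c :+ d)) refl (seq x m) (seq y m) (seq x n) (seq y n))
  (∣p+q∣≤∣p∣+∣q∣ (seq x m - seq x n) (seq y m - seq y n)))
  where open +-*-Solver

_-ᴿ_ : ℝ → ℝ → ℝ
x -ᴿ y = mkℝ (λ n → seq x n - seq y n) (cauchy₂ x y (λ n → seq x n - seq y n) λ m n → subst
  (λ t → ∣ t ∣ ≤ ∣ seq x m - seq x n ∣ + ∣ seq y m - seq y n ∣)
  (solve 4 (λ a b c d → (a :- c) :- (b :- d) := (a :- b) :- (c :- d)) refl (seq x m) (seq y m) (seq x n) (seq y n))
  (∣p-q∣≤∣p∣+∣q∣ (seq x m - seq x n) (seq y m - seq y n)))
  where open +-*-Solver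

∣_∣ᴿ : ℝ → ℝ
∣ x ∣ᴿ = mkℝ (λ n → ∣ seq x n ∣) λ ε 0<ε →
  let N , p = cauchy x ε 0<ε in
  N , λ m n h k → ≤-<-trans (∣∣p∣-∣q∣∣≤∣p-q∣ (seq x m) (seq x n)) (p m n h k)

_*ᴿ_ : ℝ → ℝ → ℝ
x *ᴿ y = mkℝ (λ n → seq x n * seq y n) go
  where
  go : IsCauchy (λ n → seq x n * seq y n)
  go ε 0<ε =
    let A , 0<A , L , a = bounded x
        B , 0<B , M , b = bounded y
        d , 0<d , Ad≡   = shrink {½ * ε} {A} (0<½*ε 0<ε) 0<A
        e , 0<e , Be≡   = shrink {½ * ε} {B} (0<½*ε 0<ε) 0<B
        N , p = cauchy y d 0<d
        O , q = cauchy x e 0<e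
    in (L ℕ.⊔ M) ℕ.⊔ (N ℕ.⊔ O) , λ m n h k →
    *-close (seq x m) (seq x n) (seq y m) (seq y n) A B d e ε 0<A 0<B
      (a m (ℕ.m⊔n≤o⇒m≤o L M (ℕ.m⊔n≤o⇒m≤o (L ℕ.⊔ M) (N ℕ.⊔ O) h))) (b n (ℕ.m⊔n≤o⇒n≤o L M (ℕ.m⊔n≤o⇒m≤o (L ℕ.⊔ M) (N ℕ.⊔ O) k)))
      (p m n (ℕ.m⊔n≤o⇒m≤o N O (ℕ.m⊔n≤o⇒n≤o (L ℕ.⊔ M) (N ℕ.⊔ O) h)) (ℕ.m⊔n≤o⇒m≤o N O (ℕ.m⊔n≤o⇒n≤o (L ℕ.⊔ M) (N ℕ.⊔ O) k)))
      (q m n (ℕ.m⊔n≤o⇒n≤o N O (ℕ.m⊔n≤o⇒n≤o (L ℕ.⊔ M) (N ℕ.⊔ O) h)) (ℕ.m⊔n≤o⇒n≤o N O (ℕ.m⊔n≤o⇒n≤o (L ℕ.⊔ M) (N ℕ.⊔ O) k)))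
      Ad≡ Be≡

_<ᴿ_ : ℝ → ℝ → Set
x <ᴿ y = ∃[ δ ] 0ℚ < δ × ∃[ N ] ∀ n → N ℕ.≤ n → seq x n + δ ≤ seq y n

_≉0 : ℝ → Set
x ≉0 = fromℚ 0ℚ <ᴿ ∣ x ∣ᴿ

-- The junk value at 0 occurs only finitely often along a Cauchy sequence
-- representing a real apart from 0.
recip : ℚ → ℚ
recip (mkℚ (+ 0) _ _)        = 0ℚ
recip p@(mkℚ +[1+ _ ] _ _) = 1/ p
recip p@(mkℚ -[1+ _ ] _ _) = 1/ p

recip-inverse : ∀ {d} p → 0ℚ < d → d ≤ ∣ p ∣ → p * recip p ≡ 1ℚ
recip-inverse p@(mkℚ +[1+ _ ] _ _) _ _ = *-inverseʳ p
recip-inverse p@(mkℚ -[1+ _ ] _ _) _ _ = *-inverseʳ p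
recip-inverse (mkℚ (+ 0) _ _) 0<d d≤ with <-≤-trans 0<d d≤
... | *<* (ℤ.+<+ ())

recip-contract : ∀ {d ε} p q → 0ℚ < d → d ≤ ∣ p ∣ → d ≤ ∣ q ∣ →
                 ∣ p - q ∣ < d * d * ε → 0ℚ < ε → ∣ recip p - recip q ∣ < ε
recip-contract {d} {ε} p q 0<d d≤p d≤q h 0<ε = *-cancelˡ-<-nonNeg (∣ p ∣ * ∣ q ∣)
  (≤-<-trans (≤-reflexive eq) (<-≤-trans h (*-monoʳ-≤-nonNeg ε d²≤)))
  where
  open ≡-Reasoning
  open +-*-Solver using (solve; _:=_; _:*_; _:-_)
  instance
    _ = nonNegative (<⇒≤ 0<ε)
    _ = nonNegative (0≤∣p∣ p)
    _ = nonNegative (0≤∣p∣ q)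
    _ = nonNegative (<⇒≤ 0<d)
    _ = nonNeg*nonNeg⇒nonNeg ∣ p ∣ ∣ q ∣
  d²≤ : d * d ≤ ∣ p ∣ * ∣ q ∣
  d²≤ = ≤-trans (*-monoʳ-≤-nonNeg d d≤p) (*-monoˡ-≤-nonNeg ∣ p ∣ d≤q)
  eq : ∣ p ∣ * ∣ q ∣ * ∣ recip p - recip q ∣ ≡ ∣ p - q ∣
  eq = begin
    ∣ p ∣ * ∣ q ∣ * ∣ recip p - recip q ∣
      ≡⟨ cong (_* ∣ recip p - recip q ∣) (∣p*q∣≡∣p∣*∣q∣ p q) ⟨
    ∣ p * q ∣ * ∣ recip p - recip q ∣ ≡⟨ ∣p*q∣≡∣p∣*∣q∣ (p * q) _ ⟨
    ∣ p * q * (recip p - recip q) ∣ ≡⟨ cong ∣_∣ (solve 4 (λ p q r s →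
       p :* q :* (r :- s) := (p :* r) :* q :- (q :* s) :* p) refl p q (recip p) (recip q)) ⟩
    ∣ p * recip p * q - q * recip q * p ∣ ≡⟨ cong₂ (λ u v → ∣ u * q - v * p ∣)
       (recip-inverse p 0<d d≤p) (recip-inverse q 0<d d≤q) ⟩
    ∣ 1ℚ * q - 1ℚ * p ∣ ≡⟨ cong₂ (λ u v → ∣ u - v ∣) (*-identityˡ q) (*-identityˡ p) ⟩
    ∣ q - p ∣ ≡⟨ ∣p-q∣-sym q p ⟩
    ∣ p - q ∣ ∎

inverse : (x : ℝ) → x ≉0 → ℝ
inverse x (d , 0<d , N , d≤) = mkℝ (λ n → recip (seq x n)) go
  where
  instance
    _ = positive 0<d
  go : IsCauchy (λ n → recip (seq x n))
  go ε 0<ε = (N ℕ.⊔ proj₁ c) , λ m n h k → recip-contract (seq x m) (seq x n) 0<d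
    (subst (_≤ _) (+-identityˡ d) (d≤ m (ℕ.m⊔n≤o⇒m≤o N (proj₁ c) h)))
    (subst (_≤ _) (+-identityˡ d) (d≤ n (ℕ.m⊔n≤o⇒m≤o N (proj₁ c) k)))
    (proj₂ c m n (ℕ.m⊔n≤o⇒n≤o N (proj₁ c) h) (ℕ.m⊔n≤o⇒n≤o N (proj₁ c) k)) 0<ε
    where
    instance
      _ = positive 0<ε
      _ = pos*pos⇒pos d d
      _ = pos*pos⇒pos (d * d) ε
    c = cauchy x (d * d * ε) (positive⁻¹ (d * d * ε))

_/ᴿ_ : ℝ → (m : ℕ) → .{{ℕ.NonZero m}} → ℝ
x /ᴿ m = x *ᴿ fromℚ (+ 1 / m)

_^ᴿ_ : ℝ → ℕ → ℝ
x ^ᴿ zero  = fromℚ 1ℚ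
x ^ᴿ suc n = x *ᴿ (x ^ᴿ n)

infix 4 _⟶_ _∼_

_⟶_ : (ℕ → ℝ) → ℝ → Set
x ⟶ L = ∀ ε → 0ℚ < ε → ∃[ N ] ∀ n → N ℕ.≤ n → ∣ x n -ᴿ L ∣ᴿ <ᴿ fromℚ ε

-- A real quotient needs its denominator apart from 0, so that every y n is so
-- is part of the assertion.
_∼_ : (ℕ → ℝ) → (ℕ → ℝ) → Set
x ∼ y = Σ[ y≉0 ∈ (∀ n → y n ≉0) ] (λ n → x n *ᴿ inverse (y n) (y≉0 n)) ⟶ fromℚ 1ℚ

IsCauchyᴿ : (ℕ → ℝ) → Set
IsCauchyᴿ x = ∀ ε → 0ℚ < ε → ∃[ N ] ∀ m n → N ℕ.≤ m → N ℕ.≤ n → ∣ x m -ᴿ x n ∣ᴿ <ᴿ fromℚ ε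

<ᴿ⇒< : ∀ {x ε} → x <ᴿ fromℚ ε → ∃[ N ] ∀ n → N ℕ.≤ n → seq x n < ε
<ᴿ⇒< {x} {ε} (d , 0<d , N , p) = N , λ n h → <-≤-trans
  (subst (_< seq x n + d) (+-identityʳ (seq x n)) (+-monoʳ-< (seq x n) 0<d)) (p n h)

-- Index from which on the terms of x k stay within 1 / (k + 1).
ix : (ℕ → ℝ) → ℕ → ℕ
ix x k = proj₁ (cauchy (x k) (δ k) (*<* (ℤ.+<+ ℕ.z<s)))

ix-close : ∀ x k m n → ix x k ℕ.≤ m → ix x k ℕ.≤ n → ∣ seq (x k) m - seq (x k) n ∣ < δ k
ix-close x k = proj₂ (cauchy (x k) (δ k) (*<* (ℤ.+<+ ℕ.z<s)))

diagonal : (ℕ → ℝ) → ℕ → ℚ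
diagonal x k = seq (x k) (ix x k)

diagonal-close : ∀ x → IsCauchyᴿ x → ∀ ε → 0ℚ < ε →
  ∃[ N ] ∀ m n → N ℕ.≤ m → N ℕ.≤ n → ∃[ J ] ∀ j → J ℕ.≤ j → ∣ seq (x m) j - diagonal x n ∣ < ε
diagonal-close x c ε 0<ε =
  let N , p = c (½ * ε) (0<½*ε 0<ε)
      A , a = archimedean (½ * ε) (0<½*ε 0<ε)
  in N ℕ.⊔ A , λ m n h k →
  let O , q = <ᴿ⇒< {∣ x m -ᴿ x n ∣ᴿ} (p m n (ℕ.m⊔n≤o⇒m≤o N A h) (ℕ.m⊔n≤o⇒m≤o N A k))
  in O ℕ.⊔ ix x n , λ j l →
    ∣p-r∣<ε (seq (x m) j) (seq (x n) j) (diagonal x n) ε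
      (q j (ℕ.m⊔n≤o⇒m≤o O (ix x n) l))
      (<-trans (ix-close x n j (ix x n) (ℕ.m⊔n≤o⇒n≤o O (ix x n) l) ℕ.≤-refl)
               (a n (ℕ.m⊔n≤o⇒n≤o N A k)))

lim : (x : ℕ → ℝ) → IsCauchyᴿ x → ℝ
lim x c = mkℝ (diagonal x) go
  where
  go : IsCauchy (diagonal x)
  go ε 0<ε = let N , p = diagonal-close x c (½ * ε) (0<½*ε 0<ε) in N , λ m n h k →
    let J , q = p m m h h ; K , r = p m n h k ; j = J ℕ.⊔ K in
    ∣p-r∣<ε (diagonal x m) (seq (x m) j) (diagonal x n) ε
      (subst (_< ½ * ε) (∣p-q∣-sym (seq (x m) j) (diagonal x m)) (q j (ℕ.m≤m⊔n J K)))
      (r j (ℕ.m≤n⊔m J K))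

⟶-lim : ∀ x c → x ⟶ lim x c
⟶-lim x c ε 0<ε =
  let N , p = diagonal-close x c (½ * (½ * ε)) (0<½*ε (0<½*ε 0<ε))
      M , q = cauchy (lim x c) (½ * (½ * ε)) (0<½*ε (0<½*ε 0<ε))
  in N ℕ.⊔ M , λ n h →
  let J , r = p n n (ℕ.m⊔n≤o⇒m≤o N M h) (ℕ.m⊔n≤o⇒m≤o N M h) in
  ½ * ε , 0<½*ε 0<ε , J ℕ.⊔ M , λ j l →
    subst (∣ seq (x n) j - diagonal x j ∣ + ½ * ε ≤_) (½+½ ε) (+-monoˡ-≤ (½ * ε)
      (<⇒≤ (∣p-r∣<ε (seq (x n) j) (diagonal x n) (diagonal x j) (½ * ε)
        (r j (ℕ.m⊔n≤o⇒m≤o J M l))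
        (q n j (ℕ.m⊔n≤o⇒n≤o N M h) (ℕ.m⊔n≤o⇒n≤o J M l)))))

-- The terms with |k| ≤ K; for nonnegative terms the limit over K is the
-- (unconditional) sum over ℤ.
partialSum : (ℤ → ℝ) → ℕ → ℝ
partialSum a zero    = a (+ 0)
partialSum a (suc K) = partialSum a K +ᴿ (a (+ suc K) +ᴿ a -[1+ K ])

Summable : (ℤ → ℝ) → Set
Summable a = IsCauchyᴿ (partialSum a)

∑ℤ : (a : ℤ → ℝ) → Summable a → ℝ
∑ℤ a s = lim (partialSum a) s

-- Least a in [a₀, a₀ + fuel) with 2 · d ^ q ≤ a ^ q, and a₀ + fuel if none.
search : (q d fuel a₀ : ℕ) → ℕ
search q d zero     a = a
search q d (suc f) a with 2 ℕ.* d ℕ.^ q ℕ.≤? a ℕ.^ q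
... | yes _ = a
... | no  _ = search q d f (suc a)

search-upper : ∀ q d f a → 2 ℕ.* d ℕ.^ q ℕ.≤ (f ℕ.+ a) ℕ.^ q →
               2 ℕ.* d ℕ.^ q ℕ.≤ search q d f a ℕ.^ q
search-upper q d zero    a h = h
search-upper q d (suc f) a h with 2 ℕ.* d ℕ.^ q ℕ.≤? a ℕ.^ q
... | yes p = p
... | no  _ = search-upper q d f (suc a)
                (subst (λ t → 2 ℕ.* d ℕ.^ q ℕ.≤ t ℕ.^ q) (sym (ℕ.+-suc f a)) h)

search-least : ∀ q d f a → (∀ b → b ℕ.< a → b ℕ.^ q ℕ.< 2 ℕ.* d ℕ.^ q) →
               ∀ b → b ℕ.< search q d f a → b ℕ.^ q ℕ.< 2 ℕ.* d ℕ.^ q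
search-least q d zero    a h = h
search-least q d (suc f) a h with 2 ℕ.* d ℕ.^ q ℕ.≤? a ℕ.^ q
... | yes _ = h
... | no ¬p = search-least q d f (suc a) h′
  where
  h′ : ∀ b → b ℕ.< suc a → b ℕ.^ q ℕ.< 2 ℕ.* d ℕ.^ q
  h′ b (ℕ.s≤s b≤a) with ℕ.m≤n⇒m<n∨m≡n b≤a
  ... | inj₁ b<a  = h b b<a
  ... | inj₂ refl = ℕ.≰⇒> ¬p

^-*-distribˡ : ∀ a b q → (a ℕ.* b) ℕ.^ q ≡ a ℕ.^ q ℕ.* b ℕ.^ q
^-*-distribˡ a b zero    = refl
^-*-distribˡ a b (suc q) = trans (cong (a ℕ.* b ℕ.*_) (^-*-distribˡ a b q))
  (ℕ.[m*n]*[o*p]≡[m*o]*[n*p] a b (a ℕ.^ q) (b ℕ.^ q))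

-- ⌈ d · 2^(1/(q+1)) ⌉
⌈_·2^1/1+_⌉ : ℕ → ℕ → ℕ
⌈ d ·2^1/1+ q ⌉ = search (suc q) d (2 ℕ.* d) 0

⌈·2^1/⌉-upper : ∀ d q → 2 ℕ.* d ℕ.^ suc q ℕ.≤ ⌈ d ·2^1/1+ q ⌉ ℕ.^ suc q
⌈·2^1/⌉-upper d q = search-upper (suc q) d (2 ℕ.* d) 0
  (subst (λ t → 2 ℕ.* d ℕ.^ suc q ℕ.≤ t ℕ.^ suc q) (sym (ℕ.+-identityʳ (2 ℕ.* d)))
    (subst (2 ℕ.* d ℕ.^ suc q ℕ.≤_) (sym (^-*-distribˡ 2 d (suc q)))
      (ℕ.*-monoˡ-≤ (d ℕ.^ suc q) (ℕ.m≤m*n 2 (2 ℕ.^ q) {{ℕ.m^n≢0 2 q}}))))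

⌈·2^1/⌉-least : ∀ d q b → b ℕ.< ⌈ d ·2^1/1+ q ⌉ → b ℕ.^ suc q ℕ.< 2 ℕ.* d ℕ.^ suc q
⌈·2^1/⌉-least d q = search-least (suc q) d (2 ℕ.* d) 0 λ _ ()

rootSeq : ℕ → ℕ → ℚ
rootSeq q j = + ⌈ suc j ·2^1/1+ q ⌉ / suc j

^-cancel-< : ∀ q m n → m ℕ.^ suc q ℕ.< n ℕ.^ suc q → m ℕ.< n
^-cancel-< q m n h with ℕ.<-≤-connex m n
... | inj₁ m<n = m<n
... | inj₂ n≤m = contradiction (ℕ.^-monoˡ-≤ (suc q) n≤m) (ℕ.<⇒≱ h)

ceil-close : ∀ q I J → .{{ℕ.NonZero J}} →
  ⌈ I ·2^1/1+ q ⌉ ℕ.* J ℕ.≤ ⌈ J ·2^1/1+ q ⌉ ℕ.* I ℕ.+ J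
ceil-close q I J {{nz}} with ⌈ I ·2^1/1+ q ⌉ | ⌈·2^1/⌉-least I q
... | zero  | _ = ℕ.z≤n
... | suc a | least = subst (ℕ._≤ ⌈ J ·2^1/1+ q ⌉ ℕ.* I ℕ.+ J) (ℕ.+-comm (a ℕ.* J) J)
  (ℕ.+-monoˡ-≤ J (ℕ.<⇒≤ (^-cancel-< q (a ℕ.* J) (⌈ J ·2^1/1+ q ⌉ ℕ.* I) (begin-strict
    (a ℕ.* J) ℕ.^ suc q               ≡⟨ ^-*-distribˡ a J (suc q) ⟩
    a ℕ.^ suc q ℕ.* J ℕ.^ suc q       <⟨ ℕ.*-monoˡ-< (J ℕ.^ suc q) {{ℕ.m^n≢0 J (suc q)}} (least a ℕ.≤-refl) ⟩
    2 ℕ.* I ℕ.^ suc q ℕ.* J ℕ.^ suc q ≡⟨ ℕ.*-assoc 2 (I ℕ.^ suc q) _ ⟩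
    2 ℕ.* (I ℕ.^ suc q ℕ.* J ℕ.^ suc q) ≡⟨ cong (2 ℕ.*_) (ℕ.*-comm (I ℕ.^ suc q) _) ⟩
    2 ℕ.* (J ℕ.^ suc q ℕ.* I ℕ.^ suc q) ≡⟨ ℕ.*-assoc 2 (J ℕ.^ suc q) _ ⟨
    2 ℕ.* J ℕ.^ suc q ℕ.* I ℕ.^ suc q ≤⟨ ℕ.*-monoˡ-≤ (I ℕ.^ suc q) (⌈·2^1/⌉-upper J q) ⟩
    ⌈ J ·2^1/1+ q ⌉ ℕ.^ suc q ℕ.* I ℕ.^ suc q ≡⟨ ^-*-distribˡ ⌈ J ·2^1/1+ q ⌉ I (suc q) ⟨
    (⌈ J ·2^1/1+ q ⌉ ℕ.* I) ℕ.^ suc q ∎))))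
  where open ℕ.≤-Reasoning

rootSeq-close : ∀ q i j → rootSeq q i ≤ rootSeq q j + δ i
rootSeq-close q i j = *-cancelʳ-≤-pos (I * J) (subst₂ _≤_ lhs rhs
  (fromℕ-mono-≤ (ceil-close q (suc i) (suc j))))
  where
  open ≡-Reasoning
  open +-*-Solver using (solve; _:=_; _:*_; _:+_)
  I = fromℕ (suc i)
  J = fromℕ (suc j)
  a = ⌈ suc i ·2^1/1+ q ⌉
  b = ⌈ suc j ·2^1/1+ q ⌉
  instance _ = pos*pos⇒pos I J
  lhs : fromℕ (a ℕ.* suc j) ≡ rootSeq q i * (I * J)
  lhs = begin
    fromℕ (a ℕ.* suc j)     ≡⟨ fromℕ-homo-* a (suc j) ⟩
    fromℕ a * J             ≡⟨ cong (_* J) (a/d*d≡a a i) ⟨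
    rootSeq q i * I * J     ≡⟨ *-assoc (rootSeq q i) I J ⟩
    rootSeq q i * (I * J)   ∎
  rhs : fromℕ (b ℕ.* suc i ℕ.+ suc j) ≡ (rootSeq q j + δ i) * (I * J)
  rhs = begin
    fromℕ (b ℕ.* suc i ℕ.+ suc j)          ≡⟨ fromℤ-homo-+ (+ (b ℕ.* suc i)) (+ suc j) ⟩
    fromℕ (b ℕ.* suc i) + J                ≡⟨ cong₂ _+_ (fromℕ-homo-* b (suc i)) (sym (*-identityˡ J)) ⟩
    fromℕ b * I + 1ℚ * J                   ≡⟨ cong₂ (λ u v → u * I + v * J) (a/d*d≡a b j) (δ*suc i) ⟨
    rootSeq q j * J * I + δ i * I * J      ≡⟨ solve 4 (λ r J I d →
       r :* J :* I :+ d :* I :* J := (r :+ d) :* (I :* J)) refl (rootSeq q j) J I (δ i) ⟩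
    (rootSeq q j + δ i) * (I * J)          ∎

root2 : ℕ → ℝ
root2 q = mkℝ (rootSeq q) λ ε 0<ε → let N , p = archimedean ε 0<ε in
  N , λ m n h k → ∣p∣<q
    (≤-<-trans (p≤q+r⇒p-q≤r _ _ _ (rootSeq-close q m n)) (p m h))
    (subst (_< ε) (solve 2 (λ a b → b :- a := :- (a :- b)) refl (rootSeq q m) (rootSeq q n))
      (≤-<-trans (p≤q+r⇒p-q≤r _ _ _ (rootSeq-close q n m)) (p n k)))
  where open +-*-Solver

d≤ceil : ∀ d q → d ℕ.≤ ⌈ d ·2^1/1+ q ⌉
d≤ceil zero    q = ℕ.z≤n
d≤ceil (suc j) q = ℕ.<⇒≤ (^-cancel-< q (suc j) _ (ℕ.<-≤-trans
  (subst (suc j ℕ.^ suc q ℕ.<_) (ℕ.*-comm (suc j ℕ.^ suc q) 2)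
    (ℕ.m<m*n (suc j ℕ.^ suc q) 2 {{ℕ.m^n≢0 (suc j) (suc q)}} (ℕ.s≤s (ℕ.s≤s ℕ.z≤n)))) (⌈·2^1/⌉-upper (suc j) q)))

1≤rootSeq : ∀ q j → 1ℚ ≤ rootSeq q j
1≤rootSeq q j = *-cancelʳ-≤-pos (fromℕ (suc j)) (subst₂ _≤_
  (sym (*-identityˡ (fromℕ (suc j)))) (sym (a/d*d≡a _ j)) (fromℕ-mono-≤ (d≤ceil (suc j) q)))

root2≉0 : ∀ q → root2 q ≉0
root2≉0 q = 1ℚ , *<* (ℤ.+<+ ℕ.z<s) , 0 , λ n _ →
  ≤-trans (1≤rootSeq q n) (p≤∣p∣ (rootSeq q n))

-- root2 q is the (q+1)-th root of 2, and mkℚ p q _ is the fraction p / (q+1).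
infix 9 2^_
2^_ : ℚ → ℝ
2^ mkℚ (+ p)    q _ = root2 q ^ᴿ p
2^ mkℚ -[1+ p ] q _ = inverse (root2 q) (root2≉0 q) ^ᴿ suc p

pow : ℚ → ℕ → ℚ
pow x zero    = 1ℚ
pow x (suc n) = x * pow x n

seq-^ᴿ : ∀ x n j → seq (x ^ᴿ n) j ≡ pow (seq x j) n
seq-^ᴿ x zero    j = refl
seq-^ᴿ x (suc n) j = cong (seq x j *_) (seq-^ᴿ x n j)

pow-+ : ∀ x m n → pow x (m ℕ.+ n) ≡ pow x m * pow x n
pow-+ x zero    n = sym (*-identityˡ _)
pow-+ x (suc m) n = trans (cong (x *_) (pow-+ x m n)) (sym (*-assoc x _ _))

pow-* : ∀ x y n → pow (x * y) n ≡ pow x n * pow y n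
pow-* x y zero    = refl
pow-* x y (suc n) = trans (cong (x * y *_) (pow-* x y n))
  (solve 4 (λ a b c d → a :* b :* (c :* d) := a :* c :* (b :* d)) refl x y (pow x n) (pow y n))
  where open +-*-Solver

pow-1 : ∀ n → pow 1ℚ n ≡ 1ℚ
pow-1 zero    = refl
pow-1 (suc n) = trans (*-identityˡ _) (pow-1 n)

pow-fromℕ : ∀ a n → pow (fromℕ a) n ≡ fromℕ (a ℕ.^ n)
pow-fromℕ a zero    = refl
pow-fromℕ a (suc n) = trans (cong (fromℕ a *_) (pow-fromℕ a n)) (sym (fromℕ-homo-* a (a ℕ.^ n)))

0≤* : ∀ {p q} → 0ℚ ≤ p → 0ℚ ≤ q → 0ℚ ≤ p * q
0≤* {p} {q} 0≤p 0≤q = nonNegative⁻¹ (p * q) {{nonNeg*nonNeg⇒nonNeg p {{nonNegative 0≤p}} q {{nonNegative 0≤q}}}}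

*-mono : ∀ {p q r s} → 0ℚ ≤ r → 0ℚ ≤ q → p ≤ q → r ≤ s → p * r ≤ q * s
*-mono {p} {q} {r} 0≤r 0≤q p≤q r≤s = ≤-trans
  (*-monoʳ-≤-nonNeg r {{nonNegative 0≤r}} p≤q) (*-monoˡ-≤-nonNeg q {{nonNegative 0≤q}} r≤s)

0≤1 : 0ℚ ≤ 1ℚ
0≤1 = *≤* (ℤ.+≤+ ℕ.z≤n)

0≤½ : 0ℚ ≤ ½
0≤½ = *≤* (ℤ.+≤+ ℕ.z≤n)

0≤pow : ∀ {x} n → 0ℚ ≤ x → 0ℚ ≤ pow x n
0≤pow zero    _   = 0≤1
0≤pow (suc n) 0≤x = 0≤* 0≤x (0≤pow n 0≤x)

pow≤1 : ∀ {x} n → 0ℚ ≤ x → x ≤ 1ℚ → pow x n ≤ 1ℚ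
pow≤1 zero    _   _   = ≤-refl
pow≤1 (suc n) 0≤x x≤1 = *-mono (0≤pow n 0≤x) 0≤1 x≤1 (pow≤1 n 0≤x x≤1)

2≤rootSeq^ : ∀ q j → fromℕ 2 ≤ pow (rootSeq q j) (suc q)
2≤rootSeq^ q j = *-cancelʳ-≤-pos D {{D⁺}} (subst₂ _≤_
  (fromℕ-homo-* 2 (suc j ℕ.^ suc q)) eq
  (fromℕ-mono-≤ (⌈·2^1/⌉-upper (suc j) q)))
  where
  open ≡-Reasoning
  D = fromℕ (suc j ℕ.^ suc q)
  a = ⌈ suc j ·2^1/1+ q ⌉
  D⁺ : Positive D
  D⁺ = positive {D} (*<* (subst₂ ℤ._<_ (sym (ℤ.*-zeroˡ (+ 1))) (sym (ℤ.*-identityʳ _)) (ℤ.+<+ (ℕ.m^n>0 (suc j) (suc q)))))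
  eq : fromℕ (a ℕ.^ suc q) ≡ pow (rootSeq q j) (suc q) * D
  eq = begin
    fromℕ (a ℕ.^ suc q)                              ≡⟨ pow-fromℕ a (suc q) ⟨
    pow (fromℕ a) (suc q)                            ≡⟨ cong (λ t → pow t (suc q)) (a/d*d≡a a j) ⟨
    pow (rootSeq q j * fromℕ (suc j)) (suc q)        ≡⟨ pow-* (rootSeq q j) (fromℕ (suc j)) (suc q) ⟩
    pow (rootSeq q j) (suc q) * pow (fromℕ (suc j)) (suc q)
      ≡⟨ cong (pow (rootSeq q j) (suc q) *_) (pow-fromℕ (suc j) (suc q)) ⟩
    pow (rootSeq q j) (suc q) * D ∎

module _ (q j : ℕ) where

  private
    ρ = rootSeq q j
    σ = recip ρ

  0<ρ : 0ℚ < ρ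
  0<ρ = <-≤-trans (*<* (ℤ.+<+ ℕ.z<s)) (1≤rootSeq q j)

  ρσ≡1 : ρ * σ ≡ 1ℚ
  ρσ≡1 = recip-inverse {1ℚ} ρ (*<* (ℤ.+<+ ℕ.z<s)) (≤-trans (1≤rootSeq q j) (p≤∣p∣ ρ))

  0≤σ : 0ℚ ≤ σ
  0≤σ = *-cancelˡ-≤-pos ρ {{positive 0<ρ}} (subst₂ _≤_ (sym (*-zeroʳ ρ)) (sym ρσ≡1) 0≤1)

  σ≤1 : σ ≤ 1ℚ
  σ≤1 = subst₂ _≤_ (*-identityˡ σ) ρσ≡1 (*-monoʳ-≤-nonNeg σ {{nonNegative 0≤σ}} (1≤rootSeq q j))

  σ^≤½ : pow σ (suc q) ≤ ½
  σ^≤½ = *-cancelˡ-≤-pos (fromℕ 2) (subst (fromℕ 2 * pow σ (suc q) ≤_)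
    (trans (sym (pow-* ρ σ (suc q))) (trans (cong (λ t → pow t (suc q)) ρσ≡1) (pow-1 (suc q))))
    (*-monoʳ-≤-nonNeg (pow σ (suc q)) {{nonNegative (0≤pow (suc q) 0≤σ)}} (2≤rootSeq^ q j)))

  σ^-bound : ∀ m r → pow σ (m ℕ.* suc q ℕ.+ r) ≤ pow ½ m
  σ^-bound zero    r = pow≤1 r 0≤σ σ≤1
  σ^-bound (suc m) r = subst (_≤ pow ½ (suc m))
    (sym (trans (cong (pow σ) (ℕ.+-assoc (suc q) (m ℕ.* suc q) r)) (pow-+ σ (suc q) (m ℕ.* suc q ℕ.+ r))))
    (*-mono (0≤pow (m ℕ.* suc q ℕ.+ r) 0≤σ) 0≤½ σ^≤½ (σ^-bound m r))

2^-bound : ∀ x m → x ≤ - fromℕ m → ∀ j → 0ℚ ≤ seq (2^ x) j × seq (2^ x) j ≤ pow ½ m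
2^-bound (mkℚ -[1+ p ] q c) m h j = subst (λ t → 0ℚ ≤ t × t ≤ pow ½ m)
  (sym (seq-^ᴿ (inverse (root2 q) (root2≉0 q)) (suc p) j))
  (0≤pow (suc p) (0≤σ q j)
  , subst (λ t → pow (recip (rootSeq q j)) t ≤ pow ½ m) (ℕ.m+[n∸m]≡n (mq≤p m h)) (σ^-bound q j m (suc p ℕ.∸ m ℕ.* suc q)))
  where
  mq≤p : ∀ m → mkℚ -[1+ p ] q c ≤ - fromℕ m → m ℕ.* suc q ℕ.≤ suc p
  mq≤p zero    _ = ℕ.z≤n
  mq≤p (suc m) (*≤* h) = subst (suc m ℕ.* suc q ℕ.≤_) (ℕ.*-identityʳ (suc p))
    (ℤ.drop‿+≤+ (subst₂ ℤ._≤_ refl refl (ℤ.neg-mono-≤ h)))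
2^-bound (mkℚ (+ 0) q c) zero h j = 0≤1 , ≤-refl
2^-bound (mkℚ (+ 0) q c) (suc m) (*≤* ()) j
2^-bound (mkℚ +[1+ p ] q c) zero (*≤* (ℤ.+≤+ ())) j
2^-bound (mkℚ +[1+ p ] q c) (suc m) (*≤* ()) j

-- Bounds the terms with |k| > K of a series whose ±(j+1)-th terms are at most ½ʲ.
tail : ℕ → ℚ
tail K = fromℕ 4 * pow ½ K

tail-step : ∀ s h → s + (h + h) + fromℕ 4 * (½ * h) ≡ s + fromℕ 4 * h
tail-step = solve 2 (λ s h →
  s :+ (h :+ h) :+ con (fromℕ 4) :* (con ½ :* h) := s :+ con (fromℕ 4) :* h) refl
  where open +-*-Solver

0≤tail : ∀ K → 0ℚ ≤ tail K
0≤tail K = 0≤* {fromℕ 4} {pow ½ K} (*≤* (ℤ.+≤+ ℕ.z≤n)) (0≤pow K 0≤½)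

-- n · ½ⁿ ≤ 1
n*½^n≤1 : ∀ n → fromℕ n * pow ½ n ≤ 1ℚ
n*½^n≤1 n = subst (fromℕ n * pow ½ n ≤_) (2^n½^n n)
  (*-monoʳ-≤-nonNeg (pow ½ n) {{nonNegative (0≤pow n 0≤½)}} (fromℕ-mono-≤ (ℕ.<⇒≤ (n<2^n n))))
  where
  n<2^n : ∀ n → n ℕ.< 2 ℕ.^ n
  n<2^n zero    = ℕ.s≤s ℕ.z≤n
  n<2^n (suc n) = subst (ℕ._≤ 2 ℕ.^ suc n) (ℕ.+-comm (suc n) 1)
    (ℕ.+-mono-≤ (n<2^n n) (subst (1 ℕ.≤_) (sym (ℕ.+-identityʳ (2 ℕ.^ n))) (ℕ.m^n>0 2 n)))
  2^n½^n : ∀ n → fromℕ (2 ℕ.^ n) * pow ½ n ≡ 1ℚ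
  2^n½^n n = trans (cong (_* pow ½ n) (sym (pow-fromℕ 2 n)))
    (trans (sym (pow-* (fromℕ 2) ½ n)) (pow-1 n))

½^<ε : ∀ ε → 0ℚ < ε → ∃[ N ] pow ½ N < ε
½^<ε ε 0<ε with archimedean ε 0<ε
... | A , a = suc A , ≤-<-trans
  (*-cancelˡ-≤-pos (fromℕ (suc A)) (subst (fromℕ (suc A) * pow ½ (suc A) ≤_)
    (sym (trans (*-comm (fromℕ (suc A)) (δ A)) (δ*suc A))) (n*½^n≤1 (suc A))))
  (a A ℕ.≤-refl)

tail<ε : ∀ ε → 0ℚ < ε → ∃[ N ] tail N < ε
tail<ε ε 0<ε =
  let d , 0<d , 4d≡ε = shrink {ε} {fromℕ 4} 0<ε (*<* (ℤ.+<+ ℕ.z<s))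
      N , p = ½^<ε d 0<d
  in N , subst (tail N <_) 4d≡ε (*-monoʳ-<-pos (fromℕ 4) p)

module _ (S : ℕ → ℚ) (a b : ℕ → ℚ) (S-suc : ∀ K → S (suc K) ≡ S K + (a K + b K))
         (a-bound : ∀ K → 0ℚ ≤ a K × a K ≤ pow ½ K) (b-bound : ∀ K → 0ℚ ≤ b K × b K ≤ pow ½ K) where

  S-step : ∀ K → S K ≤ S (suc K) × S (suc K) + tail (suc K) ≤ S K + tail K
  S-step K = lower , upper
    where
    open ≤-Reasoning
    lower : S K ≤ S (suc K)
    lower = begin
      S K                ≡⟨ +-identityʳ (S K) ⟨
      S K + 0ℚ           ≤⟨ +-monoʳ-≤ (S K) (+-mono-≤ (proj₁ (a-bound K)) (proj₁ (b-bound K))) ⟩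
      S K + (a K + b K)  ≡⟨ S-suc K ⟨
      S (suc K)          ∎
    upper : S (suc K) + tail (suc K) ≤ S K + tail K
    upper = begin
      S (suc K) + tail (suc K)                  ≡⟨ cong (_+ tail (suc K)) (S-suc K) ⟩
      S K + (a K + b K) + tail (suc K)
        ≤⟨ +-monoˡ-≤ (tail (suc K)) (+-monoʳ-≤ (S K) (+-mono-≤ (proj₂ (a-bound K)) (proj₂ (b-bound K)))) ⟩
      S K + (pow ½ K + pow ½ K) + tail (suc K)  ≡⟨ tail-step (S K) (pow ½ K) ⟩
      S K + tail K                              ∎

  S-mono : ∀ M d → S M ≤ S (d ℕ.+ M) × S (d ℕ.+ M) + tail (d ℕ.+ M) ≤ S M + tail M
  S-mono M zero    = ≤-refl , ≤-refl
  S-mono M (suc d) = ≤-trans (proj₁ (S-mono M d)) (proj₁ (S-step (d ℕ.+ M)))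
                   , ≤-trans (proj₂ (S-step (d ℕ.+ M))) (proj₂ (S-mono M d))

  S-close : ∀ M d → ∣ S (d ℕ.+ M) - S M ∣ ≤ tail M
  S-close M d = subst (_≤ tail M) (sym (0≤p⇒∣p∣≡p 0≤S-S))
    (p≤q+r⇒p-q≤r (S (d ℕ.+ M)) (S M) (tail M) (≤-trans
      (subst (_≤ S (d ℕ.+ M) + tail (d ℕ.+ M)) (+-identityʳ (S (d ℕ.+ M)))
        (+-monoʳ-≤ (S (d ℕ.+ M)) (0≤tail (d ℕ.+ M))))
      (proj₂ (S-mono M d))))
    where
    0≤S-S : 0ℚ ≤ S (d ℕ.+ M) - S M
    0≤S-S = subst (_≤ S (d ℕ.+ M) - S M) (+-inverseʳ (S M)) (+-monoˡ-≤ (- S M) (proj₁ (S-mono M d)))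

  S-cauchy : ∀ ε N → tail N < ½ * ε → ∀ m n → N ℕ.≤ m → N ℕ.≤ n → ∣ S m - S n ∣ < ε
  S-cauchy ε N t m n h k = ∣p-r∣<ε (S m) (S N) (S n) ε (close m h)
    (subst (_< ½ * ε) (∣p-q∣-sym (S n) (S N)) (close n k))
    where
    close : ∀ m → N ℕ.≤ m → ∣ S m - S N ∣ < ½ * ε
    close m h = ≤-<-trans
      (subst (λ t → ∣ S t - S N ∣ ≤ tail N) (ℕ.m∸n+n≡m h) (S-close N (m ℕ.∸ N))) t

summable-2^ : (e : ℤ → ℚ) → (∀ m → e (+ suc m) ≤ - fromℕ m) → (∀ m → e -[1+ m ] ≤ - fromℕ m) →
              Summable (λ k → 2^ e k)
summable-2^ e e⁺ e⁻ ε 0<ε = N , λ m n h k → ½ * ε , 0<½*ε 0<ε , 0 , λ j _ →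
  add-half (S j m) (S j n) (<⇒≤ (S-cauchy (S j) (a j) (b j) (λ K → refl)
    (λ K → 2^-bound (e (+ suc K)) K (e⁺ K) j) (λ K → 2^-bound (e -[1+ K ]) K (e⁻ K) j)
    (½ * ε) N t m n h k))
  where
  S a b : ℕ → ℕ → ℚ
  S j K = seq (partialSum (λ k → 2^ e k) K) j
  a j K = seq (2^ e (+ suc K)) j
  b j K = seq (2^ e -[1+ K ]) j
  N = proj₁ (tail<ε (½ * (½ * ε)) (0<½*ε (0<½*ε 0<ε)))
  t = proj₂ (tail<ε (½ * (½ * ε)) (0<½*ε (0<½*ε 0<ε)))
  add-half : ∀ p q → ∣ p - q ∣ ≤ ½ * ε → ∣ p - q ∣ + ½ * ε ≤ ε
  add-half p q h = subst (∣ p - q ∣ + ½ * ε ≤_) (½+½ ε) (+-monoˡ-≤ (½ * ε) h)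

-- t² ≥ 2t - 1
square-bound : ∀ t m → fromℕ (suc m) ≤ t + ½ → - (t * t) ≤ - fromℕ m
square-bound t m h = neg-antimono-≤ (≤-trans m≤2m (≤-trans 2m≤2t-1 2t-1≤t²))
  where
  open +-*-Solver
  2t-1 = t + t - 1ℚ
  0≤[t-1]² : 0ℚ ≤ (t - 1ℚ) * (t - 1ℚ)
  0≤[t-1]² with ≤-total 0ℚ (t - 1ℚ)
  ... | inj₁ p = 0≤* p p
  ... | inj₂ p = subst (0ℚ ≤_) (solve 1 (λ a → (:- a) :* (:- a) := a :* a) refl (t - 1ℚ))
                  (0≤* (neg-antimono-≤ p) (neg-antimono-≤ p))
  2t-1≤t² : 2t-1 ≤ t * t
  2t-1≤t² = subst₂ _≤_ (+-identityˡ 2t-1)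
    (solve 1 (λ t → (t :- con 1ℚ) :* (t :- con 1ℚ) :+ (t :+ t :- con 1ℚ) := t :* t) refl t)
    (+-monoˡ-≤ 2t-1 0≤[t-1]²)
  m≤t-½ : fromℕ m ≤ t - ½
  m≤t-½ = subst₂ _≤_ (trans (cong (_- 1ℚ) (fromℤ-homo-+ (+ 1) (+ m)))
      (solve 1 (λ m → con 1ℚ :+ m :- con 1ℚ := m) refl (fromℕ m)))
    (solve 1 (λ t → t :+ con ½ :- con 1ℚ := t :- con ½) refl t) (+-monoˡ-≤ (- 1ℚ) h)
  2m≤2t-1 : fromℕ m + fromℕ m ≤ 2t-1
  2m≤2t-1 = subst (fromℕ m + fromℕ m ≤_) (solve 1 (λ t → (t :- con ½) :+ (t :- con ½) := t :+ t :- con 1ℚ) refl t)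
    (+-mono-≤ m≤t-½ m≤t-½)
  m≤2m : fromℕ m ≤ fromℕ m + fromℕ m
  m≤2m = subst (_≤ fromℕ m + fromℕ m) (+-identityʳ (fromℕ m))
    (+-monoʳ-≤ (fromℕ m) (fromℕ-mono-≤ {0} {m} ℕ.z≤n))

neg-square : ∀ t → - (- t * - t) ≡ - (t * t)
neg-square t = +-*-Solver.solve 1 (λ t → :- ((:- t) :* (:- t)) := :- (t :* t)) refl t
  where open +-*-Solver

p≤p+q : ∀ p q → 0ℚ ≤ q → p ≤ p + q
p≤p+q p q 0≤q = subst (_≤ p + q) (+-identityʳ p) (+-monoʳ-≤ p 0≤q)

evenSummable : Summable (λ k → 2^ (- ((k / 1) * (k / 1))))
evenSummable = summable-2^ (λ k → - ((k / 1) * (k / 1)))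
  (λ m → square-bound (+ suc m / 1) m
    (subst (λ t → fromℕ (suc m) ≤ t + ½) (sym (fromℤ≡/1 (+ suc m))) (p≤p+q (fromℕ (suc m)) ½ 0≤½)))
  (λ m → subst (_≤ - fromℕ m) (neg-square (-[1+ m ] / 1)) (square-bound (- (-[1+ m ] / 1)) m
    (subst (λ t → fromℕ (suc m) ≤ - t + ½) (sym (fromℤ≡/1 -[1+ m ])) (p≤p+q (fromℕ (suc m)) ½ 0≤½))))

oddSummable : Summable (λ k → 2^ (- ((k / 1 + ½) * (k / 1 + ½))))
oddSummable = summable-2^ (λ k → - ((k / 1 + ½) * (k / 1 + ½)))
  (λ m → square-bound (+ suc m / 1 + ½) m
    (subst (λ t → fromℕ (suc m) ≤ t + ½ + ½) (sym (fromℤ≡/1 (+ suc m)))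
      (≤-trans (p≤p+q (fromℕ (suc m)) ½ 0≤½) (p≤p+q (fromℕ (suc m) + ½) ½ 0≤½))))
  (λ m → subst (_≤ - fromℕ m) (neg-square (-[1+ m ] / 1 + ½)) (square-bound (- (-[1+ m ] / 1 + ½)) m
    (subst (λ t → fromℕ (suc m) ≤ - (t + ½) + ½) (sym (fromℤ≡/1 -[1+ m ]))
      (≤-reflexive (solve 1 (λ s → s := :- ((:- s) :+ con ½) :+ con ½) refl (fromℕ (suc m)))))))
  where open +-*-Solver

c : ℕ → ℝ
c n = if does (2 ∣? n)
      then ∑ℤ (λ k → 2^ (- ((k / 1) * (k / 1)))) evenSummable
      else ∑ℤ (λ k → 2^ (- ((k / 1 + ½) * (k / 1 + ½)))) oddSummable

{-# OPTIONS --safe #-}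
module Submission where

-- Relabelling gives two injections, the two halves of Burnside's lemma:
--   n! b̃ₙ ≥ number of labelled bicolored graphs = Σₖ C(n,k) 2^{k(n-k)},
--   n! b̃ₙ ≤ number of pairs (graph, automorphism).
-- Call a vertex moved if it is not the largest of its cycle.  The automorphism
-- determines the rows of the moved green vertices from the other rows of the
-- bipartite adjacency matrix, and likewise the columns of the moved red ones; the
-- better of the two leaves at most ⌊n/2⌋⌈n/2⌉ - ta free entries if a vertices are
-- moved and t ≤ ⌊n/2⌋/12.  The sum of 2^{-ta} over all permutations is
-- Π_{j<n} (1 + j 2^{-t}) = 1 + o(1), so b̃ₙ ∼ Σₖ 2^{k(n-k)} / (k! (n-k)!).
-- Relative to the central one, the summand k = ⌊n/2⌋ - i (i ∈ ℤ) is at most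
-- 2^{-i(i+ε)} with ε = n mod 2, and is asymptotic to it for fixed i.

-- A moved vertex saves only as many entries as there are vertices of the other color, and these may
-- be few. But then the coloring is lopsided, and the product of its class sizes is already far
-- below the maximum. The bound on the free entries trades one loss against the other, and this
-- trade fixes the constant 12.
--
-- For odd n neither c(n) nor 2^(n²/4) is rational. Since (k + 1/2)² = k(k + 1) + 1/4, a factor
-- 2^(1/4) taken from the second clears the first, and their product is 2^(⌊n/2⌋⌈n/2⌉) times the sum
-- of 2^(-k(k+1)). So everything is compared with the rational partial sums `theta ε j`, where ε is
-- the parity and j indexes at once the partial sum and the rational approximation of a real. The
-- value of the limit never has to be named, and both parities are treated together.

-- Finite sums, lists without repetitions, and Boolean matrices with given support

module Counting where
  open import Data.Bool.Base using (Bool; true; false; if_then_else_; _∧_; not)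
  open import Data.Nat.Base
  open import Data.Nat.Properties
  open import Data.Fin.Base using (Fin; zero; suc)
  import Data.Fin.Properties as Fin
  open import Data.List.Base using (List; []; _∷_; _++_; map; concatMap; cartesianProductWith; length; lookup)
  open import Data.List.Properties using (length-++; length-map)
  open import Data.List.Relation.Unary.Any as Any using (here; there; index)
  open import Data.List.Relation.Unary.Any.Properties using (lookup-index; concatMap⁺)
  open import Data.List.Relation.Unary.All as All using (All; []; _∷_)
  open import Data.List.Relation.Unary.AllPairs using ([]; _∷_)
  open import Data.List.Relation.Unary.Unique.Propositional using (Unique)
  import Data.List.Relation.Unary.Unique.Propositional.Properties as Unique
  open import Data.List.Membership.Propositional using (_∈_)
  open import Data.List.Membership.Propositional.Properties using (∈-lookup; ∈-map⁺; ∈-map⁻; ∈-++⁻; ∈-cartesianProductWith⁺; ∈-cartesianProductWith⁻)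
  open import Data.Product.Base using (∃-syntax; _×_; _,_; proj₁; proj₂)
  open import Data.Sum.Base using (inj₁; inj₂)
  open import Data.Vec.Base as Vec using (Vec; []; _∷_)
  import Data.Vec.Properties as Vec
  open import Function.Base using (_∘_)
  open import Relation.Binary.PropositionalEquality
  open import Defs using (lookup-injective)

  module _ {A B : Set} where

    injection⇒length≤ : ∀ {xs : List A} {ys : List B} (f : A → B) → Unique xs →
      (∀ {x y} → x ∈ xs → y ∈ xs → f x ≡ f y → x ≡ y) → (∀ {x} → x ∈ xs → f x ∈ ys) →
      length xs ≤ length ys
    injection⇒length≤ {xs} {ys} f u inj mem = Fin.injective⇒≤ {f = position} λ {i} {j} eq →
      lookup-injective (setoid A) u (inj (∈-lookup i) (∈-lookup j)
        (trans (lookup-index (mem (∈-lookup i)))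
          (trans (cong (lookup ys) eq) (sym (lookup-index (mem (∈-lookup j)))))))
      where
      position : Fin (length xs) → Fin (length ys)
      position i = index (mem (∈-lookup i))

  ∑ : {A : Set} → List A → (A → ℕ) → ℕ
  ∑ []       f = 0
  ∑ (x ∷ xs) f = f x + ∑ xs f

  module _ {A : Set} where

    ∑-mono : ∀ (xs : List A) {f g : A → ℕ} → (∀ x → f x ≤ g x) → ∑ xs f ≤ ∑ xs g
    ∑-mono []       h = z≤n
    ∑-mono (x ∷ xs) h = +-mono-≤ (h x) (∑-mono xs h)

    ∑-cong : ∀ (xs : List A) {f g : A → ℕ} → (∀ x → f x ≡ g x) → ∑ xs f ≡ ∑ xs g
    ∑-cong []       h = refl
    ∑-cong (x ∷ xs) h = cong₂ _+_ (h x) (∑-cong xs h)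

    ∑-+ : ∀ (xs : List A) (f g : A → ℕ) → ∑ xs (λ x → f x + g x) ≡ ∑ xs f + ∑ xs g
    ∑-+ []       f g = refl
    ∑-+ (x ∷ xs) f g = trans (cong (f x + g x +_) (∑-+ xs f g)) ([m+n]+[o+p]≡[m+o]+[n+p] (f x) (g x) _ _)
      where
      open import Algebra.Properties.CommutativeSemigroup +-commutativeSemigroup using ()
        renaming (interchange to [m+n]+[o+p]≡[m+o]+[n+p])

    ∑-*ˡ : ∀ (xs : List A) c (f : A → ℕ) → ∑ xs (λ x → c * f x) ≡ c * ∑ xs f
    ∑-*ˡ []       c f = sym (*-zeroʳ c)
    ∑-*ˡ (x ∷ xs) c f = trans (cong (c * f x +_) (∑-*ˡ xs c f)) (sym (*-distribˡ-+ c (f x) _))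

    ∑-const : ∀ (xs : List A) c → ∑ xs (λ _ → c) ≡ length xs * c
    ∑-const []       c = refl
    ∑-const (x ∷ xs) c = cong (c +_) (∑-const xs c)

    ∑-++ : ∀ (xs ys : List A) f → ∑ (xs ++ ys) f ≡ ∑ xs f + ∑ ys f
    ∑-++ []       ys f = refl
    ∑-++ (x ∷ xs) ys f = trans (cong (f x +_) (∑-++ xs ys f)) (sym (+-assoc (f x) _ _))

  module _ {A B : Set} where

    ∑-map : ∀ (xs : List A) (g : A → B) f → ∑ (map g xs) f ≡ ∑ xs (f ∘ g)
    ∑-map []       g f = refl
    ∑-map (x ∷ xs) g f = cong (f (g x) +_) (∑-map xs g f)

    pairs : List A → (A → List B) → List (A × B)
    pairs xs f = concatMap (λ x → map (x ,_) (f x)) xs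

    length-pairs : ∀ xs f → length (pairs xs f) ≡ ∑ xs (length ∘ f)
    length-pairs []       f = refl
    length-pairs (x ∷ xs) f = trans (length-++ (map (x ,_) (f x)))
      (cong₂ _+_ (length-map (x ,_) (f x)) (length-pairs xs f))

    ∈-pairs⁺ : ∀ {xs} f {x y} → x ∈ xs → y ∈ f x → (x , y) ∈ pairs xs f
    ∈-pairs⁺ f x∈ y∈ = concatMap⁺ _ (Any.map (λ { refl → ∈-map⁺ _ y∈ }) x∈)

    ∈-pairs⁻ : ∀ xs f {p} → p ∈ pairs xs f → proj₁ p ∈ xs × proj₂ p ∈ f (proj₁ p)
    ∈-pairs⁻ (x ∷ xs) f p∈ with ∈-++⁻ (map (x ,_) (f x)) p∈
    ... | inj₂ q = let a , b = ∈-pairs⁻ xs f q in there a , b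
    ... | inj₁ q with ∈-map⁻ (x ,_) q
    ...   | y , y∈ , refl = here refl , y∈

    pairs-unique : ∀ {xs} f → Unique xs → (∀ x → Unique (f x)) → Unique (pairs xs f)
    pairs-unique {[]}     f _        _  = []
    pairs-unique {x ∷ xs} f (px ∷ u) uf = Unique.++⁺ (Unique.map⁺ (λ { refl → refl }) (uf x))
      (pairs-unique f u uf) λ (p , q) → disjoint (∈-map⁻ (x ,_) p) (∈-pairs⁻ xs f q)
      where
      disjoint : ∀ {p} → ∃[ y ] (y ∈ f x × p ≡ (x , y)) → proj₁ p ∈ xs × proj₂ p ∈ f (proj₁ p) → _
      disjoint (_ , _ , refl) (x∈ , _) = All.lookup px x∈ refl

  module _ {A : Set} where

    vectors : ∀ {n} → (Fin n → List A) → List (Vec A n)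
    vectors {zero}  L = [] ∷ []
    vectors {suc n} L = cartesianProductWith _∷_ (L zero) (vectors (L ∘ suc))

    ∈-vectors⁺ : ∀ {n} {L : Fin n → List A} {v} → (∀ i → Vec.lookup v i ∈ L i) → v ∈ vectors L
    ∈-vectors⁺ {v = []}    h = here refl
    ∈-vectors⁺ {v = x ∷ v} h = ∈-cartesianProductWith⁺ _∷_ (h zero) (∈-vectors⁺ (h ∘ suc))

    vectors-unique : ∀ {n} {L : Fin n → List A} → (∀ i → Unique (L i)) → Unique (vectors L)
    vectors-unique {zero}  _ = [] ∷ []
    vectors-unique {suc n} u =
      Unique.cartesianProductWith⁺ _∷_ Vec.∷-injective (u zero) (vectors-unique (u ∘ suc))

    ∈-vectors⁻ : ∀ {n} (L : Fin n → List A) {v} → v ∈ vectors L → ∀ i → Vec.lookup v i ∈ L i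
    ∈-vectors⁻ {suc n} L v∈ i with ∈-cartesianProductWith⁻ _∷_ (L zero) (vectors (L ∘ suc)) v∈
    ∈-vectors⁻ {suc n} L v∈ zero    | x , v , x∈ , v∈′ , refl = x∈
    ∈-vectors⁻ {suc n} L v∈ (suc i) | x , v , x∈ , v∈′ , refl = ∈-vectors⁻ (L ∘ suc) v∈′ i

  length-cartesianProductWith : ∀ {A B C : Set} (f : A → B → C) xs ys →
    length (cartesianProductWith f xs ys) ≡ length xs * length ys
  length-cartesianProductWith f []       ys = refl
  length-cartesianProductWith f (x ∷ xs) ys = trans (length-++ (map (f x) ys))
    (cong₂ _+_ (length-map (f x) ys) (length-cartesianProductWith f xs ys))

  choices : Bool → List Bool
  choices true  = true ∷ false ∷ []
  choices false = false ∷ []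

  choices-unique : ∀ b → Unique (choices b)
  choices-unique true  = ((λ ()) ∷ []) ∷ [] ∷ []
  choices-unique false = [] ∷ []

  ∧-∈-choices : ∀ k b → k ∧ b ∈ choices k
  ∧-∈-choices true  true  = here refl
  ∧-∈-choices true  false = there (here refl)
  ∧-∈-choices false b     = here refl

  ∈-choices⇒≡∧ : ∀ k {b} → b ∈ choices k → b ≡ k ∧ b
  ∈-choices⇒≡∧ true  _           = refl
  ∈-choices⇒≡∧ false (here refl) = refl

  -- Vectors rather than functions: entrywise equal matrices are then propositionally equal, as
  -- counting by injections requires.
  Matrix : ℕ → Set
  Matrix n = Vec (Vec Bool n) n

  entry : ∀ {n} → Matrix n → Fin n → Fin n → Bool
  entry h i j = Vec.lookup (Vec.lookup h i) j

  restrict : ∀ {n} → (Fin n → Fin n → Bool) → (Fin n → Fin n → Bool) → Matrix n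
  restrict k h = Vec.tabulate λ i → Vec.tabulate λ j → k i j ∧ h i j

  entry-restrict : ∀ {n} (k h : Fin n → Fin n → Bool) i j → entry (restrict k h) i j ≡ k i j ∧ h i j
  entry-restrict k h i j = trans (cong (λ v → Vec.lookup v j) (Vec.lookup∘tabulate _ i)) (Vec.lookup∘tabulate _ j)

  lookup-ext : ∀ {A : Set} {n} {u v : Vec A n} → (∀ i → Vec.lookup u i ≡ Vec.lookup v i) → u ≡ v
  lookup-ext {u = u} {v} eq = trans (sym (Vec.tabulate∘lookup u)) (trans (Vec.tabulate-cong eq) (Vec.tabulate∘lookup v))

  entry-injective : ∀ {n} {h h′ : Matrix n} → (∀ i j → entry h i j ≡ entry h′ i j) → h ≡ h′
  entry-injective eq = lookup-ext λ i → lookup-ext (eq i)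

  -- A Boolean function on the positions in `k` is represented by its extension by `false`.
  -- Functions on different sets of positions thus share one type, and restriction to `k` is
  -- conjunction with `k`.
  supported : ∀ {n} → (Fin n → Fin n → Bool) → List (Matrix n)
  supported k = vectors λ i → vectors λ j → choices (k i j)

  module _ {n} (k : Fin n → Fin n → Bool) where

    supported-unique : Unique (supported k)
    supported-unique = vectors-unique λ i → vectors-unique λ j → choices-unique (k i j)

    restrict-∈-supported : ∀ h → restrict k h ∈ supported k
    restrict-∈-supported h = ∈-vectors⁺ λ i → ∈-vectors⁺ λ j →
      subst (_∈ choices (k i j)) (sym (entry-restrict k h i j)) (∧-∈-choices (k i j) (h i j))

    ∈-supported⇒≡∧ : ∀ {h} → h ∈ supported k → ∀ i j → entry h i j ≡ k i j ∧ entry h i j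
    ∈-supported⇒≡∧ h∈ i j = ∈-choices⇒≡∧ (k i j)
      (∈-vectors⁻ (λ j → choices (k i j)) (∈-vectors⁻ (λ i → vectors λ j → choices (k i j)) h∈ i) j)

  indicator : Bool → ℕ
  indicator b = if b then 1 else 0

  count : ∀ {n} → (Fin n → Bool) → ℕ
  count {zero}  f = 0
  count {suc n} f = indicator (f zero) + count (f ∘ suc)

  count-cong : ∀ {n} {f g : Fin n → Bool} → (∀ i → f i ≡ g i) → count f ≡ count g
  count-cong {zero}  h = refl
  count-cong {suc n} h = cong₂ (λ b m → indicator b + m) (h zero) (count-cong (h ∘ suc))

  count-split : ∀ {n} (f g : Fin n → Bool) →
    count (λ i → f i ∧ g i) + count (λ i → f i ∧ not (g i)) ≡ count f
  count-split {zero}  f g = refl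
  count-split {suc n} f g with f zero | g zero
  ... | false | _     = count-split (f ∘ suc) (g ∘ suc)
  ... | true  | true  = cong suc (count-split (f ∘ suc) (g ∘ suc))
  ... | true  | false = trans (+-suc _ _) (cong suc (count-split (f ∘ suc) (g ∘ suc)))

  count-not : ∀ {n} (f : Fin n → Bool) → count f + count (not ∘ f) ≡ n
  count-not {zero}  f = refl
  count-not {suc n} f with f zero
  ... | true  = cong suc (count-not (f ∘ suc))
  ... | false = trans (+-suc _ _) (cong suc (count-not (f ∘ suc)))

  length-vectors-choices : ∀ {n} (b : Fin n → Bool) →
    length (vectors (choices ∘ b)) ≡ 2 ^ count b
  length-vectors-choices {zero}  b = refl
  length-vectors-choices {suc n} b = trans (length-cartesianProductWith _∷_ (choices (b zero)) _)
    (trans (cong (length (choices (b zero)) *_) (length-vectors-choices (b ∘ suc))) (go (b zero)))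
    where
    go : ∀ x → length (choices x) * 2 ^ count (b ∘ suc) ≡ 2 ^ (indicator x + count (b ∘ suc))
    go true  = refl
    go false = +-identityʳ _

  length-supported : ∀ {m n} (a : Fin m → Bool) (b : Fin n → Bool) →
    length (vectors λ i → vectors λ j → choices (a i ∧ b j)) ≡ 2 ^ (count a * count b)
  length-supported {zero}  a b = refl
  length-supported {suc m} {n} a b = trans
    (length-cartesianProductWith _∷_ (vectors λ j → choices (a zero ∧ b j)) _)
    (trans (cong₂ _*_ (row (a zero)) (length-supported (a ∘ suc) b)) (go (a zero)))
    where
    row : ∀ x → length (vectors λ j → choices (x ∧ b j)) ≡ 2 ^ (indicator x * count b)
    row x = trans (length-vectors-choices (λ j → x ∧ b j)) (cong (2 ^_) (row′ x))
      where
      none : ∀ n → count {n} (λ _ → false) ≡ 0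
      none zero    = refl
      none (suc n) = none n
      row′ : ∀ x → count (λ j → x ∧ b j) ≡ indicator x * count b
      row′ true  = sym (+-identityʳ _)
      row′ false = none n
    go : ∀ x → 2 ^ (indicator x * count b) * 2 ^ (count (a ∘ suc) * count b) ≡ 2 ^ ((indicator x + count (a ∘ suc)) * count b)
    go x = trans (sym (^-distribˡ-+-* 2 (indicator x * count b) (count (a ∘ suc) * count b)))
      (cong (2 ^_) (sym (*-distribʳ-+ (count b) (indicator x) (count (a ∘ suc)))))

-- Permutations coded by insertion into cycles, and their generating function by moved elements

module Permutations where
  open import Data.Bool.Base using (Bool; true; false)
  open import Data.Nat.Base
  open import Data.Nat.Properties
  open import Data.Fin.Base using (Fin; zero; suc)
  import Data.Fin.Properties as Fin
  open import Data.Fin.Permutation as Perm using (Permutation′; _⟨$⟩ʳ_; _⟨$⟩ˡ_; inverseˡ; inverseʳ; _∘ₚ_; lift₀; remove; transpose)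
  open import Data.Fin.Permutation using (lift₀-remove)
  open import Data.List.Base using (List; []; _∷_; length; cartesianProduct; map; allFin; tabulate)
  open import Data.List.Properties using (length-tabulate)
  open import Data.List.Relation.Unary.Unique.Propositional using (Unique)
  open import Data.List.Relation.Unary.Unique.Propositional.Properties using (allFin⁺; cartesianProduct⁺)
  open import Data.List.Relation.Unary.All as All using ([]; _∷_)
  open import Data.List.Relation.Unary.AllPairs using ([]; _∷_)
  open import Data.List.Membership.Propositional using (_∈_)
  open import Data.List.Membership.Propositional.Properties using (∈-allFin; ∈-cartesianProduct⁺)
  open import Data.List.Relation.Unary.Any using (here)
  open import Data.Product.Base using (∃-syntax; _×_; _,_; proj₁; proj₂)
  open import Data.Unit.Base using (⊤; tt)
  open import Function.Base using (_∘_)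
  open import Relation.Nullary.Decidable using (yes; no)
  open import Relation.Nullary.Negation using (contradiction)
  open import Relation.Binary.PropositionalEquality
  open Counting using (∑; ∑-map; ∑-++; ∑-*ˡ; count; length-cartesianProductWith)

  -- A permutation is built by inserting a new smallest element into the cycles of a smaller one:
  -- index zero makes it a fixed point, index `suc j` puts it directly before `suc j`. Codes have
  -- propositional equality, and sums over them factor level by level.
  Code : ℕ → Set
  Code zero    = ⊤
  Code (suc n) = Fin (suc n) × Code n

  perm : ∀ {n} → Code n → Permutation′ n
  perm {zero}  _       = Perm.id
  perm {suc n} (i , p) = lift₀ (perm p) ∘ₚ transpose zero i

  transpose-right : ∀ {n} (j : Fin n) → transpose zero (suc j) ⟨$⟩ʳ suc j ≡ zero
  transpose-right j with j Fin.≟ j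
  ... | yes _   = refl
  ... | no  j≢j = contradiction refl j≢j

  ⟨$⟩ʳ-injective : ∀ {n} (π : Permutation′ n) {i j} → π ⟨$⟩ʳ i ≡ π ⟨$⟩ʳ j → i ≡ j
  ⟨$⟩ʳ-injective π {i} {j} eq = trans (sym (inverseˡ π)) (trans (cong (π ⟨$⟩ˡ_) eq) (inverseˡ π))

  perm-injective : ∀ {n} {p q : Code n} → (∀ i → perm p ⟨$⟩ʳ i ≡ perm q ⟨$⟩ʳ i) → p ≡ q
  perm-injective {zero}  _ = refl
  perm-injective {suc n} {i , p} {j , q} eq with eq zero
  ... | refl = cong (i ,_) (perm-injective λ k → Fin.suc-injective (⟨$⟩ʳ-injective (transpose zero i) (eq (suc k))))

  encode : ∀ {n} (π : Permutation′ n) → ∃[ p ] ∀ i → perm p ⟨$⟩ʳ i ≡ π ⟨$⟩ʳ i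
  encode {zero}  π = tt , λ ()
  encode {suc n} π = (i , proj₁ rec) , λ k → trans
      (cong (transpose zero i ⟨$⟩ʳ_) (trans (Perm.lift₀-cong _ _ (proj₂ rec) k) (lift₀-remove ρ ρ0≡0 k)))
      (inverseʳ (transpose zero i))
    where
    i = π ⟨$⟩ʳ zero
    ρ = π ∘ₚ Perm.flip (transpose zero i)
    ρ0≡0 : ρ ⟨$⟩ʳ zero ≡ zero
    ρ0≡0 = inverseˡ (transpose zero i) {zero}
    rec = encode (remove zero ρ)

  -- The vertices that are not the largest of their cycle: in perm (i , p), the
  -- vertex zero precedes i in the cycle of i.
  moved : ∀ {n} → Code n → Fin n → Bool
  moved {suc n} (zero  , p) zero    = false
  moved {suc n} (suc i , p) zero    = true
  moved {suc n} (i     , p) (suc k) = moved p k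

  -- Every cycle is reached from its largest element.
  moved-induction : ∀ {n} (p : Code n) (P : Fin n → Set) → (∀ i → P i → P (perm p ⟨$⟩ʳ i)) →
                    (∀ i → moved p i ≡ false → P i) → ∀ i → P i
  moved-induction {suc n} (zero , p) P step base = λ { zero → base zero refl ; (suc k) → tail k }
    where
    tail : ∀ k → P (suc k)
    tail = moved-induction p (P ∘ suc) (λ k → step (suc k)) (λ k → base (suc k))
  moved-induction {suc n} (suc j , p) P step base = λ { zero → head ; (suc k) → tail k }
    where
    -- Inserting zero diverts the arrow that ends in `suc j`: where the smaller permutation makes
    -- one step into `j`, the larger one makes two, through zero.
    step′ : ∀ k → P (suc k) → P (suc (perm p ⟨$⟩ʳ k))
    step′ k Pk with perm p ⟨$⟩ʳ k Fin.≟ j | step (suc k) Pk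
    ... | no  _    | Q = Q
    ... | yes refl | Q = step zero Q
    tail : ∀ k → P (suc k)
    tail = moved-induction p (P ∘ suc) step′ (λ k → base (suc k))
    head : P zero
    head = subst P (trans (cong (λ k → transpose zero (suc j) ⟨$⟩ʳ suc k) (inverseʳ (perm p))) (transpose-right j))
      (step (suc (perm p ⟨$⟩ˡ j)) (tail (perm p ⟨$⟩ˡ j)))

  codes : ∀ n → List (Code n)
  codes zero    = tt ∷ []
  codes (suc n) = cartesianProduct (allFin (suc n)) (codes n)

  ∈-codes : ∀ {n} (p : Code n) → p ∈ codes n
  ∈-codes {zero}  _       = here refl
  ∈-codes {suc n} (i , p) = ∈-cartesianProduct⁺ (∈-allFin i) (∈-codes p)

  codes-unique : ∀ n → Unique (codes n)
  codes-unique zero    = [] ∷ []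
  codes-unique (suc n) = cartesianProduct⁺ (allFin⁺ (suc n)) (codes-unique n)

  length-codes : ∀ n → length (codes n) ≡ n !
  length-codes zero    = refl
  length-codes (suc n) = trans (length-cartesianProductWith _,_ (allFin (suc n)) (codes n))
    (cong₂ _*_ (length-tabulate {n = suc n} (λ i → i)) (length-codes n))

  -- Each cycle has exactly one unmoved element, so this is u to the number of cycles times v to the
  -- number of moved elements. With u = 2^t and v = 1 it replaces 2^(-ta) without fractions; with u
  -- = 1 and v = 0 it is the indicator of the identity.
  weight : ∀ {n} → ℕ → ℕ → Code n → ℕ
  weight {zero}  u v _           = 1
  weight {suc n} u v (zero  , p) = u * weight u v p
  weight {suc n} u v (suc i , p) = v * weight u v p

  -- The product of u + jv over j < n, the homogeneous generating polynomial of the Stirling cycle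
  -- numbers.
  rising : ℕ → ℕ → ℕ → ℕ
  rising u v zero    = 1
  rising u v (suc n) = (u + n * v) * rising u v n

  ∑-cartesianProduct : ∀ {A B : Set} (xs : List A) (ys : List B) f →
    ∑ (cartesianProduct xs ys) f ≡ ∑ xs (λ x → ∑ ys (λ y → f (x , y)))
  ∑-cartesianProduct []       ys f = refl
  ∑-cartesianProduct (x ∷ xs) ys f = trans (∑-++ (map (x ,_) ys) _ f)
    (cong₂ _+_ (∑-map ys (x ,_) f) (∑-cartesianProduct xs ys f))

  ∑-weight : ∀ u v n → ∑ (codes n) (weight u v) ≡ rising u v n
  ∑-weight u v zero    = refl
  ∑-weight u v (suc n) = begin
    ∑ (codes (suc n)) (weight u v)                        ≡⟨ ∑-cartesianProduct (allFin (suc n)) (codes n) (weight u v) ⟩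
    ∑ (codes n) (λ p → u * weight u v p) + ∑ (tabulate suc) (λ i → ∑ (codes n) (λ p → weight u v (i , p)))
      ≡⟨ cong₂ _+_ (∑-*ˡ (codes n) u (weight u v)) (others n suc (λ i → ∑-*ˡ (codes n) v (weight u v))) ⟩
    u * W + n * (v * W)                                   ≡⟨ cong (u * W +_) (sym (*-assoc n v W)) ⟩
    u * W + n * v * W                                     ≡⟨ *-distribʳ-+ W u (n * v) ⟨
    (u + n * v) * W                                       ≡⟨ cong ((u + n * v) *_) (∑-weight u v n) ⟩
    rising u v (suc n)                                    ∎
    where
    open ≡-Reasoning
    W = ∑ (codes n) (weight u v)
    others : ∀ {A : Set} m (f : Fin m → A) {g : A → ℕ} {x} → (∀ i → g (f i) ≡ x) → ∑ (tabulate f) g ≡ m * x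
    others zero    f h = refl
    others (suc m) f h = cong₂ _+_ (h zero) (others m (f ∘ suc) (h ∘ suc))

  weight-^ : ∀ {n} T (p : Code n) → T ^ count (moved p) * weight T 1 p ≡ T ^ n
  weight-^ {zero}  T p           = refl
  weight-^ {suc n} T (zero  , p) = trans (x∙yz≈y∙xz (T ^ count (moved p)) T _) (cong (T *_) (weight-^ T p))
    where open import Algebra.Properties.CommutativeSemigroup *-commutativeSemigroup using (x∙yz≈y∙xz)
  weight-^ {suc n} T (suc i , p) = trans (cong (T * T ^ count (moved p) *_) (+-identityʳ _))
    (trans (*-assoc T _ _) (cong (T *_) (weight-^ T p)))

  weight-0 : ∀ {n} (p : Code n) → 0 < count (moved p) → weight 1 0 p ≡ 0
  weight-0 {suc n} (zero  , p) h = trans (+-identityʳ _) (weight-0 p h)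
  weight-0 {suc n} (suc i , p) h = refl

  weight-1 : ∀ {n} (p : Code n) → count (moved p) ≡ 0 → weight 1 0 p ≡ 1
  weight-1 {zero}  p           h = refl
  weight-1 {suc n} (zero  , p) h = trans (+-identityʳ _) (weight-1 p h)

  rising-1-0 : ∀ n → rising 1 0 n ≡ 1
  rising-1-0 zero    = refl
  rising-1-0 (suc n) = trans (cong₂ (λ x y → (1 + x) * y) (*-zeroʳ n) (rising-1-0 n)) refl

  -- Divided by T^(k+1), this bounds the product of 1 + j/T over j < k by 1 + 2kn/T. Each factor is
  -- at most 1 + n/T; the cross term 2kn²/T² is at most n/T because 2kn ≤ 2n² ≤ T, which accounts
  -- for the 2.
  rising-bound : ∀ T n k → 2 * (n * n) ≤ T → k ≤ n → T * rising T 1 k ≤ (T + 2 * k * n) * T ^ k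
  rising-bound T n zero    h _ = ≤-reflexive (cong (_* 1) (sym (+-identityʳ T)))
  rising-bound T n (suc k) h k<n = begin
    T * ((T + k * 1) * R)                    ≡⟨ x∙yz≈y∙xz T (T + k * 1) R ⟩
    (T + k * 1) * (T * R)                    ≤⟨ *-mono-≤ (+-monoʳ-≤ T k*1≤n) (rising-bound T n k h (<⇒≤ k<n)) ⟩
    (T + n) * ((T + 2 * k * n) * T ^ k)      ≡⟨ *-assoc (T + n) (T + 2 * k * n) (T ^ k) ⟨
    (T + n) * (T + 2 * k * n) * T ^ k        ≤⟨ *-monoˡ-≤ (T ^ k) step ⟩
    (T + 2 * suc k * n) * T * T ^ k          ≡⟨ *-assoc (T + 2 * suc k * n) T (T ^ k) ⟩
    (T + 2 * suc k * n) * T ^ suc k          ∎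
    where
    open ≤-Reasoning
    open import Algebra.Properties.CommutativeSemigroup *-commutativeSemigroup using (x∙yz≈y∙xz)
    open import Data.Nat.Solver using (module +-*-Solver)
    open +-*-Solver
    R = rising T 1 k
    k*1≤n : k * 1 ≤ n
    k*1≤n = subst (_≤ n) (sym (*-identityʳ k)) (<⇒≤ k<n)
    small : 2 * k * n ≤ T
    small = begin
      2 * k * n     ≡⟨ *-assoc 2 k n ⟩
      2 * (k * n)   ≤⟨ *-monoʳ-≤ 2 (*-monoˡ-≤ n (<⇒≤ k<n)) ⟩
      2 * (n * n)   ≤⟨ h ⟩
      T             ∎
    step : (T + n) * (T + 2 * k * n) ≤ (T + 2 * suc k * n) * T
    step = begin
      (T + n) * (T + 2 * k * n)                          ≡⟨ solve 3 (λ T n k → (T :+ n) :* (T :+ con 2 :* k :* n) :=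
                                                              T :* T :+ n :* T :+ con 2 :* k :* n :* T :+ n :* (con 2 :* k :* n)) refl T n k ⟩
      T * T + n * T + 2 * k * n * T + n * (2 * k * n)    ≤⟨ +-monoʳ-≤ (T * T + n * T + 2 * k * n * T) (*-monoʳ-≤ n small) ⟩
      T * T + n * T + 2 * k * n * T + n * T              ≡⟨ solve 3 (λ T n k → T :* T :+ n :* T :+ con 2 :* k :* n :* T :+ n :* T :=
                                                              (T :+ con 2 :* (con 1 :+ k) :* n) :* T) refl T n k ⟩
      (T + 2 * suc k * n) * T                            ∎

-- Labelled bicolored graphs and the two halves of Burnside's lemma

module Orbits where
  open import Data.Bool.Base using (Bool; true; false; _∧_; not)
  open import Data.Nat.Base
  open import Data.Nat.Properties
  open import Data.Fin.Base using (Fin)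
  open import Data.Fin.Permutation as Perm using (Permutation′; _⟨$⟩ʳ_; _⟨$⟩ˡ_; inverseˡ; inverseʳ; _∘ₚ_)
  open import Data.List.Base using (List; []; _∷_; length; cartesianProduct; allFin)
  open import Data.List.Properties using (length-tabulate)
  open import Data.List.Relation.Unary.Unique.Propositional using (Unique)
  open import Data.List.Relation.Unary.Unique.Propositional.Properties using (allFin⁺; cartesianProduct⁺)
  open import Data.List.Relation.Unary.All using ([]; _∷_)
  open import Data.List.Relation.Unary.AllPairs using ([]; _∷_)
  open import Data.List.Membership.Propositional using (_∈_)
  open import Data.List.Membership.Propositional.Properties using (∈-allFin; ∈-cartesianProduct⁺)
  open import Data.List.Relation.Unary.Any using (here; there)
  open import Data.Product.Base using (_×_; _,_; proj₁; proj₂)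
  open import Data.Vec.Base as Vec using (Vec; lookup; tabulate)
  open import Data.Vec.Properties using (lookup∘tabulate)
  open import Function.Base using (_∘_)
  open import Function.Bundles using (Bijection)
  open import Relation.Binary.Bundles using (Setoid)
  open import Relation.Binary.PropositionalEquality
  open import Defs using (BicoloredGraph; Color; green; red; _≅_; bicoloredGraphs)
  open BicoloredGraph hiding (graph)
  open Counting
  open Permutations

  isGreen : Color → Bool
  isGreen green = true
  isGreen red   = false

  Coloring : ℕ → Set
  Coloring n = Vec Color n

  module _ {n} (c : Coloring n) where

    greens reds : Fin n → Bool
    greens i = isGreen (lookup c i)
    reds   i = not (greens i)

  colors : List Color
  colors = green ∷ red ∷ []

  colorings : ∀ n → List (Coloring n)
  colorings n = vectors λ _ → colors

  ∈-colorings : ∀ {n} (c : Coloring n) → c ∈ colorings n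
  ∈-colorings c = ∈-vectors⁺ λ i → ∈-colors (lookup c i)
    where
    ∈-colors : ∀ x → x ∈ colors
    ∈-colors green = here refl
    ∈-colors red   = there (here refl)

  colorings-unique : ∀ n → Unique (colorings n)
  colorings-unique n = vectors-unique {n = n} λ _ → ((λ ()) ∷ []) ∷ [] ∷ []

  -- A labelled bicolored graph is a coloring together with a matrix supported
  -- on the (green, red) positions.
  Labelled : ℕ → Set
  Labelled n = Coloring n × Matrix n

  crossing : ∀ {n} → Coloring n → Fin n → Fin n → Bool
  crossing c i j = greens c i ∧ reds c j

  -- An edge is stored once, in the row of its green end and the column of its red end; for a
  -- red-green pair the transposed entry y is read.
  edge : Color → Color → Bool → Bool → Bool
  edge green red   x y = x
  edge red   green x y = y
  edge green green x y = false
  edge red   red   x y = false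

  graph : ∀ {n} → Labelled n → BicoloredGraph n
  graph (c , h) = record
    { graph  = record
      { adjacent    = λ i j → edge (lookup c i) (lookup c j) (entry h i j) (entry h j i)
      ; symmetric   = λ i j → edge-sym (lookup c i) (lookup c j) _ _
      ; irreflexive = λ i → edge-irr (lookup c i) _ _
      }
    ; color  = lookup c
    ; proper = λ i j → edge-proper (lookup c i) (lookup c j) _ _
    }
    where
    edge-sym : ∀ a b x y → edge a b x y ≡ edge b a y x
    edge-sym green green x y = refl
    edge-sym green red   x y = refl
    edge-sym red   green x y = refl
    edge-sym red   red   x y = refl
    edge-irr : ∀ a x y → edge a a x y ≡ false
    edge-irr green x y = refl
    edge-irr red   x y = refl
    edge-proper : ∀ a b x y → edge a b x y ≡ true → a ≢ b
    edge-proper green green x y () refl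
    edge-proper red   red   x y () refl

  label : ∀ {n} → BicoloredGraph n → Labelled n
  label G = c , restrict (crossing c) (adjacent G)
    where c = tabulate (color G)

  infix 4 _≐_

  -- Graphs contain functions and proofs, so they are compared pointwise; propositional equality is
  -- used only for `Labelled`.
  _≐_ : ∀ {n} → BicoloredGraph n → BicoloredGraph n → Set
  G ≐ H = (∀ i j → adjacent G i j ≡ adjacent H i j) × (∀ i → color G i ≡ color H i)

  graph-label : ∀ {n} (G : BicoloredGraph n) → G ≐ graph (label G)
  graph-label G = (λ i j → sym (adj i j)) , λ i → sym (lookup∘tabulate (color G) i)
    where
    no-edge : ∀ i j → color G i ≡ color G j → false ≡ adjacent G i j
    no-edge i j eq with adjacent G i j | proper G i j
    ... | false | _ = refl
    ... | true  | p with () ← p refl eq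
    adj : ∀ i j → adjacent (graph (label G)) i j ≡ adjacent G i j
    adj i j rewrite entry-restrict (crossing (proj₁ (label G))) (adjacent G) i j
                  | entry-restrict (crossing (proj₁ (label G))) (adjacent G) j i
                  | lookup∘tabulate (color G) i | lookup∘tabulate (color G) j
      with color G i in ci | color G j in cj
    ... | green | green = no-edge i j (trans ci (sym cj))
    ... | green | red   = refl
    ... | red   | green = symmetric G j i
    ... | red   | red   = no-edge i j (trans ci (sym cj))

  adjacent-crossing : ∀ {n} (x : Labelled n) i j → crossing (proj₁ x) i j ≡ true →
                      adjacent (graph x) i j ≡ entry (proj₂ x) i j
  adjacent-crossing (c , h) i j eq with lookup c i | lookup c j
  ... | green | red = refl

  crossing-injective : ∀ {n} (c : Coloring n) {h h′} →
    (∀ i j → entry h i j ≡ crossing c i j ∧ entry h i j) →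
    (∀ i j → entry h′ i j ≡ crossing c i j ∧ entry h′ i j) →
    (∀ i j → crossing c i j ≡ true → adjacent (graph (c , h)) i j ≡ adjacent (graph (c , h′)) i j) → h ≡ h′
  crossing-injective c {h} {h′} sh sh′ eq = entry-injective λ i j → go i j (crossing c i j) refl
    where
    go : ∀ i j x → crossing c i j ≡ x → entry h i j ≡ entry h′ i j
    go i j true  x = trans (sym (adjacent-crossing (c , h) i j x)) (trans (eq i j x) (adjacent-crossing (c , h′) i j x))
    go i j false x = trans (trans (sh i j) (cong (_∧ entry h i j) x)) (sym (trans (sh′ i j) (cong (_∧ entry h′ i j) x)))

  -- The target of an isomorphism is the source transported along the permutation. This lets a
  -- labelled graph be read back from its class and a code.
  ≅-unique : ∀ {n} {R G H : BicoloredGraph n} (φ : R ≅ G) (ψ : R ≅ H) →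
             (∀ i → proj₁ φ ⟨$⟩ʳ i ≡ proj₁ ψ ⟨$⟩ʳ i) → G ≐ H
  ≅-unique {R = R} {G} {H} (π , a , c) (ρ , b , d) eq =
      (λ i j → trans (sym (cong₂ (adjacent G) (inverseʳ π) (inverseʳ π)))
        (trans (sym (a _ _)) (trans (b _ _) (cong₂ (adjacent H) (back i) (back j)))))
    , (λ i → trans (sym (cong (color G) (inverseʳ π))) (trans (sym (c _)) (trans (d _) (cong (color H) (back i)))))
    where
    back : ∀ i → ρ ⟨$⟩ʳ (π ⟨$⟩ˡ i) ≡ i
    back i = trans (sym (eq _)) (inverseʳ π)

  relabel : ∀ {n} → BicoloredGraph n → Permutation′ n → BicoloredGraph n
  relabel G π = record
    { graph  = record
      { adjacent    = λ i j → adjacent G (π ⟨$⟩ˡ i) (π ⟨$⟩ˡ j)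
      ; symmetric   = λ i j → symmetric G _ _
      ; irreflexive = λ i → irreflexive G _
      }
    ; color  = λ i → color G (π ⟨$⟩ˡ i)
    ; proper = λ i j → proper G _ _
    }

  ≅-relabel : ∀ {n} (G : BicoloredGraph n) π → G ≅ relabel G π
  ≅-relabel G π = π , (λ i j → sym (cong₂ (adjacent G) (inverseˡ π) (inverseˡ π)))
                    , λ i → sym (cong (color G) (inverseˡ π))

  module _ {n m : ℕ} (classes : Bijection (setoid (Fin m)) (bicoloredGraphs n)) where

    open Setoid (bicoloredGraphs n) using () renaming (sym to ≅-sym; trans to ≅-trans)

    rep : Fin m → BicoloredGraph n
    rep = Bijection.to classes

    class : BicoloredGraph n → Fin m
    class G = proj₁ (Bijection.surjective classes G)

    class-≅ : ∀ G → rep (class G) ≅ G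
    class-≅ G = proj₂ (Bijection.surjective classes G) refl

    length-classes×codes : length (cartesianProduct (allFin m) (codes n)) ≡ m * n !
    length-classes×codes = trans (length-cartesianProductWith _,_ (allFin m) (codes n))
      (cong₂ _*_ (length-tabulate {n = m} (λ i → i)) (length-codes n))

    labelled : List (Labelled n)
    labelled = pairs (colorings n) (λ c → supported (crossing c))

    length-labelled : length labelled ≡ ∑ (colorings n) (λ c → 2 ^ (count (greens c) * count (reds c)))
    length-labelled = trans (length-pairs (colorings n) _)
      (∑-cong (colorings n) λ c → length-supported (greens c) (reds c))

    -- Each labelled graph is sent to its class and the code of the chosen isomorphism from the
    -- representative. By `≅-unique` these determine the graph, so neither orbits nor stabilizers
    -- have to be counted.
    labelled≤classes : ∑ (colorings n) (λ c → 2 ^ (count (greens c) * count (reds c))) ≤ m * n !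
    labelled≤classes = subst₂ _≤_ length-labelled length-classes×codes
      (injection⇒length≤ {xs = labelled} f (pairs-unique (λ c → supported (crossing c)) (colorings-unique n) (λ c → supported-unique (crossing c)))
        f-injective λ _ → ∈-cartesianProduct⁺ (∈-allFin _) (∈-codes _))
      where
      f : Labelled n → Fin m × Code n
      f x = class (graph x) , proj₁ (encode (proj₁ (class-≅ (graph x))))
      same : ∀ x y → f x ≡ f y → graph x ≐ graph y
      same x y eq with class (graph x) | class-≅ (graph x) | class (graph y) | class-≅ (graph y)
      same x y eq | k | φ | l | ψ with cong proj₁ eq
      ... | refl = ≅-unique {R = rep k} {graph x} {graph y} φ ψ λ i → trans (sym (proj₂ (encode (proj₁ φ)) i))
        (trans (cong (λ p → perm (proj₂ p) ⟨$⟩ʳ i) eq) (proj₂ (encode (proj₁ ψ)) i))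
      f-injective : ∀ {x y} → x ∈ labelled → y ∈ labelled → f x ≡ f y → x ≡ y
      f-injective {c , h} {d , k} x∈ y∈ eq with same (c , h) (d , k) eq
      ... | a , b with lookup-ext {u = c} {d} b
      ... | refl = cong (c ,_) (crossing-injective c
        (∈-supported⇒≡∧ (crossing c) (proj₂ (∈-pairs⁻ (colorings n) _ x∈)))
        (∈-supported⇒≡∧ (crossing c) (proj₂ (∈-pairs⁻ (colorings n) _ y∈))) λ i j _ → a i j)

    module _ (rows : Code n → Coloring n → Bool) where

      -- Either the moved green rows are dropped, or the moved red columns. Injectivity holds for
      -- every choice function `rows`, so the choice is left open until the savings are compared.
      freeGreens freeReds : Code n → Coloring n → Fin n → Bool
      freeGreens p c i = greens c i ∧ not (rows p c ∧ moved p i)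
      freeReds   p c j = reds c j ∧ not (not (rows p c) ∧ moved p j)

      free : Code n → Coloring n → Fin n → Fin n → Bool
      free p c i j = freeGreens p c i ∧ freeReds p c j

      ∧-true : ∀ x y → x ∧ y ≡ true → x ≡ true × y ≡ true
      ∧-true true true _ = refl , refl

      -- An automorphism carries the row of a green vertex to the row of its
      -- image, so the rows of the unmoved vertices determine all rows; likewise
      -- for columns.
      free-determines : ∀ p c {h h′} →
        (∀ i j → adjacent (graph (c , h)) i j ≡ adjacent (graph (c , h)) (perm p ⟨$⟩ʳ i) (perm p ⟨$⟩ʳ j)) →
        (∀ i j → adjacent (graph (c , h′)) i j ≡ adjacent (graph (c , h′)) (perm p ⟨$⟩ʳ i) (perm p ⟨$⟩ʳ j)) →
        (∀ i → lookup c i ≡ lookup c (perm p ⟨$⟩ʳ i)) →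
        (∀ i j → free p c i j ≡ true → entry h i j ≡ entry h′ i j) →
        ∀ i j → crossing c i j ≡ true → adjacent (graph (c , h)) i j ≡ adjacent (graph (c , h′)) i j
      free-determines p c {h} {h′} inv inv′ invc eq with rows p c
      ... | true  = moved-induction p (λ i → ∀ j → crossing c i j ≡ true → a i j ≡ a′ i j) step base
        where
        a  = adjacent (graph (c , h))
        a′ = adjacent (graph (c , h′))
        π  = perm p
        base : ∀ i → moved p i ≡ false → ∀ j → crossing c i j ≡ true → a i j ≡ a′ i j
        base i mi j x = trans (adjacent-crossing (c , h) i j x) (trans (eq i j fr) (sym (adjacent-crossing (c , h′) i j x)))
          where
          fr : (greens c i ∧ not (true ∧ moved p i)) ∧ (reds c j ∧ not (false ∧ moved p j)) ≡ true
          fr rewrite mi | proj₁ (∧-true (greens c i) (reds c j) x) | proj₂ (∧-true (greens c i) (reds c j) x) = refl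
        -- By invariance the entry at (π i , j) is the one at (i , π⁻¹ j), and this position is
        -- again green-red because π preserves colors.
        step : ∀ i → (∀ j → crossing c i j ≡ true → a i j ≡ a′ i j) →
               ∀ j → crossing c (π ⟨$⟩ʳ i) j ≡ true → a (π ⟨$⟩ʳ i) j ≡ a′ (π ⟨$⟩ʳ i) j
        step i IH j x = subst (λ t → a (π ⟨$⟩ʳ i) t ≡ a′ (π ⟨$⟩ʳ i) t) (inverseʳ π)
          (trans (sym (inv _ _)) (trans (IH (π ⟨$⟩ˡ j) (trans (cong₂ (λ s t → isGreen s ∧ not (isGreen t))
            (invc i) (trans (invc _) (cong (lookup c) (inverseʳ π)))) x)) (inv′ _ _)))
      ... | false = λ i j → moved-induction p (λ j → ∀ i → crossing c i j ≡ true → a i j ≡ a′ i j) step base j i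
        where
        a  = adjacent (graph (c , h))
        a′ = adjacent (graph (c , h′))
        π  = perm p
        base : ∀ j → moved p j ≡ false → ∀ i → crossing c i j ≡ true → a i j ≡ a′ i j
        base j mj i x = trans (adjacent-crossing (c , h) i j x) (trans (eq i j fr) (sym (adjacent-crossing (c , h′) i j x)))
          where
          fr : (greens c i ∧ not (false ∧ moved p i)) ∧ (reds c j ∧ not (true ∧ moved p j)) ≡ true
          fr rewrite mj | proj₁ (∧-true (greens c i) (reds c j) x) | proj₂ (∧-true (greens c i) (reds c j) x) = refl
        step : ∀ j → (∀ i → crossing c i j ≡ true → a i j ≡ a′ i j) →
               ∀ i → crossing c i (π ⟨$⟩ʳ j) ≡ true → a i (π ⟨$⟩ʳ j) ≡ a′ i (π ⟨$⟩ʳ j)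
        step j IH i x = subst (λ t → a t (π ⟨$⟩ʳ j) ≡ a′ t (π ⟨$⟩ʳ j)) (inverseʳ π)
          (trans (sym (inv _ _)) (trans (IH (π ⟨$⟩ˡ i) (trans (cong₂ (λ s t → isGreen s ∧ not (isGreen t))
            (trans (invc _) (cong (lookup c) (inverseʳ π))) (invc j)) x)) (inv′ _ _)))

      partials : List (Code n × Labelled n)
      partials = pairs (codes n) λ p → pairs (colorings n) λ c → supported (free p c)

      length-partials : length partials ≡
        ∑ (codes n) λ p → ∑ (colorings n) λ c → 2 ^ (count (freeGreens p c) * count (freeReds p c))
      length-partials = trans (length-pairs (codes n) _) (∑-cong (codes n) λ p →
        trans (length-pairs (colorings n) _) (∑-cong (colorings n) λ c →
          length-supported (freeGreens p c) (freeReds p c)))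

      -- The pair (k , δ) yields the graph δ(rep k) and its automorphism δ τ⁻¹,
      -- where τ is the chosen isomorphism from rep k; τ depends only on the label.
      image : Fin m × Code n → Labelled n
      image (k , δ) = label (relabel (rep k) (perm δ))

      chosen : (x : Labelled n) → rep (class (graph x)) ≅ graph x
      chosen x = class-≅ (graph x)

      rep≅image : ∀ k δ → rep k ≅ graph (image (k , δ))
      rep≅image k δ = perm δ
        , (λ i j → trans (proj₁ (proj₂ (≅-relabel (rep k) (perm δ))) i j) (proj₁ (graph-label (relabel (rep k) (perm δ))) _ _))
        , (λ i → trans (proj₂ (proj₂ (≅-relabel (rep k) (perm δ))) i) (proj₂ (graph-label (relabel (rep k) (perm δ))) _))

      class-image : ∀ k δ → class (graph (image (k , δ))) ≡ k
      class-image k δ = Bijection.injective classes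
        (≅-trans {rep (class G)} {G} {rep k} (class-≅ G) (≅-sym {rep k} {G} (rep≅image k δ)))
        where G = graph (image (k , δ))

      auto : (x : Fin m × Code n) → Permutation′ n
      auto (k , δ) = Perm.flip (proj₁ (chosen (image (k , δ)))) ∘ₚ perm δ

      auto-≅ : ∀ x → let G = graph (image x) ; π = auto x in
        (∀ i j → adjacent G i j ≡ adjacent G (π ⟨$⟩ʳ i) (π ⟨$⟩ʳ j)) × (∀ i → color G i ≡ color G (π ⟨$⟩ʳ i))
      -- The chosen isomorphism starts at the representative of the class of G, which is `rep k`
      -- only along `class-image`. So the claim is proved for every τ from `rep k` and then
      -- transported.
      auto-≅ (k , δ) = subst (λ l → (τ : rep l ≅ G) → let π = Perm.flip (proj₁ τ) ∘ₚ perm δ in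
          (∀ i j → adjacent G i j ≡ adjacent G (π ⟨$⟩ʳ i) (π ⟨$⟩ʳ j)) × (∀ i → color G i ≡ color G (π ⟨$⟩ʳ i)))
        (sym (class-image k δ)) (λ τ → proj₂ (≅-trans {G} {rep k} {G} (≅-sym {rep k} {G} τ) (rep≅image k δ))) (chosen (image (k , δ)))
        where G = graph (image (k , δ))

      -- The free entries and the automorphism give back the whole matrix by `free-determines`,
      -- hence the graph and its class k. The graph also fixes τ, and δ is the automorphism after τ.
      classes≤partials : m * n ! ≤ ∑ (codes n) λ p → ∑ (colorings n) λ c → 2 ^ (count (freeGreens p c) * count (freeReds p c))
      classes≤partials = subst₂ _≤_ length-classes×codes length-partials
        (injection⇒length≤ f (cartesianProduct⁺ (allFin⁺ m) (codes-unique n)) (λ _ _ → f-injective _ _)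
          λ {x} _ → f-∈ x)
        where
        autoCode : Fin m × Code n → Code n
        autoCode x = proj₁ (encode (auto x))
        autoCode-≡ : ∀ x i → perm (autoCode x) ⟨$⟩ʳ i ≡ auto x ⟨$⟩ʳ i
        autoCode-≡ x = proj₂ (encode (auto x))
        f : Fin m × Code n → Code n × Labelled n
        f x = autoCode x , proj₁ (image x) , restrict (free (autoCode x) (proj₁ (image x))) (entry (proj₂ (image x)))
        f-∈ : ∀ x → f x ∈ partials
        f-∈ x = ∈-pairs⁺ (λ p → pairs (colorings n) λ c → supported (free p c)) (∈-codes (autoCode x))
          (∈-pairs⁺ (λ c → supported (free (autoCode x) c)) (∈-colorings (proj₁ (image x)))
            (restrict-∈-supported (free (autoCode x) (proj₁ (image x))) (entry (proj₂ (image x)))))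
        support : ∀ x i j → entry (proj₂ (image x)) i j ≡ crossing (proj₁ (image x)) i j ∧ entry (proj₂ (image x)) i j
        support (k , δ) = ∈-supported⇒≡∧ (crossing (proj₁ (image (k , δ)))) (restrict-∈-supported (crossing (proj₁ (image (k , δ)))) _)
        invariant : ∀ x → let G = graph (image x) ; π = perm (autoCode x) in
          (∀ i j → adjacent G i j ≡ adjacent G (π ⟨$⟩ʳ i) (π ⟨$⟩ʳ j)) × (∀ i → color G i ≡ color G (π ⟨$⟩ʳ i))
        invariant x = (λ i j → trans (proj₁ (auto-≅ x) i j) (sym (cong₂ (adjacent (graph (image x))) (autoCode-≡ x i) (autoCode-≡ x j))))
                    , (λ i → trans (proj₂ (auto-≅ x) i) (sym (cong (color (graph (image x))) (autoCode-≡ x i))))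
        same-image : ∀ {p q c d h k} →
          (∀ i j → entry h i j ≡ crossing c i j ∧ entry h i j) → (∀ i j → entry k i j ≡ crossing d i j ∧ entry k i j) →
          (∀ i j → adjacent (graph (c , h)) i j ≡ adjacent (graph (c , h)) (perm p ⟨$⟩ʳ i) (perm p ⟨$⟩ʳ j)) →
          (∀ i j → adjacent (graph (d , k)) i j ≡ adjacent (graph (d , k)) (perm q ⟨$⟩ʳ i) (perm q ⟨$⟩ʳ j)) →
          (∀ i → lookup c i ≡ lookup c (perm p ⟨$⟩ʳ i)) →
          _≡_ {A = Code n × Labelled n} (p , c , restrict (free p c) (entry h)) (q , d , restrict (free q d) (entry k)) →
          _≡_ {A = Labelled n} (c , h) (d , k)
        same-image {p} {q} {c} {d} {h} {k} sh sk inv inv′ invc eq with cong proj₁ eq | cong (proj₁ ∘ proj₂) eq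
        ... | refl | refl = cong (c ,_) (crossing-injective c sh sk (free-determines p c {h} {k} inv inv′ invc λ i j fr →
          trans (sym (trans (entry-restrict (free p c) (entry h) i j) (cong (_∧ entry h i j) fr)))
            (trans (cong (λ x → entry (proj₂ (proj₂ x)) i j) eq)
              (trans (entry-restrict (free p c) (entry k) i j) (cong (_∧ entry k i j) fr)))))
        f-injective : ∀ x y → f x ≡ f y → x ≡ y
        f-injective x@(k , δ) y@(l , ε) eq = cong₂ _,_
          (trans (sym (class-image k δ)) (trans (cong (class ∘ graph) im) (class-image l ε)))
          -- Both sides evaluate the automorphism at τ i, with the same τ because the two images
          -- agree.
          (perm-injective λ i → trans (sym (cong (perm δ ⟨$⟩ʳ_) (inverseˡ (proj₁ (chosen (image x))))))
            (trans (trans (sym (autoCode-≡ x _)) (trans (cong (λ z → perm (proj₁ z) ⟨$⟩ʳ (proj₁ (chosen (image x)) ⟨$⟩ʳ i)) eq)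
              (trans (autoCode-≡ y _) (cong (λ z → perm ε ⟨$⟩ʳ (proj₁ (chosen (image y)) ⟨$⟩ˡ (proj₁ (chosen z) ⟨$⟩ʳ i))) im))))
              (cong (perm ε ⟨$⟩ʳ_) (inverseˡ (proj₁ (chosen (image y)))))))
          where
          im : image x ≡ image y
          im = same-image {autoCode x} {autoCode y} (support x) (support y)
            (proj₁ (invariant x)) (proj₁ (invariant y)) (proj₂ (invariant x)) eq

-- Binomial coefficients near the centre, and the bound for pairs of a graph and an automorphism

module Estimates where
  open import Data.Bool.Base using (Bool; _∧_; not)
  open import Data.Bool.Properties using (∧-identityʳ; ∧-comm)
  open import Data.Nat.Base
  open import Data.Nat.Properties
  open import Data.Nat.Combinatorics renaming (_C_ to C) using (nCk+nC[k+1]≡[n+1]C[k+1]; nCk≡n!/k![n-k]!; k![n∸k]!∣n!; k>n⇒nCk≡0)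
  open import Data.Nat.DivMod using (m/n*n≡m)
  open import Data.Nat.Solver using (module +-*-Solver)
  open import Data.Fin.Base using (Fin; zero; suc)
  open import Data.List.Base using (List; []; _∷_; length; map)
  open import Data.Vec.Base using (_∷_)
  open import Function.Base using (_∘_)
  open import Function.Bundles using (Bijection)
  open import Relation.Nullary.Decidable using (Dec; does; yes; no)
  open import Relation.Binary.PropositionalEquality
  open import Defs using (green; red; bicoloredGraphs)
  open Counting
  open Permutations
  open Orbits

  C-! : ∀ {n} p q → p + q ≡ n → C n p * (p ! * q !) ≡ n !
  C-! p q refl = begin
    C (p + q) p * (p ! * q !)              ≡⟨ cong (λ x → C (p + q) p * (p ! * x !)) (m+n∸m≡n p q) ⟨
    C (p + q) p * (p ! * (p + q ∸ p) !)    ≡⟨ cong (_* (p ! * (p + q ∸ p) !)) (nCk≡n!/k![n-k]! (m≤m+n p q)) ⟩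
    _                                      ≡⟨ m/n*n≡m {{p !* (p + q ∸ p) !≢0}} (k![n∸k]!∣n! (m≤m+n p q)) ⟩
    (p + q) !                              ∎
    where open ≡-Reasoning

  -- After multiplication by p! q! both sides are n!.
  C-step : ∀ {n} p q → suc p + q ≡ n → suc p * C n (suc p) ≡ suc q * C n p
  C-step {n} p q eq = *-cancelʳ-≡ _ _ (p ! * q !) {{p !* q !≢0}} (trans
    (trans (solve 4 (λ a x u v → a :* x :* (u :* v) := x :* (a :* u :* v)) refl (suc p) (C n (suc p)) (p !) (q !)) (C-! (suc p) q eq))
    (sym (trans (solve 4 (λ b x u v → b :* x :* (u :* v) := x :* (u :* (b :* v))) refl (suc q) (C n p) (p !) (q !)) (C-! p (suc q) (trans (+-suc p q) eq)))))
    where open +-*-Solver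

  module _ {n P Q : ℕ} (P+Q≡n : P + Q ≡ n) (P≤1+Q : P ≤ suc Q) where

    C-step-down : ∀ i → suc i ≤ P → (suc (Q + i)) * C n (P ∸ suc i) ≡ (P ∸ i) * C n (P ∸ i)
    C-step-down i i<P = sym (subst (λ x → x * C n x ≡ suc (Q + i) * C n (P ∸ suc i)) (sym eq)
      (C-step (P ∸ suc i) (Q + i) (trans (cong (λ x → x + (Q + i)) (sym eq)) (trans (sum (P ∸ i) i) (trans (cong (_+ Q) (m∸n+n≡m (<⇒≤ i<P))) P+Q≡n)))))
      where
      eq : P ∸ i ≡ suc (P ∸ suc i)
      eq = +-∸-assoc 1 i<P
      sum : ∀ x i → x + (Q + i) ≡ x + i + Q
      sum x i = trans (cong (x +_) (+-comm Q i)) (sym (+-assoc x i Q))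

    -- By `C-step-down` the quotient of neighbours is (P - i)/(Q + i + 1), at most 1 since P ≤ Q +
    -- 1. That hypothesis holds for (m , m′) as well as (m′ , m), so one lemma serves both sides of
    -- the centre.
    C-decreasing : ∀ i → C n (P ∸ suc i) ≤ C n (P ∸ i)
    C-decreasing i with suc i ≤? P
    ... | yes i<P = *-cancelˡ-≤ (suc (Q + i)) (≤-trans (≤-reflexive (C-step-down i i<P))
      (*-monoˡ-≤ (C n (P ∸ i)) (≤-trans (m∸n≤m P i) (≤-trans P≤1+Q (s≤s (m≤m+n Q i))))))
    -- Here both truncated differences are 0.
    ... | no  i≮P = ≤-reflexive (cong (C n) (trans (m≤n⇒m∸n≡0 {P} (m≤n⇒m≤1+n P≤i)) (sym (m≤n⇒m∸n≡0 P≤i))))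
      where
      P≤i : P ≤ i
      P≤i = ≤-pred (≰⇒> i≮P)

    C≤C-central : ∀ i → C n (P ∸ i) ≤ C n P
    C≤C-central zero    = ≤-refl
    C≤C-central (suc i) = ≤-trans (C-decreasing i) (C≤C-central i)

    -- The binomials within distance i of the centre lose at most the proportion i(i+1)/M. By
    -- `C-step-down` a step loses the fraction (Q + 2i + 1 - P)/(Q + i + 1), whose numerator is at
    -- most 2(i + 1) as Q ≤ P + 1; these numerators add up to i(i+1).
    C-drop : ∀ {M} → M ≤ suc Q → Q ≤ suc P → ∀ i → i ≤ P → M * C n P ≤ M * C n (P ∸ i) + i * suc i * C n P
    C-drop {M} _ _ zero    _ = m≤m+n _ _
    C-drop {M} M≤ Q≤ (suc i) i<P = begin
      M * c                                            ≤⟨ C-drop M≤ Q≤ i (<⇒≤ i<P) ⟩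
      M * x + i * suc i * c                            ≤⟨ +-monoˡ-≤ (i * suc i * c) step ⟩
      M * y + 2 * suc i * c + i * suc i * c            ≡⟨ solve 3 (λ a i c → a :+ con 2 :* (con 1 :+ i) :* c :+ i :* (con 1 :+ i) :* c
                                                            := a :+ (con 1 :+ i) :* (con 2 :+ i) :* c) refl (M * y) i c ⟩
      M * y + suc i * suc (suc i) * c                  ∎
      where
      open ≤-Reasoning
      open +-*-Solver using (solve; _:=_; _:*_; _:+_; con)
      c = C n P
      x = C n (P ∸ i)
      y = C n (P ∸ suc i)
      d = x ∸ y
      x≡ : y + d ≡ x
      x≡ = m+[n∸m]≡n (C-decreasing i)
      Q+i≤ : suc (Q + i) ≤ (P ∸ i) + 2 * suc i
      Q+i≤ = begin
        suc (Q + i)             ≤⟨ s≤s (+-monoˡ-≤ i Q≤) ⟩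
        suc (suc P + i)         ≡⟨ cong (λ z → suc (suc z + i)) (m∸n+n≡m (<⇒≤ i<P)) ⟨
        suc (suc (P ∸ i + i) + i) ≡⟨ solve 2 (λ z i → con 2 :+ (z :+ i :+ i) := z :+ con 2 :* (con 1 :+ i)) refl (P ∸ i) i ⟩
        (P ∸ i) + 2 * suc i     ∎
      [Q+i]d≤ : suc (Q + i) * d ≤ 2 * suc i * c
      [Q+i]d≤ = +-cancelˡ-≤ (suc (Q + i) * y) _ _ (begin
        suc (Q + i) * y + suc (Q + i) * d      ≡⟨ *-distribˡ-+ (suc (Q + i)) y d ⟨
        suc (Q + i) * (y + d)                  ≡⟨ cong (suc (Q + i) *_) x≡ ⟩
        suc (Q + i) * x                        ≤⟨ *-monoˡ-≤ x Q+i≤ ⟩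
        (P ∸ i + 2 * suc i) * x                ≡⟨ *-distribʳ-+ x (P ∸ i) (2 * suc i) ⟩
        (P ∸ i) * x + 2 * suc i * x            ≡⟨ cong (_+ 2 * suc i * x) (C-step-down i i<P) ⟨
        suc (Q + i) * y + 2 * suc i * x        ≤⟨ +-monoʳ-≤ (suc (Q + i) * y) (*-monoʳ-≤ (2 * suc i) (C≤C-central i)) ⟩
        suc (Q + i) * y + 2 * suc i * c        ∎)
      step : M * x ≤ M * y + 2 * suc i * c
      step = begin
        M * x               ≡⟨ cong (M *_) x≡ ⟨
        M * (y + d)         ≡⟨ *-distribˡ-+ M y d ⟩
        M * y + M * d       ≤⟨ +-monoʳ-≤ (M * y) (*-monoˡ-≤ d (≤-trans M≤ (s≤s (m≤m+n Q i)))) ⟩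
        M * y + suc (Q + i) * d ≤⟨ +-monoʳ-≤ (M * y) [Q+i]d≤ ⟩
        M * y + 2 * suc i * c   ∎

  ∑< : ℕ → (ℕ → ℕ) → ℕ
  ∑< zero    f = 0
  ∑< (suc N) f = ∑< N f + f N

  ∑<-cong : ∀ N {f g} → (∀ k → k < N → f k ≡ g k) → ∑< N f ≡ ∑< N g
  ∑<-cong zero    h = refl
  ∑<-cong (suc N) h = cong₂ _+_ (∑<-cong N (λ k k<N → h k (m≤n⇒m≤1+n k<N))) (h N ≤-refl)

  ∑<-+ : ∀ N f g → ∑< N (λ k → f k + g k) ≡ ∑< N f + ∑< N g
  ∑<-+ zero    f g = refl
  ∑<-+ (suc N) f g = trans (cong (_+ (f N + g N)) (∑<-+ N f g))
    (solve 4 (λ a b c d → a :+ b :+ (c :+ d) := a :+ c :+ (b :+ d)) refl (∑< N f) (∑< N g) (f N) (g N))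
    where open +-*-Solver

  ∑<-suc : ∀ N f → ∑< (suc N) f ≡ f 0 + ∑< N (f ∘ suc)
  ∑<-suc zero    f = sym (+-identityʳ (f 0))
  ∑<-suc (suc N) f = trans (cong (_+ f (suc N)) (∑<-suc N f)) (+-assoc (f 0) _ _)

  ∑<-split : ∀ M N f → ∑< (M + N) f ≡ ∑< M f + ∑< N (λ k → f (M + k))
  ∑<-split M zero    f = trans (cong (λ x → ∑< x f) (+-identityʳ M)) (sym (+-identityʳ _))
  ∑<-split M (suc N) f = trans (cong (λ x → ∑< x f) (+-suc M N))
    (trans (cong (_+ f (M + N)) (∑<-split M N f)) (+-assoc (∑< M f) _ _))

  ∑<-reverse : ∀ M f → ∑< M f ≡ ∑< M (λ i → f (M ∸ suc i))
  ∑<-reverse zero    f = refl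
  ∑<-reverse (suc M) f = trans (+-comm (∑< M f) (f M))
    (trans (cong (f M +_) (∑<-reverse M f)) (sym (∑<-suc M (λ i → f (suc M ∸ suc i)))))

  ∑<-mono : ∀ N {f g} → (∀ k → k < N → f k ≤ g k) → ∑< N f ≤ ∑< N g
  ∑<-mono zero    h = z≤n
  ∑<-mono (suc N) h = +-mono-≤ (∑<-mono N (λ k k<N → h k (m≤n⇒m≤1+n k<N))) (h N ≤-refl)

  ∑<-const : ∀ N c → ∑< N (λ _ → c) ≡ N * c
  ∑<-const zero    c = refl
  ∑<-const (suc N) c = trans (cong (_+ c) (∑<-const N c)) (+-comm (N * c) c)

  ∑<-C-suc : ∀ n (f : ℕ → ℕ) → ∑< (suc (suc n)) (λ k → C (suc n) k * f k) ≡
    ∑< (suc n) (λ k → C n k * f (suc k)) + ∑< (suc n) (λ k → C n k * f k)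
  ∑<-C-suc n f = begin
    ∑< (suc (suc n)) (λ k → C (suc n) k * f k)
      ≡⟨ ∑<-suc (suc n) (λ k → C (suc n) k * f k) ⟩
    1 * f 0 + ∑< (suc n) (λ k → C (suc n) (suc k) * f (suc k))
      ≡⟨ cong (1 * f 0 +_) (∑<-cong (suc n) λ k _ → trans (cong (_* f (suc k)) (sym (nCk+nC[k+1]≡[n+1]C[k+1] n k)))
           (*-distribʳ-+ (f (suc k)) (C n k) (C n (suc k)))) ⟩
    1 * f 0 + ∑< (suc n) (λ k → C n k * f (suc k) + C n (suc k) * f (suc k))
      ≡⟨ cong (1 * f 0 +_) (∑<-+ (suc n) (λ k → C n k * f (suc k)) (λ k → C n (suc k) * f (suc k))) ⟩
    1 * f 0 + (A + ∑< (suc n) (λ k → C n (suc k) * f (suc k)))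
      ≡⟨ solve 3 (λ a b c → a :+ (b :+ c) := b :+ (a :+ c)) refl (1 * f 0) A _ ⟩
    A + (1 * f 0 + ∑< (suc n) (λ k → C n (suc k) * f (suc k)))
      ≡⟨ cong (A +_) (∑<-suc (suc n) (λ k → C n k * f k)) ⟨
    A + (∑< (suc n) (λ k → C n k * f k) + C n (suc n) * f (suc n))
      ≡⟨ cong (λ x → A + (∑< (suc n) (λ k → C n k * f k) + x * f (suc n))) (k>n⇒nCk≡0 (n<1+n n)) ⟩
    A + (∑< (suc n) (λ k → C n k * f k) + 0)
      ≡⟨ cong (A +_) (+-identityʳ _) ⟩
    A + ∑< (suc n) (λ k → C n k * f k) ∎
    where
    open ≡-Reasoning
    open +-*-Solver using (solve; _:=_; _:+_)
    A = ∑< (suc n) (λ k → C n k * f (suc k))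

  ∑-colorings : ∀ n (f : ℕ → ℕ) → ∑ (colorings n) (λ c → f (count (greens c))) ≡ ∑< (suc n) (λ k → C n k * f k)
  ∑-colorings zero    f = refl
  ∑-colorings (suc n) f = begin
    ∑ (colorings (suc n)) F
      ≡⟨ ∑-++ (map (green ∷_) (colorings n)) _ F ⟩
    ∑ (map (green ∷_) (colorings n)) F + ∑ (map (red ∷_) (colorings n) Data.List.Base.++ []) F
      ≡⟨ cong₂ _+_ (∑-map (colorings n) (green ∷_) F)
           (trans (∑-++ (map (red ∷_) (colorings n)) [] F) (trans (+-identityʳ _) (∑-map (colorings n) (red ∷_) F))) ⟩
    ∑ (colorings n) (λ c → f (suc (count (greens c)))) + ∑ (colorings n) (λ c → f (count (greens c)))
      ≡⟨ cong₂ _+_ (∑-colorings n (f ∘ suc)) (∑-colorings n f) ⟩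
    ∑< (suc n) (λ k → C n k * f (suc k)) + ∑< (suc n) (λ k → C n k * f k)
      ≡⟨ ∑<-C-suc n f ⟨
    ∑< (suc (suc n)) (λ k → C (suc n) k * f k) ∎
    where
    open ≡-Reasoning
    F : Coloring (suc n) → ℕ
    F c = f (count (greens c))

  length-colorings : ∀ n → length (colorings n) ≡ 2 ^ n
  length-colorings zero    = refl
  length-colorings (suc n) = trans (length-cartesianProductWith _∷_ colors (colorings n)) (cong (2 *_) (length-colorings n))

  labelledCount : ℕ → ℕ
  labelledCount n = ∑ (colorings n) (λ c → 2 ^ (count (greens c) * count (reds c)))

  labelledCount-≡ : ∀ n → labelledCount n ≡ ∑< (suc n) (λ k → C n k * 2 ^ (k * (n ∸ k)))
  labelledCount-≡ n = trans (∑-cong (colorings n) λ c → cong (λ r → 2 ^ (count (greens c) * r)) (red≡ c))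
    (∑-colorings n (λ k → 2 ^ (k * (n ∸ k))))
    where
    red≡ : ∀ c → count (reds c) ≡ n ∸ count (greens c)
    red≡ c = trans (sym (m+n∸m≡n (count (greens c)) (count (reds c)))) (cong (_∸ count (greens c)) (count-not (greens c)))

  private
    -- Here s and m′ + x are the class sizes. The imbalance x puts their product at least x² below m
    -- m′, and the determined entries contribute a s / 2; together they must pay t a. If 2t ≤ s, the
    -- second suffices. Otherwise x ≥ 12t - 2t = 10t, so a ≤ 3x and 2ta ≤ 6tx ≤ x²: this is where 12
    -- comes from.
    lopsided : ∀ {t s x m m′ a} → s + x ≡ m → m ≤ m′ → a ≤ suc (2 * m) → 12 * t ≤ m →
               2 * (t * a) + 2 * (s * (m′ + x)) ≤ 2 * (m * m′) + a * s
    lopsided {t} {s} {x} {m} {m′} {a} refl m≤m′ a≤ 12t≤m = begin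
      2 * (t * a) + 2 * (s * (m′ + x))                       ≤⟨ +-monoˡ-≤ (2 * (s * (m′ + x))) small ⟩
      2 * (x * x) + a * s + 2 * (s * (m′ + x))               ≡⟨ solve 4 (λ x s m a → con 2 :* (x :* x) :+ a :+ con 2 :* (s :* (m :+ x))
                                                                  := con 2 :* (s :* m :+ x :* (s :+ x)) :+ a) refl x s m′ (a * s) ⟩
      2 * (s * m′ + x * (s + x)) + a * s                     ≤⟨ +-monoˡ-≤ (a * s) (*-monoʳ-≤ 2 (+-monoʳ-≤ (s * m′) (*-monoʳ-≤ x m≤m′))) ⟩
      2 * (s * m′ + x * m′) + a * s                          ≡⟨ cong (λ y → 2 * y + a * s) (*-distribʳ-+ m′ s x) ⟨
      2 * ((s + x) * m′) + a * s                             ∎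
      where
      open ≤-Reasoning
      open +-*-Solver using (solve; _:=_; _:*_; _:+_; con)
      small : 2 * (t * a) ≤ 2 * (x * x) + a * s
      small with 2 * t ≤? s
      ... | yes 2t≤s = begin
        2 * (t * a)  ≡⟨ solve 2 (λ t a → con 2 :* (t :* a) := a :* (con 2 :* t)) refl t a ⟩
        a * (2 * t)  ≤⟨ *-monoʳ-≤ a 2t≤s ⟩
        a * s        ≤⟨ m≤n+m (a * s) (2 * (x * x)) ⟩
        2 * (x * x) + a * s ∎
      ... | no 2t≰s = begin
        2 * (t * a)       ≤⟨ *-monoʳ-≤ 2 (*-monoʳ-≤ t a≤3x) ⟩
        2 * (t * (3 * x)) ≡⟨ solve 2 (λ t x → con 2 :* (t :* (con 3 :* x)) := con 6 :* t :* x) refl t x ⟩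
        6 * t * x         ≤⟨ *-monoˡ-≤ x (≤-trans (*-monoˡ-≤ t (≤ᵇ⇒≤ 6 10 _)) 10t≤x) ⟩
        x * x             ≤⟨ m≤m+n (x * x) _ ⟩
        2 * (x * x)       ≤⟨ m≤m+n _ _ ⟩
        2 * (x * x) + a * s ∎
        where
        s<2t : s < 2 * t
        s<2t = ≰⇒> 2t≰s
        10t≤x : 10 * t ≤ x
        10t≤x = +-cancelˡ-≤ (2 * t) _ _ (begin
          2 * t + 10 * t ≡⟨ *-distribʳ-+ t 2 10 ⟨
          12 * t         ≤⟨ 12t≤m ⟩
          s + x          ≤⟨ +-monoˡ-≤ x (<⇒≤ s<2t) ⟩
          2 * t + x      ∎)
        a≤3x : a ≤ 3 * x
        a≤3x = begin
          a                     ≤⟨ a≤ ⟩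
          suc (2 * (s + x))     ≤⟨ n≤1+n _ ⟩
          2 + 2 * (s + x)       ≡⟨ solve 2 (λ s x → con 2 :+ con 2 :* (s :+ x) := con 2 :* (con 1 :+ s) :+ con 2 :* x) refl s x ⟩
          2 * suc s + 2 * x     ≤⟨ +-monoˡ-≤ (2 * x) (*-monoʳ-≤ 2 s<2t) ⟩
          2 * (2 * t) + 2 * x   ≡⟨ cong (_+ 2 * x) (*-assoc 2 2 t) ⟨
          4 * t + 2 * x         ≤⟨ +-monoˡ-≤ (2 * x) (*-monoˡ-≤ t (≤ᵇ⇒≤ 4 10 _)) ⟩
          10 * t + 2 * x        ≤⟨ +-monoˡ-≤ (2 * x) 10t≤x ⟩
          x + 2 * x             ∎

  -- Invariance under a moved vertices costs at least t a of the m m′ possible edges.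
  exponent-bound : ∀ {t m m′ g r a₁ a₂} → m ≤ m′ → m′ ≤ suc m → 12 * t ≤ m → g + r ≡ m + m′ →
    a₁ ≤ g → a₂ ≤ r → a₂ * g ≤ a₁ * r → t * (a₁ + a₂) + g * r ≤ m * m′ + a₁ * r
  exponent-bound {t} {m} {m′} {g} {r} {a₁} {a₂} m≤m′ m′≤ 12t≤m eq a₁≤g a₂≤r cheaper = *-cancelˡ-≤ 2 (begin
    2 * (t * a + g * r)              ≡⟨ *-distribˡ-+ 2 (t * a) (g * r) ⟩
    2 * (t * a) + 2 * (g * r)        ≤⟨ main ⟩
    -- The larger of the two savings is at least their mean; everything is doubled to avoid the
    -- fraction.
    2 * (m * m′) + (a₁ * r + a₂ * g) ≤⟨ +-monoʳ-≤ (2 * (m * m′)) (+-monoʳ-≤ (a₁ * r) cheaper) ⟩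
    2 * (m * m′) + (a₁ * r + a₁ * r) ≡⟨ solve 2 (λ x y → con 2 :* x :+ (y :+ y) := con 2 :* (x :+ y)) refl (m * m′) (a₁ * r) ⟩
    2 * (m * m′ + a₁ * r)            ∎)
    where
    open ≤-Reasoning
    open +-*-Solver using (solve; _:=_; _:*_; _:+_; con)
    a = a₁ + a₂
    a≤ : a ≤ suc (2 * m)
    a≤ = begin
      a₁ + a₂      ≤⟨ +-mono-≤ a₁≤g a₂≤r ⟩
      g + r        ≡⟨ eq ⟩
      m + m′       ≤⟨ +-monoʳ-≤ m m′≤ ⟩
      m + suc m    ≡⟨ solve 1 (λ m → m :+ (con 1 :+ m) := con 1 :+ con 2 :* m) refl m ⟩
      suc (2 * m)  ∎
    other : ∀ {s l} → s ≤ m → s + l ≡ m + m′ → l ≡ m′ + (m ∸ s)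
    other {s} {l} s≤m e = +-cancelˡ-≡ s l _ (trans e (trans (cong (_+ m′) (sym (m+[n∸m]≡n s≤m)))
      (solve 3 (λ s x y → s :+ x :+ y := s :+ (y :+ x)) refl s (m ∸ s) m′)))
    -- If s is the size of the smaller class, the other has size m′ + (m - s), and the two savings
    -- together are at least a s.
    main : 2 * (t * a) + 2 * (g * r) ≤ 2 * (m * m′) + (a₁ * r + a₂ * g)
    main with g ≤? m
    ... | yes g≤m = begin
      2 * (t * a) + 2 * (g * r)                ≡⟨ cong (λ r → 2 * (t * a) + 2 * (g * r)) (other g≤m eq) ⟩
      2 * (t * a) + 2 * (g * (m′ + (m ∸ g)))   ≤⟨ lopsided {t} (m+[n∸m]≡n g≤m) m≤m′ a≤ 12t≤m ⟩
      2 * (m * m′) + a * g                     ≡⟨ cong (2 * (m * m′) +_) (*-distribʳ-+ g a₁ a₂) ⟩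
      2 * (m * m′) + (a₁ * g + a₂ * g)         ≤⟨ +-monoʳ-≤ (2 * (m * m′)) (+-monoˡ-≤ (a₂ * g) (*-monoʳ-≤ a₁ g≤r)) ⟩
      2 * (m * m′) + (a₁ * r + a₂ * g)         ∎
      where
      g≤r : g ≤ r
      g≤r = ≤-trans g≤m (≤-trans m≤m′ (≤-trans (m≤m+n m′ _) (≤-reflexive (sym (other g≤m eq)))))
    ... | no g≰m = begin
      2 * (t * a) + 2 * (g * r)                ≡⟨ cong (λ x → 2 * (t * a) + 2 * x) (*-comm g r) ⟩
      2 * (t * a) + 2 * (r * g)                ≡⟨ cong (λ g → 2 * (t * a) + 2 * (r * g)) (other r≤m eq′) ⟩
      2 * (t * a) + 2 * (r * (m′ + (m ∸ r)))   ≤⟨ lopsided {t} (m+[n∸m]≡n r≤m) m≤m′ a≤ 12t≤m ⟩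
      2 * (m * m′) + a * r                     ≡⟨ cong (2 * (m * m′) +_) (*-distribʳ-+ r a₁ a₂) ⟩
      2 * (m * m′) + (a₁ * r + a₂ * r)         ≤⟨ +-monoʳ-≤ (2 * (m * m′)) (+-monoʳ-≤ (a₁ * r) (*-monoʳ-≤ a₂ r≤g)) ⟩
      2 * (m * m′) + (a₁ * r + a₂ * g)         ∎
      where
      m<g : m < g
      m<g = ≰⇒> g≰m
      eq′ : r + g ≡ m + m′
      eq′ = trans (+-comm r g) eq
      r≤m : r ≤ m
      r≤m = +-cancelˡ-≤ (suc m) r m (begin
        suc m + r  ≤⟨ +-monoˡ-≤ r m<g ⟩
        g + r      ≡⟨ eq ⟩
        m + m′     ≤⟨ +-monoʳ-≤ m m′≤ ⟩
        m + suc m  ≡⟨ +-suc m m ⟩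
        suc m + m  ∎)
      r≤g : r ≤ g
      r≤g = ≤-trans r≤m (<⇒≤ m<g)

  module _ {n m m′ t} (m≤m′ : m ≤ m′) (m′≤ : m′ ≤ suc m) (n≡ : n ≡ m + m′) (12t≤m : 12 * t ≤ m) where

    movedGreens movedReds : Code n → Coloring n → ℕ
    movedGreens p c = count (λ i → greens c i ∧ moved p i)
    movedReds   p c = count (λ i → reds c i ∧ moved p i)

    -- Dropping a green row saves one entry per red vertex, dropping a red column one per green
    -- vertex; the larger total saving is taken.
    rows : Code n → Coloring n → Bool
    rows p c = does (movedReds p c * count (greens c) ≤? movedGreens p c * count (reds c))

    moved-split : ∀ p c → count (moved p) ≡ movedGreens p c + movedReds p c
    moved-split p c = sym (trans (cong₂ _+_ (count-cong λ i → ∧-comm (greens c i) (moved p i))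
      (count-cong λ i → ∧-comm (reds c i) (moved p i))) (count-split (moved p) (greens c)))

    private
      count-∧≤ : ∀ {k} (f g : Fin k → Bool) → count (λ i → f i ∧ g i) ≤ count f
      count-∧≤ f g = ≤-trans (m≤m+n _ _) (≤-reflexive (count-split f g))

      exponent : ∀ {e d gr a} → e + d ≡ gr → t * a + gr ≤ m * m′ + d → (2 ^ t) ^ a * 2 ^ e ≤ 2 ^ (m * m′)
      exponent {e} {d} {gr} {a} refl h = begin
        (2 ^ t) ^ a * 2 ^ e   ≡⟨ cong (_* 2 ^ e) (^-*-assoc 2 t a) ⟩
        2 ^ (t * a) * 2 ^ e   ≡⟨ ^-distribˡ-+-* 2 (t * a) e ⟨
        2 ^ (t * a + e)       ≤⟨ ^-monoʳ-≤ 2 (+-cancelʳ-≤ d _ _ (≤-trans (≤-reflexive (+-assoc (t * a) e d)) h)) ⟩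
        2 ^ (m * m′)          ∎
        where open ≤-Reasoning

    module _ {b} (classes : Bijection (setoid (Fin b)) (bicoloredGraphs n)) where

      freeCount : Code n → Coloring n → ℕ
      freeCount p c = count (freeGreens classes rows p c) * count (freeReds classes rows p c)

      freeCount≤ : ∀ p c → freeCount p c ≤ count (greens c) * count (reds c)
      freeCount≤ p c = *-mono-≤ (count-∧≤ (greens c) _) (count-∧≤ (reds c) _)

      partial-bound : ∀ p c → (2 ^ t) ^ count (moved p) * 2 ^ freeCount p c ≤ 2 ^ (m * m′)
      partial-bound p c = by-cases (movedReds p c * count (greens c) ≤? movedGreens p c * count (reds c)) refl
        where
        open ≤-Reasoning
        g = count (greens c)
        r = count (reds c)
        a₁ = movedGreens p c
        a₂ = movedReds p c
        A = count (moved p)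
        a≡ : A ≡ a₁ + a₂
        a≡ = moved-split p c
        g+r≡ : g + r ≡ m + m′
        g+r≡ = trans (count-not (greens c)) n≡
        by-cases : (d : Dec (a₂ * g ≤ a₁ * r)) → rows p c ≡ does d → (2 ^ t) ^ A * 2 ^ freeCount p c ≤ 2 ^ (m * m′)
        by-cases (yes cheaper) eq = exponent {d = a₁ * r} {a = A} sum (subst (λ a → t * a + g * r ≤ m * m′ + a₁ * r) (sym a≡)
          (exponent-bound {t} m≤m′ m′≤ 12t≤m g+r≡ (count-∧≤ (greens c) _) (count-∧≤ (reds c) _) cheaper))
          where
          sum : freeCount p c + a₁ * r ≡ g * r
          sum = trans (cong₂ (λ x y → x * y + a₁ * r)
                  (count-cong λ i → cong (λ z → greens c i ∧ not (z ∧ moved p i)) eq)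
                  (count-cong λ i → trans (cong (λ z → reds c i ∧ not (not z ∧ moved p i)) eq) (∧-identityʳ _)))
            (trans (sym (*-distribʳ-+ r (count (λ i → greens c i ∧ not (moved p i))) a₁)) (cong (_* r) (trans (+-comm _ a₁) (count-split (greens c) (moved p)))))
        by-cases (no ¬cheaper) eq = exponent {d = a₂ * g} {a = A} sum (subst₂ (λ a x → t * a + x ≤ m * m′ + a₂ * g)
          (trans (+-comm a₂ a₁) (sym a≡)) (*-comm r g)
          (exponent-bound {t} m≤m′ m′≤ 12t≤m (trans (+-comm r g) g+r≡) (count-∧≤ (reds c) _) (count-∧≤ (greens c) _) (<⇒≤ (≰⇒> ¬cheaper))))
          where
          sum : freeCount p c + a₂ * g ≡ g * r
          sum = trans (cong₂ (λ x y → x * y + a₂ * g)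
                  (count-cong λ i → trans (cong (λ z → greens c i ∧ not (z ∧ moved p i)) eq) (∧-identityʳ _))
                  (count-cong λ i → cong (λ z → reds c i ∧ not (not z ∧ moved p i)) eq))
            (trans (cong (g * count (λ i → reds c i ∧ not (moved p i)) +_) (*-comm a₂ g)) (trans (sym (*-distribˡ-+ g (count (λ i → reds c i ∧ not (moved p i))) a₂)) (cong (g *_) (trans (+-comm _ a₂) (count-split (reds c) (moved p))))))

      private
        T Y L : ℕ
        T = 2 ^ t
        Y = 2 ^ n * 2 ^ (m * m′)
        L = labelledCount n
        X : Code n → ℕ
        X p = ∑ (colorings n) λ c → 2 ^ freeCount p c

      T^a*X≤Y : ∀ p → T ^ count (moved p) * X p ≤ Y
      T^a*X≤Y p = begin
        T ^ a * X p                                           ≡⟨ ∑-*ˡ (colorings n) (T ^ a) _ ⟨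
        ∑ (colorings n) (λ c → T ^ a * 2 ^ freeCount p c)     ≤⟨ ∑-mono (colorings n) (partial-bound p) ⟩
        ∑ (colorings n) (λ _ → 2 ^ (m * m′))                  ≡⟨ ∑-const (colorings n) _ ⟩
        length (colorings n) * 2 ^ (m * m′)                   ≡⟨ cong (_* 2 ^ (m * m′)) (length-colorings n) ⟩
        Y                                                     ∎
        where
        open ≤-Reasoning
        a = count (moved p)

      X≤L : ∀ p → X p ≤ L
      X≤L p = ∑-mono (colorings n) λ c → ^-monoʳ-≤ 2 (freeCount≤ p c)

      -- Separates the identity, the only code of positive weight 1 0, from the others.
      code-bound : ∀ p → T ^ n * X p + T ^ n * Y * weight 1 0 p ≤ T ^ n * L * weight 1 0 p + Y * weight T 1 p
      code-bound p with count (moved p) in eq | T^a*X≤Y p | weight-^ T p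
      -- For the identity `weight T 1` is T^n, so the two terms with Y cancel and `X≤L` remains.
      ... | zero  | _ | W≡ rewrite weight-1 p eq = begin
        T ^ n * X p + T ^ n * Y * 1              ≤⟨ +-mono-≤ (*-monoʳ-≤ (T ^ n) (X≤L p)) (≤-reflexive (*-identityʳ _)) ⟩
        T ^ n * L + T ^ n * Y                    ≡⟨ cong₂ _+_ (sym (*-identityʳ (T ^ n * L)))
                                                      (trans (*-comm (T ^ n) Y) (cong (Y *_) (trans (sym W≡) (+-identityʳ _)))) ⟩
        T ^ n * L * 1 + Y * weight T 1 p         ∎
        where open ≤-Reasoning
      -- For any other code T^n splits into T^a, which brings X below Y, and the weight.
      ... | suc a | h | W≡ rewrite weight-0 p (subst (0 <_) (sym eq) z<s) = begin
        T ^ n * X p + T ^ n * Y * 0              ≡⟨ trans (cong (T ^ n * X p +_) (*-zeroʳ (T ^ n * Y))) (+-identityʳ _) ⟩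
        T ^ n * X p                              ≡⟨ cong (_* X p) W≡ ⟨
        T ^ suc a * weight T 1 p * X p           ≡⟨ solve 3 (λ t w x → t :* w :* x := t :* x :* w) refl (T ^ suc a) (weight T 1 p) (X p) ⟩
        T ^ suc a * X p * weight T 1 p           ≤⟨ *-monoˡ-≤ (weight T 1 p) h ⟩
        Y * weight T 1 p                         ≡⟨ cong (_+ Y * weight T 1 p) (*-zeroʳ (T ^ n * L)) ⟨
        T ^ n * L * 0 + Y * weight T 1 p         ∎
        where
        open ≤-Reasoning
        open +-*-Solver using (solve; _:=_; _:*_)

      -- The identity contributes L; all other codes together contribute at most Y(R/T^n - 1), which
      -- `rising-bound` makes at most 2n²Y/T. The 1 subtracted there appears as a summand with Y on
      -- the left, to stay within ℕ.
      ∑X-bound : 2 * (n * n) ≤ T → T * ∑ (codes n) X ≤ T * L + 2 * n * n * Y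
      ∑X-bound 2n²≤T = +-cancelʳ-≤ (T * Y) _ _ (*-cancelˡ-≤ (T ^ n) {{m^n≢0 T n {{m^n≢0 2 t}}}} (begin
        T ^ n * (T * S + T * Y)                      ≡⟨ solve 4 (λ a t s y → a :* (t :* s :+ t :* y) := t :* (a :* s :+ a :* y :* con 1)) refl (T ^ n) T S Y ⟩
        T * (T ^ n * S + T ^ n * Y * 1)              ≤⟨ *-monoʳ-≤ T summed ⟩
        T * (T ^ n * L * 1 + Y * R)                  ≡⟨ solve 5 (λ a t l y r → t :* (a :* l :* con 1 :+ y :* r) := a :* (t :* l) :+ y :* (t :* r)) refl (T ^ n) T L Y R ⟩
        T ^ n * (T * L) + Y * (T * R)                ≤⟨ +-monoʳ-≤ (T ^ n * (T * L)) (*-monoʳ-≤ Y (rising-bound T n n 2n²≤T ≤-refl)) ⟩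
        T ^ n * (T * L) + Y * ((T + 2 * n * n) * T ^ n)
          ≡⟨ solve 5 (λ a t l y q → a :* (t :* l) :+ y :* ((t :+ q) :* a) := a :* (t :* l :+ q :* y :+ t :* y)) refl (T ^ n) T L Y (2 * n * n) ⟩
        T ^ n * (T * L + 2 * n * n * Y + T * Y)      ∎))
        where
        open ≤-Reasoning
        open +-*-Solver using (solve; _:=_; _:*_; _:+_; con)
        S = ∑ (codes n) X
        R = rising T 1 n
        summed : T ^ n * S + T ^ n * Y * 1 ≤ T ^ n * L * 1 + Y * R
        summed = subst₂ _≤_
          (trans (∑-+ (codes n) _ _) (cong₂ _+_ (∑-*ˡ (codes n) (T ^ n) X)
            (trans (∑-*ˡ (codes n) (T ^ n * Y) (weight 1 0)) (cong (T ^ n * Y *_) (trans (∑-weight 1 0 n) (rising-1-0 n))))))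
          (trans (∑-+ (codes n) _ _) (cong₂ _+_
            (trans (∑-*ˡ (codes n) (T ^ n * L) (weight 1 0)) (cong (T ^ n * L *_) (trans (∑-weight 1 0 n) (rising-1-0 n))))
            (trans (∑-*ˡ (codes n) Y (weight T 1)) (cong (Y *_) (∑-weight T 1 n)))))
          (∑-mono (codes n) code-bound)

      unlabelled-upper : 2 * (n * n) ≤ T → T * (b * n !) ≤ T * L + 2 * n * n * Y
      unlabelled-upper 2n²≤T = ≤-trans (*-monoʳ-≤ T (classes≤partials classes rows)) (∑X-bound 2n²≤T)

-- Comparison with the sum whose binomials are all replaced by the central one

module CentralTerms where
  open import Data.Nat.Base
  open import Data.Nat.Properties
  open import Data.Nat.Combinatorics renaming (_C_ to C) using (nCk≡nC[n∸k])
  open import Data.Nat.Solver using (module +-*-Solver)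
  open import Data.Fin.Base using (Fin)
  open import Data.List.Base using (length)
  open import Function.Bundles using (Bijection)
  open import Relation.Binary.PropositionalEquality
  open import Defs using (bicoloredGraphs)
  open Counting
  open Orbits using (colorings; labelled≤classes)
  open Estimates

  -- For n = P + Q, the summand of labelledCount n at distance i + 1 below P.
  wing majorant : (n P Q i : ℕ) → ℕ
  wing     n P Q i = C n (P ∸ suc i) * 2 ^ ((P ∸ suc i) * (Q + suc i))
  majorant n P Q i = C n P * 2 ^ ((P ∸ suc i) * (Q + suc i))

  ∑<-*ˡ : ∀ c N f → ∑< N (λ k → c * f k) ≡ c * ∑< N f
  ∑<-*ˡ c zero    f = sym (*-zeroʳ c)
  ∑<-*ˡ c (suc N) f = trans (cong (_+ c * f N) (∑<-*ˡ c N f)) (sym (*-distribˡ-+ c _ _))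

  ∑<-extend : ∀ {M N} f → M ≤ N → ∑< M f ≤ ∑< N f
  ∑<-extend {M} {N} f M≤N = ≤-trans (m≤m+n _ _)
    (≤-reflexive (trans (sym (∑<-split M (N ∸ M) f)) (cong (λ x → ∑< x f) (m+[n∸m]≡n M≤N))))

  module _ {n P Q} (P+Q≡n : P + Q ≡ n) (P≤1+Q : P ≤ suc Q) where

    wing≤majorant : ∀ N → ∑< N (wing n P Q) ≤ ∑< N (majorant n P Q)
    wing≤majorant N = ∑<-mono N λ i _ → *-monoˡ-≤ (2 ^ ((P ∸ suc i) * (Q + suc i))) (C≤C-central P+Q≡n P≤1+Q (suc i))

    -- `C-drop` with the worst distance K used for all K terms.
    majorant≤wing : ∀ {M} → M ≤ suc Q → Q ≤ suc P → ∀ {K} → K ≤ P →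
      M * ∑< K (majorant n P Q) ≤ M * ∑< K (wing n P Q) + K * suc K * ∑< K (majorant n P Q)
    majorant≤wing {M} M≤ Q≤ {K} K≤P = begin
      M * ∑< K (majorant n P Q)                         ≡⟨ ∑<-*ˡ M K _ ⟨
      ∑< K (λ i → M * majorant n P Q i)                 ≤⟨ ∑<-mono K term ⟩
      ∑< K (λ i → M * wing n P Q i + K * suc K * majorant n P Q i)  ≡⟨ ∑<-+ K _ _ ⟩
      ∑< K (λ i → M * wing n P Q i) + ∑< K (λ i → K * suc K * majorant n P Q i)
        ≡⟨ cong₂ _+_ (∑<-*ˡ M K _) (∑<-*ˡ (K * suc K) K _) ⟩
      M * ∑< K (wing n P Q) + K * suc K * ∑< K (majorant n P Q)     ∎
      where
      open ≤-Reasoning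
      open +-*-Solver using (solve; _:=_; _:*_; _:+_)
      term : ∀ i → i < K → M * majorant n P Q i ≤ M * wing n P Q i + K * suc K * majorant n P Q i
      term i i<K = begin
        M * (c * X)                          ≡⟨ *-assoc M c X ⟨
        M * c * X                            ≤⟨ *-monoˡ-≤ X (C-drop P+Q≡n P≤1+Q M≤ Q≤ (suc i) (≤-trans i<K K≤P)) ⟩
        (M * x + suc i * suc (suc i) * c) * X  ≤⟨ *-monoˡ-≤ X (+-monoʳ-≤ (M * x) (*-monoˡ-≤ c (*-mono-≤ i<K (s≤s i<K)))) ⟩
        (M * x + K * suc K * c) * X          ≡⟨ solve 5 (λ m x k c z → (m :* x :+ k :* c) :* z := m :* (x :* z) :+ k :* (c :* z)) refl M x (K * suc K) c X ⟩
        M * (x * X) + K * suc K * (c * X)    ∎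
        where
        c = C n P
        x = C n (P ∸ suc i)
        X = 2 ^ ((P ∸ suc i) * (Q + suc i))

  module _ {n m m′} (m≤m′ : m ≤ m′) (m′≤ : m′ ≤ suc m) (n≡ : n ≡ m + m′) where

    private
      m′+m≡n : m′ + m ≡ n
      m′+m≡n = trans (+-comm m′ m) (sym n≡)
      m≤n : m ≤ n
      m≤n = subst (m ≤_) (sym n≡) (m≤m+n m m′)
      n∸m : n ∸ m ≡ m′
      n∸m = trans (cong (_∸ m) n≡) (m+n∸m≡n m m′)
      right : ∀ i → n ∸ (suc m + i) ≡ m′ ∸ suc i
      right i = trans (cong (n ∸_) (sym (+-suc m i))) (trans (sym (∸-+-assoc n m (suc i))) (cong (_∸ suc i) n∸m))
      right≤ : ∀ i → i < m′ → suc m + i ≤ n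
      right≤ i i<m′ = subst₂ _≤_ (+-suc m i) (sym n≡) (+-monoʳ-≤ m i<m′)

    C-central : C n m ≡ C n m′
    C-central = trans (nCk≡nC[n∸k] m≤n) (cong (C n) n∸m)

    central : ℕ
    central = C n m * 2 ^ (m * m′)

    ∑-central : ∀ f → ∑< (suc n) f ≡ ∑< m (λ i → f (m ∸ suc i)) + f m + ∑< m′ (λ i → f (suc m + i))
    ∑-central f = trans (cong (λ x → ∑< (suc x) f) n≡) (trans (∑<-split (suc m) m′ f)
      (cong (λ x → x + f m + ∑< m′ (λ i → f (suc m + i))) (∑<-reverse m f)))

    -- The summand k = m + 1 + i is reflected to n - k = m′ - (i + 1), so the right wing is a left
    -- wing with m and m′ exchanged.
    labelledCount-central : labelledCount n ≡ ∑< m (wing n m m′) + central + ∑< m′ (wing n m′ m)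
    labelledCount-central = trans (labelledCount-≡ n) (trans (∑-central _) (cong₂ _+_ (cong₂ _+_
      (∑<-cong m λ i i<m → cong (λ x → C n (m ∸ suc i) * 2 ^ ((m ∸ suc i) * x)) (left i i<m))
      (cong (λ x → C n m * 2 ^ (m * x)) n∸m))
      (∑<-cong m′ λ i i<m′ → cong₂ (λ x y → x * 2 ^ y)
        (trans (nCk≡nC[n∸k] (right≤ i i<m′)) (cong (C n) (right i)))
        (trans (cong ((suc m + i) *_) (right i)) (trans (*-comm (suc m + i) (m′ ∸ suc i)) (cong ((m′ ∸ suc i) *_) (sym (+-suc m i))))))))
      where
      left : ∀ i → i < m → n ∸ (m ∸ suc i) ≡ m′ + suc i
      left i i<m = trans (cong (_∸ (m ∸ suc i)) (trans n≡ (trans (cong (_+ m′) (sym (m∸n+n≡m i<m)))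
        (+-assoc (m ∸ suc i) (suc i) m′)))) (trans (m+n∸m≡n (m ∸ suc i) _) (+-comm (suc i) m′))

    -- The labelled count with every binomial frozen at its central value, cut off after K terms on
    -- the left and N on the right. Divided by `central` it becomes a partial sum of the theta
    -- series.
    profile : ℕ → ℕ → ℕ
    profile K N = ∑< K (majorant n m m′) + central + ∑< N (majorant n m′ m)

    labelledCount≤profile : labelledCount n ≤ profile m m′
    labelledCount≤profile = ≤-trans (≤-reflexive labelledCount-central) (+-mono-≤ (+-monoˡ-≤ central
      (wing≤majorant (sym n≡) (≤-trans m≤m′ (n≤1+n m′)) m)) (wing≤majorant m′+m≡n m′≤ m′))

    profile≤labelledCount : ∀ {K} → K ≤ m → m * profile K K ≤ m * labelledCount n + K * suc K * profile K K
    profile≤labelledCount {K} K≤m = begin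
      m * (A + central + B)                           ≡⟨ solve 4 (λ m a c b → m :* (a :+ c :+ b) := m :* a :+ m :* c :+ m :* b) refl m A central B ⟩
      m * A + m * central + m * B                     ≤⟨ +-mono-≤ (+-monoˡ-≤ (m * central)
        (majorant≤wing (sym n≡) (≤-trans m≤m′ (n≤1+n m′)) (≤-trans m≤m′ (n≤1+n m′)) m′≤ K≤m))
        (majorant≤wing m′+m≡n m′≤ (n≤1+n m) (≤-trans m≤m′ (n≤1+n m′)) (≤-trans K≤m m≤m′)) ⟩
      m * A′ + k * A + m * central + (m * B′ + k * B) ≡⟨ solve 7 (λ m a′ k a c b′ b → m :* a′ :+ k :* a :+ m :* c :+ (m :* b′ :+ k :* b)
                                                          := m :* (a′ :+ c :+ b′) :+ k :* (a :+ b)) refl m A′ k A central B′ B ⟩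
      m * (A′ + central + B′) + k * (A + B)           ≤⟨ +-mono-≤ (*-monoʳ-≤ m (≤-trans (+-mono-≤ (+-monoˡ-≤ central (∑<-extend (wing n m m′) K≤m))
                                                            (∑<-extend (wing n m′ m) (≤-trans K≤m m≤m′))) (≤-reflexive (sym labelledCount-central))))
                                                          (*-monoʳ-≤ k (+-monoˡ-≤ B (m≤m+n A central))) ⟩
      m * labelledCount n + k * (A + central + B)     ∎
      where
      open ≤-Reasoning
      open +-*-Solver using (solve; _:=_; _:*_; _:+_)
      k = K * suc K
      A = ∑< K (majorant n m m′)
      A′ = ∑< K (wing n m m′)
      B = ∑< K (majorant n m′ m)
      B′ = ∑< K (wing n m′ m)

    -- The central binomial is the largest of n + 1 numbers with sum 2^n. So the error term, which
    -- counts all 2^n colorings at the maximal exponent, is only a polynomial multiple of `central`.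
    2^n≤[1+n]C : 2 ^ n ≤ suc n * C n m
    2^n≤[1+n]C = begin
      2 ^ n                             ≡⟨ length-colorings n ⟨
      length (colorings n)  ≡⟨ *-identityʳ _ ⟨
      length (colorings n) * 1  ≡⟨ ∑-const (colorings n) 1 ⟨
      ∑ (colorings n) (λ _ → 1)         ≡⟨ ∑-colorings n (λ _ → 1) ⟩
      ∑< (suc n) (λ k → C n k * 1)      ≡⟨ ∑<-cong (suc n) (λ k _ → *-identityʳ (C n k)) ⟩
      ∑< (suc n) (C n)                  ≡⟨ ∑-central (C n) ⟩
      ∑< m (λ i → C n (m ∸ suc i)) + C n m + ∑< m′ (λ i → C n (suc m + i))
        ≤⟨ +-mono-≤ (+-monoˡ-≤ (C n m) (∑<-mono m λ i _ → C≤C-central (sym n≡) (≤-trans m≤m′ (n≤1+n m′)) (suc i)))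
             (∑<-mono m′ λ i i<m′ → ≤-trans (≤-reflexive (trans (nCk≡nC[n∸k] (right≤ i i<m′)) (cong (C n) (right i))))
               (≤-trans (C≤C-central m′+m≡n m′≤ (suc i)) (≤-reflexive (sym C-central)))) ⟩
      ∑< m (λ _ → C n m) + C n m + ∑< m′ (λ _ → C n m)
        ≡⟨ cong₂ (λ x y → x + C n m + y) (∑<-const m (C n m)) (∑<-const m′ (C n m)) ⟩
      m * C n m + C n m + m′ * C n m    ≡⟨ solve 3 (λ m q c → m :* c :+ c :+ q :* c := (con 1 :+ (m :+ q)) :* c) refl m m′ (C n m) ⟩
      suc (m + m′) * C n m              ≡⟨ cong (λ x → suc x * C n m) n≡ ⟨
      suc n * C n m                     ∎
      where
      open ≤-Reasoning
      open +-*-Solver using (solve; _:=_; _:*_; _:+_; con)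

    module _ {b} (classes : Bijection (setoid (Fin b)) (bicoloredGraphs n)) where

      classes-lower : ∀ {K} → K ≤ m → m * profile K K ≤ m * (b * n !) + K * suc K * profile K K
      classes-lower {K} K≤m = ≤-trans (profile≤labelledCount K≤m)
        (+-monoˡ-≤ (K * suc K * profile K K) (*-monoʳ-≤ m (labelled≤classes classes)))

      classes-upper : ∀ t → 12 * t ≤ m → 2 * (n * n) ≤ 2 ^ t →
        2 ^ t * (b * n !) ≤ 2 ^ t * profile m m′ + 2 * n * n * suc n * central
      classes-upper t 12t≤m 2n²≤T = ≤-trans (unlabelled-upper {t = t} m≤m′ m′≤ n≡ 12t≤m classes 2n²≤T)
        (+-mono-≤ (*-monoʳ-≤ (2 ^ t) labelledCount≤profile) (begin
          2 * n * n * (2 ^ n * X)              ≤⟨ *-monoʳ-≤ (2 * n * n) (*-monoˡ-≤ X 2^n≤[1+n]C) ⟩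
          2 * n * n * (suc n * C n m * X)      ≡⟨ solve 4 (λ a b c x → a :* (b :* c :* x) := a :* b :* (c :* x)) refl (2 * n * n) (suc n) (C n m) X ⟩
          2 * n * n * suc n * central          ∎))
        where
        open ≤-Reasoning
        open +-*-Solver using (solve; _:=_; _:*_)
        X = 2 ^ (m * m′)

-- Rational partial sums of the theta series, and two-sided bounds for the normalized count

module Theta where
  open import Data.Nat.Base as ℕ using (ℕ; zero; suc; z≤n; s≤s; _!)
  import Data.Nat.Properties as ℕ
  open import Data.Nat.Combinatorics renaming (_C_ to C) using ()
  import Data.Nat.Solver as ℕSolver
  import Data.Integer.Base as ℤ
  import Data.Integer.Properties as ℤ
  open import Data.Rational.Base
  open import Data.Rational.Properties hiding (_≟_; _≤?_)
  open import Data.Rational.Solver using (module +-*-Solver)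
  open import Data.Fin.Base using (Fin)
  open import Data.Product.Base using (∃-syntax; _,_; proj₁; proj₂)
  open import Function.Bundles using (Bijection)
  open import Relation.Binary.PropositionalEquality
  open import Defs hiding (c)
  open Estimates using (∑<)
  open CentralTerms

  pow-½-antitone : ∀ {k l} → k ℕ.≤ l → pow ½ l ≤ pow ½ k
  pow-½-antitone {k} {l} k≤l = subst₂ _≤_
    (trans (sym (pow-+ ½ k (l ℕ.∸ k))) (cong (pow ½) (ℕ.m+[n∸m]≡n k≤l))) (*-identityʳ (pow ½ k))
    (*-monoˡ-≤-nonNeg (pow ½ k) {{nonNegative (0≤pow k 0≤½)}} (pow≤1 (l ℕ.∸ k) 0≤½ (*≤* (ℤ.+≤+ (s≤s z≤n)))))

  2^½^ : ∀ x y → fromℕ (2 ℕ.^ (x ℕ.+ y)) * pow ½ y ≡ fromℕ (2 ℕ.^ x)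
  2^½^ x y = begin
    fromℕ (2 ℕ.^ (x ℕ.+ y)) * pow ½ y                   ≡⟨ cong (λ z → fromℕ z * pow ½ y) (ℕ.^-distribˡ-+-* 2 x y) ⟩
    fromℕ (2 ℕ.^ x ℕ.* 2 ℕ.^ y) * pow ½ y               ≡⟨ cong (_* pow ½ y) (fromℕ-homo-* (2 ℕ.^ x) (2 ℕ.^ y)) ⟩
    fromℕ (2 ℕ.^ x) * fromℕ (2 ℕ.^ y) * pow ½ y         ≡⟨ *-assoc (fromℕ (2 ℕ.^ x)) (fromℕ (2 ℕ.^ y)) (pow ½ y) ⟩
    fromℕ (2 ℕ.^ x) * (fromℕ (2 ℕ.^ y) * pow ½ y)       ≡⟨ cong (λ z → fromℕ (2 ℕ.^ x) * (z * pow ½ y)) (sym (pow-fromℕ 2 y)) ⟩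
    fromℕ (2 ℕ.^ x) * (pow (fromℕ 2) y * pow ½ y)       ≡⟨ cong (fromℕ (2 ℕ.^ x) *_) (trans (sym (pow-* (fromℕ 2) ½ y)) (pow-1 y)) ⟩
    fromℕ (2 ℕ.^ x) * 1ℚ                                ≡⟨ *-identityʳ _ ⟩
    fromℕ (2 ℕ.^ x)                                     ∎
    where open ≡-Reasoning

  -- The values of k(k + ε) at k = i + 1 and at k = -(i + 1). For ε ≤ 1 this exponent is (k + ε/2)²
  -- - ε/4.
  left right : ℕ → ℕ → ℕ
  left  ε i = suc i ℕ.* (suc i ℕ.+ ε)
  right ε i = suc i ℕ.* (suc i ℕ.∸ ε)

  -- The sum of 2^{-k(k+ε)} over |k| ≤ K.
  theta : ℕ → ℕ → ℚ
  theta ε zero    = 1ℚ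
  theta ε (suc K) = theta ε K + (pow ½ (left ε K) + pow ½ (right ε K))

  module _ {ε : ℕ} (ε≤1 : ε ℕ.≤ 1) where

    private
      i≤left : ∀ i → i ℕ.≤ left ε i
      i≤left i = ℕ.≤-trans (ℕ.n≤1+n i) (ℕ.≤-trans (ℕ.m≤m+n (suc i) ε) (ℕ.m≤n*m (suc i ℕ.+ ε) (suc i)))
      i≤right : ∀ i → i ℕ.≤ right ε i
      i≤right i = ℕ.≤-trans (ℕ.∸-monoʳ-≤ (suc i) ε≤1) (ℕ.m≤n*m (suc i ℕ.∸ ε) (suc i))
      0≤pow½ : ∀ k → 0ℚ ≤ pow ½ k
      0≤pow½ k = 0≤pow k 0≤½
      ½ˡ ½ʳ : ℕ → ℚ
      ½ˡ i = pow ½ (left ε i)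
      ½ʳ i = pow ½ (right ε i)
      mono = S-mono (theta ε) ½ˡ ½ʳ (λ _ → refl)
        (λ i → 0≤pow½ (left ε i) , pow-½-antitone (i≤left i)) (λ i → 0≤pow½ (right ε i) , pow-½-antitone (i≤right i))

    theta-mono : ∀ {K J} → K ℕ.≤ J → theta ε K ≤ theta ε J
    theta-mono {K} {J} K≤J = subst (λ x → theta ε K ≤ theta ε x) (ℕ.m∸n+n≡m K≤J) (proj₁ (mono K (J ℕ.∸ K)))

    theta-tail : ∀ {K J} → K ℕ.≤ J → theta ε J ≤ theta ε K + tail K
    theta-tail {K} {J} K≤J = ≤-trans (p≤p+q (theta ε J) (tail J) (0≤tail J))
      (subst (λ x → theta ε x + tail x ≤ theta ε K + tail K) (ℕ.m∸n+n≡m K≤J) (proj₂ (mono K (J ℕ.∸ K))))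

    1≤theta : ∀ K → 1ℚ ≤ theta ε K
    1≤theta K = theta-mono {0} {K} z≤n

    -- The 5 is `theta ε 0` + `tail 0` = 1 + 4.
    theta≤5 : ∀ K → theta ε K ≤ fromℕ 5
    theta≤5 K = theta-tail {0} {K} z≤n

  0<fromℕ : ∀ {n} → 0 ℕ.< n → 0ℚ < fromℕ n
  0<fromℕ {suc n} _ = *<* (ℤ.+<+ (s≤s z≤n))

  0≤fromℕ : ∀ n → 0ℚ ≤ fromℕ n
  0≤fromℕ n = fromℕ-mono-≤ {0} {n} z≤n

  fromℕ-homo-+ : ∀ m n → fromℕ (m ℕ.+ n) ≡ fromℕ m + fromℕ n
  fromℕ-homo-+ m n = fromℤ-homo-+ (ℤ.+ m) (ℤ.+ n)

  eventually-≤ : ∀ c η → 0ℚ < η → ∃[ N ] ∀ n → N ℕ.≤ n → fromℕ c ≤ fromℕ n * η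
  eventually-≤ c η 0<η with archimedean η 0<η
  ... | A , a = c ℕ.* suc A , λ n h → begin
    fromℕ c                             ≡⟨ *-identityʳ (fromℕ c) ⟨
    fromℕ c * 1ℚ                        ≡⟨ cong (fromℕ c *_) (trans (*-comm (fromℕ (suc A)) (δ A)) (δ*suc A)) ⟨
    fromℕ c * (fromℕ (suc A) * δ A)     ≡⟨ *-assoc (fromℕ c) (fromℕ (suc A)) (δ A) ⟨
    fromℕ c * fromℕ (suc A) * δ A       ≡⟨ cong (_* δ A) (fromℕ-homo-* c (suc A)) ⟨
    fromℕ (c ℕ.* suc A) * δ A           ≤⟨ *-mono (<⇒≤ (*<* (ℤ.+<+ (s≤s z≤n)))) (0≤fromℕ n) (fromℕ-mono-≤ h) (<⇒≤ (a A ℕ.≤-refl)) ⟩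
    fromℕ n * η                         ∎
    where open ≤-Reasoning

  -- With s = i + 1 this is (P - s)(Q + s) = PQ - s(s + Q - P). The proof writes P = d + s and Q = d
  -- + e, so that no truncated difference is left.
  majorant-pow : ∀ n P Q i → suc i ℕ.≤ P → P ℕ.≤ suc i ℕ.+ Q →
    fromℕ (majorant n P Q i) ≡ fromℕ (C n P ℕ.* 2 ℕ.^ (P ℕ.* Q)) * pow ½ (suc i ℕ.* (suc i ℕ.+ Q ℕ.∸ P))
  majorant-pow n P Q i s≤P P≤s+Q = begin
    fromℕ (c ℕ.* 2 ℕ.^ x)                        ≡⟨ fromℕ-homo-* c (2 ℕ.^ x) ⟩
    fromℕ c * fromℕ (2 ℕ.^ x)                    ≡⟨ cong (fromℕ c *_) (2^½^ x y) ⟨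
    fromℕ c * (fromℕ (2 ℕ.^ (x ℕ.+ y)) * pow ½ y)  ≡⟨ *-assoc (fromℕ c) (fromℕ (2 ℕ.^ (x ℕ.+ y))) (pow ½ y) ⟨
    fromℕ c * fromℕ (2 ℕ.^ (x ℕ.+ y)) * pow ½ y  ≡⟨ cong (_* pow ½ y) (trans (sym (fromℕ-homo-* c _)) (cong (λ z → fromℕ (c ℕ.* 2 ℕ.^ z)) x+y≡)) ⟩
    fromℕ (c ℕ.* 2 ℕ.^ (P ℕ.* Q)) * pow ½ y      ∎
    where
    open ≡-Reasoning
    s = suc i
    c = C n P
    d = P ℕ.∸ s
    e = s ℕ.+ Q ℕ.∸ P
    x = d ℕ.* (Q ℕ.+ s)
    y = s ℕ.* e
    d+s≡ : d ℕ.+ s ≡ P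
    d+s≡ = ℕ.m∸n+n≡m s≤P
    d+e≡Q : d ℕ.+ e ≡ Q
    d+e≡Q = ℕ.+-cancelʳ-≡ s (d ℕ.+ e) Q (trans (solve 3 (λ d e s → d :+ e :+ s := e :+ (d :+ s)) refl d e s)
      (trans (cong (e ℕ.+_) d+s≡) (trans (ℕ.m∸n+n≡m P≤s+Q) (ℕ.+-comm s Q))))
      where open ℕSolver.+-*-Solver
    x+y≡ : x ℕ.+ y ≡ P ℕ.* Q
    x+y≡ = subst₂ (λ P Q → d ℕ.* (Q ℕ.+ s) ℕ.+ y ≡ P ℕ.* Q) d+s≡ d+e≡Q
      (solve 3 (λ d e s → d :* (d :+ e :+ s) :+ s :* e := (d :+ s) :* (d :+ e)) refl d e s)
      where open ℕSolver.+-*-Solver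

  module _ {n m ε : ℕ} (ε≤1 : ε ℕ.≤ 1) (n≡ : n ≡ m ℕ.+ (m ℕ.+ ε)) where

    private
      m′ = m ℕ.+ ε
      m≤m′ : m ℕ.≤ m′
      m≤m′ = ℕ.m≤m+n m ε
      m′≤ : m′ ℕ.≤ suc m
      m′≤ = ℕ.≤-trans (ℕ.+-monoʳ-≤ m ε≤1) (ℕ.≤-reflexive (ℕ.+-comm m 1))

    Z : ℚ
    Z = fromℕ (central m≤m′ m′≤ n≡)

    left-term : ∀ i → i ℕ.< m → fromℕ (majorant n m m′ i) ≡ Z * pow ½ (left ε i)
    left-term i i<m = trans (majorant-pow n m m′ i i<m (ℕ.≤-trans m≤m′ (ℕ.m≤n+m m′ (suc i))))
      (cong (λ x → Z * pow ½ (suc i ℕ.* x)) (trans (cong (ℕ._∸ m) (solve 3 (λ s m e → s :+ (m :+ e) := s :+ e :+ m) refl (suc i) m ε)) (ℕ.m+n∸n≡m (suc i ℕ.+ ε) m)))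
      where open ℕSolver.+-*-Solver

    right-term : ∀ i → i ℕ.< m′ → fromℕ (majorant n m′ m i) ≡ Z * pow ½ (right ε i)
    right-term i i<m′ = trans (majorant-pow n m′ m i i<m′ (ℕ.≤-trans m′≤ (ℕ.+-monoˡ-≤ m (s≤s (z≤n {i})))))
      (cong₂ (λ z x → fromℕ z * pow ½ (suc i ℕ.* x))
        (cong₂ (λ a b → a ℕ.* 2 ℕ.^ b) (sym (C-central m≤m′ m′≤ n≡)) (ℕ.*-comm m′ m))
        (trans (cong (ℕ._∸ m′) (ℕ.+-comm (suc i) m)) (ℕ.[m+n]∸[m+o]≡n∸o m (suc i) ε)))

    profile-ℚ : ∀ K → K ℕ.≤ m → fromℕ (profile m≤m′ m′≤ n≡ K K) ≡ Z * theta ε K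
    profile-ℚ zero    _ = trans (cong fromℕ (ℕ.+-identityʳ _)) (sym (*-identityʳ Z))
    profile-ℚ (suc K) K<m = begin
      fromℕ (A ℕ.+ a ℕ.+ z ℕ.+ (B ℕ.+ b))       ≡⟨ cong fromℕ (solve 5 (λ A a z B b → A :+ a :+ z :+ (B :+ b) := A :+ z :+ B :+ (a :+ b)) refl A a z B b) ⟩
      fromℕ (A ℕ.+ z ℕ.+ B ℕ.+ (a ℕ.+ b))       ≡⟨ fromℕ-homo-+ (A ℕ.+ z ℕ.+ B) (a ℕ.+ b) ⟩
      fromℕ (A ℕ.+ z ℕ.+ B) + fromℕ (a ℕ.+ b)   ≡⟨ cong₂ _+_ (profile-ℚ K (ℕ.<⇒≤ K<m)) (trans (fromℕ-homo-+ a b)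
                                                    (cong₂ _+_ (left-term K K<m) (right-term K (ℕ.≤-trans K<m m≤m′)))) ⟩
      Z * theta ε K + (Z * pow ½ (left ε K) + Z * pow ½ (right ε K))  ≡⟨ cong (Z * theta ε K +_) (*-distribˡ-+ Z (pow ½ (left ε K)) (pow ½ (right ε K))) ⟨
      Z * theta ε K + Z * (pow ½ (left ε K) + pow ½ (right ε K))       ≡⟨ *-distribˡ-+ Z (theta ε K) (pow ½ (left ε K) + pow ½ (right ε K)) ⟨
      Z * theta ε (suc K)                       ∎
      where
      open ≡-Reasoning
      open ℕSolver.+-*-Solver
      A = ∑< K (majorant n m m′)
      a = majorant n m m′ K
      z = central m≤m′ m′≤ n≡
      B = ∑< K (majorant n m′ m)
      b = majorant n m′ m K

    -- For odd n the right wing has one term more than the left one, while `theta` takes its terms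
    -- in pairs. The missing left term is added, which costs only an inequality.
    profile-≤ : ∀ d → d ℕ.≤ ε → fromℕ (profile m≤m′ m′≤ n≡ m (d ℕ.+ m)) ≤ Z * theta ε (d ℕ.+ m)
    profile-≤ zero    _   = ≤-reflexive (profile-ℚ m ℕ.≤-refl)
    profile-≤ (suc d) d<ε = begin
      fromℕ (A ℕ.+ (B ℕ.+ b))                   ≡⟨ cong fromℕ (ℕ.+-assoc A B b) ⟨
      fromℕ (A ℕ.+ B ℕ.+ b)                     ≡⟨ fromℕ-homo-+ (A ℕ.+ B) b ⟩
      fromℕ (A ℕ.+ B) + fromℕ b                 ≤⟨ +-mono-≤ (profile-≤ d (ℕ.<⇒≤ d<ε)) (≤-reflexive (right-term K K<m′)) ⟩
      Z * theta ε K + Z * pow ½ (right ε K)     ≡⟨ *-distribˡ-+ Z (theta ε K) _ ⟨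
      Z * (theta ε K + pow ½ (right ε K))       ≤⟨ *-monoˡ-≤-nonNeg Z {{nonNegative (0≤fromℕ (central m≤m′ m′≤ n≡))}} (+-monoʳ-≤ (theta ε K) grow) ⟩
      Z * theta ε (suc K)                       ∎
      where
      open ≤-Reasoning
      K = d ℕ.+ m
      A = ∑< m (majorant n m m′) ℕ.+ central m≤m′ m′≤ n≡
      B = ∑< K (majorant n m′ m)
      b = majorant n m′ m K
      K<m′ : K ℕ.< m′
      K<m′ = ℕ.≤-trans (ℕ.+-monoˡ-≤ m d<ε) (ℕ.≤-reflexive (ℕ.+-comm ε m))
      grow : pow ½ (right ε K) ≤ pow ½ (left ε K) + pow ½ (right ε K)
      grow = subst (pow ½ (right ε K) ≤_) (+-comm (pow ½ (right ε K)) _) (p≤p+q _ _ (0≤pow (left ε K) 0≤½))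

    profile-upper : fromℕ (profile m≤m′ m′≤ n≡ m m′) ≤ Z * theta ε m′
    profile-upper = subst (λ N → fromℕ (profile m≤m′ m′≤ n≡ m N) ≤ Z * theta ε N) (ℕ.+-comm ε m) (profile-≤ ε ℕ.≤-refl)

    0<Z : 0ℚ < Z
    0<Z = 0<fromℕ (ℕ.n≢0⇒n>0 λ Z≡0 → ℕ.<-irrefl refl (ℕ.≤-trans (1≤central Z≡0) (ℕ.≤-reflexive (ℕ.*-zeroʳ (suc n)))))
      where
      1≤central : central m≤m′ m′≤ n≡ ≡ 0 → 1 ℕ.≤ suc n ℕ.* 0
      1≤central Z≡0 = ℕ.≤-trans (ℕ.≤-trans (ℕ.m^n>0 2 n) (2^n≤[1+n]C m≤m′ m′≤ n≡))
        (ℕ.*-monoʳ-≤ (suc n) (ℕ.≤-reflexive (ℕ.m*n≡0⇒m≡0 (C n m) (2 ℕ.^ (m ℕ.* m′)) {{ℕ.m^n≢0 2 (m ℕ.* m′)}} Z≡0)))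

    module _ {b} (classes : Bijection (setoid (Fin b)) (bicoloredGraphs n)) {v : ℚ} (v≡ : v * Z ≡ fromℕ (b ℕ.* n !)) where

      private instance
        _ = positive 0<Z

      -- Here v is the normalized count b n!/Z, and the bound says v ≥ (1 - K(K+1)/m) `theta ε K`:
      -- for fixed K the error vanishes as m grows.
      ratio-lower : ∀ {K} → K ℕ.≤ m → fromℕ m * theta ε K ≤ fromℕ m * v + fromℕ (K ℕ.* suc K) * theta ε K
      ratio-lower {K} K≤m = *-cancelʳ-≤-pos Z (subst₂ _≤_ lhs rhs (fromℕ-mono-≤ (classes-lower m≤m′ m′≤ n≡ classes K≤m)))
        where
        open +-*-Solver
        k = K ℕ.* suc K
        U = profile m≤m′ m′≤ n≡ K K
        lhs : fromℕ (m ℕ.* U) ≡ fromℕ m * theta ε K * Z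
        lhs = trans (fromℕ-homo-* m U) (trans (cong (fromℕ m *_) (profile-ℚ K K≤m))
          (solve 3 (λ a z t → a :* (z :* t) := a :* t :* z) refl (fromℕ m) Z (theta ε K)))
        rhs : fromℕ (m ℕ.* (b ℕ.* n !) ℕ.+ k ℕ.* U) ≡ (fromℕ m * v + fromℕ k * theta ε K) * Z
        rhs = trans (fromℕ-homo-+ (m ℕ.* (b ℕ.* n !)) _) (trans (cong₂ _+_
          (trans (fromℕ-homo-* m _) (cong (fromℕ m *_) (sym v≡)))
          (trans (fromℕ-homo-* k U) (cong (fromℕ k *_) (profile-ℚ K K≤m))))
          (solve 5 (λ a v z k t → a :* (v :* z) :+ k :* (z :* t) := (a :* v :+ k :* t) :* z) refl (fromℕ m) v Z (fromℕ k) (theta ε K)))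

      -- Divided by 2^t, the nontrivial automorphisms add at most 2n²(n + 1)/2^t to the theta sum.
      ratio-upper : ∀ t → 12 ℕ.* t ℕ.≤ m → 2 ℕ.* (n ℕ.* n) ℕ.≤ 2 ℕ.^ t →
        fromℕ (2 ℕ.^ t) * v ≤ fromℕ (2 ℕ.^ t) * theta ε m′ + fromℕ (2 ℕ.* n ℕ.* n ℕ.* suc n)
      ratio-upper t 12t≤m 2n²≤T = *-cancelʳ-≤-pos Z (≤-trans (≤-reflexive lhs)
        (≤-trans (fromℕ-mono-≤ (classes-upper m≤m′ m′≤ n≡ classes t 12t≤m 2n²≤T)) rhs))
        where
        open +-*-Solver
        T = 2 ℕ.^ t
        q = 2 ℕ.* n ℕ.* n ℕ.* suc n
        P = profile m≤m′ m′≤ n≡ m m′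
        lhs : fromℕ T * v * Z ≡ fromℕ (T ℕ.* (b ℕ.* n !))
        lhs = trans (*-assoc (fromℕ T) v Z) (trans (cong (fromℕ T *_) v≡) (sym (fromℕ-homo-* T _)))
        rhs : fromℕ (T ℕ.* P ℕ.+ q ℕ.* central m≤m′ m′≤ n≡) ≤ (fromℕ T * theta ε m′ + fromℕ q) * Z
        rhs = ≤-trans (≤-reflexive (trans (fromℕ-homo-+ (T ℕ.* P) _) (cong₂ _+_ (fromℕ-homo-* T P) (fromℕ-homo-* q _))))
          (≤-trans (+-monoˡ-≤ (fromℕ q * Z) (*-monoˡ-≤-nonNeg (fromℕ T) {{nonNegative (0≤fromℕ T)}} profile-upper))
            (≤-reflexive (solve 4 (λ t z h q → t :* (z :* h) :+ q :* z := (t :* h :+ q) :* z) refl (fromℕ T) Z (theta ε m′) (fromℕ q))))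

  -- With t = 4u the factor 2ᵗ ≥ (u + 1)⁴ outgrows the cubic n²(n + 1); u = ⌊m/48⌋
  -- keeps 12 t ≤ m.
  module Growth {m n u : ℕ} (n≤ : n ℕ.≤ suc (2 ℕ.* m)) (48u≤m : 48 ℕ.* u ℕ.≤ m) (m<48[1+u] : m ℕ.< 48 ℕ.* suc u) where

    private
      open ℕSolver.+-*-Solver
      open ℕ.≤-Reasoning

      n<2^n : ∀ n → n ℕ.< 2 ℕ.^ n
      n<2^n zero    = s≤s z≤n
      n<2^n (suc n) = subst (ℕ._≤ 2 ℕ.^ suc n) (ℕ.+-comm (suc n) 1)
        (ℕ.+-mono-≤ (n<2^n n) (subst (1 ℕ.≤_) (sym (ℕ.+-identityʳ (2 ℕ.^ n))) (ℕ.m^n>0 2 n)))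

    12t≤m : 12 ℕ.* (u ℕ.* 4) ℕ.≤ m
    12t≤m = subst (ℕ._≤ m) (solve 1 (λ u → con 48 :* u := con 12 :* (u :* con 4)) refl u) 48u≤m

    1+n≤ : suc n ℕ.≤ 96 ℕ.* suc u
    1+n≤ = begin
      suc n                  ≤⟨ s≤s n≤ ⟩
      2 ℕ.+ 2 ℕ.* m          ≡⟨ ℕ.*-suc 2 m ⟨
      2 ℕ.* suc m            ≤⟨ ℕ.*-monoʳ-≤ 2 m<48[1+u] ⟩
      2 ℕ.* (48 ℕ.* suc u)   ≡⟨ ℕ.*-assoc 2 48 (suc u) ⟨
      96 ℕ.* suc u           ∎

    -- Both n and n + 1 are at most 96(u + 1), where 96 = 2 · 48. The fourth factor u + 1 is one
    -- more than the cubic needs, so the error divided by 2^t is at most 2 · 96³/(u + 1) and tends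
    -- to 0.
    growth : 2 ℕ.* n ℕ.* n ℕ.* suc n ℕ.* suc u ℕ.≤ 2 ℕ.* (96 ℕ.^ 3) ℕ.* 2 ℕ.^ (u ℕ.* 4)
    growth = begin
      2 ℕ.* n ℕ.* n ℕ.* suc n ℕ.* suc u        ≤⟨ ℕ.*-monoˡ-≤ (suc u) (ℕ.*-mono-≤ (ℕ.*-mono-≤ (ℕ.*-monoʳ-≤ 2 n≤96U) n≤96U) 1+n≤) ⟩
      2 ℕ.* (96 ℕ.* U) ℕ.* (96 ℕ.* U) ℕ.* (96 ℕ.* U) ℕ.* U
        ≡⟨ solve 2 (λ a U → con 2 :* (a :* U) :* (a :* U) :* (a :* U) :* U := con 2 :* (a :^ 3) :* (U :^ 4)) refl 96 U ⟩
      2 ℕ.* (96 ℕ.^ 3) ℕ.* U ℕ.^ 4             ≤⟨ ℕ.*-monoʳ-≤ (2 ℕ.* 96 ℕ.^ 3) (ℕ.^-monoˡ-≤ 4 (n<2^n u)) ⟩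
      2 ℕ.* (96 ℕ.^ 3) ℕ.* (2 ℕ.^ u) ℕ.^ 4     ≡⟨ cong (2 ℕ.* (96 ℕ.^ 3) ℕ.*_) (ℕ.^-*-assoc 2 u 4) ⟩
      2 ℕ.* (96 ℕ.^ 3) ℕ.* 2 ℕ.^ (u ℕ.* 4)     ∎
      where
      U = suc u
      n≤96U : n ℕ.≤ 96 ℕ.* U
      n≤96U = ℕ.≤-trans (ℕ.n≤1+n n) 1+n≤

    -- `growth` again: once u exceeds its constant, the spare factor u + 1 absorbs that constant.
    2n²≤T : 2 ℕ.* (96 ℕ.^ 3) ℕ.≤ u → 2 ℕ.* (n ℕ.* n) ℕ.≤ 2 ℕ.^ (u ℕ.* 4)
    2n²≤T c≤u = ℕ.*-cancelˡ-≤ (suc u) (begin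
      suc u ℕ.* (2 ℕ.* (n ℕ.* n))              ≤⟨ ℕ.m≤m*n _ (suc n) ⟩
      suc u ℕ.* (2 ℕ.* (n ℕ.* n)) ℕ.* suc n    ≡⟨ solve 3 (λ U n s → U :* (con 2 :* (n :* n)) :* s := con 2 :* n :* n :* s :* U) refl (suc u) n (suc n) ⟩
      2 ℕ.* n ℕ.* n ℕ.* suc n ℕ.* suc u        ≤⟨ growth ⟩
      2 ℕ.* (96 ℕ.^ 3) ℕ.* 2 ℕ.^ (u ℕ.* 4)     ≤⟨ ℕ.*-monoˡ-≤ (2 ℕ.^ (u ℕ.* 4)) (ℕ.≤-trans c≤u (ℕ.n≤1+n u)) ⟩
      suc u ℕ.* 2 ℕ.^ (u ℕ.* 4)                ∎)

-- The normalized count approaches the theta series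

module RatioLimit where
  open import Data.Nat.Base as ℕ using (ℕ; suc; z≤n; s≤s; _!)
  import Data.Nat.Properties as ℕ
  import Data.Nat.DivMod as ℕ
  open import Data.Rational.Base
  open import Data.Rational.Properties hiding (_≟_; _≤?_)
  open import Data.Rational.Solver using (module +-*-Solver)
  open import Data.Fin.Base using (Fin)
  open import Data.Product.Base using (∃-syntax; _×_; _,_; proj₁; proj₂)
  open import Data.Sum.Base using (inj₁; inj₂)
  open import Function.Bundles using (Bijection)
  open import Relation.Binary.PropositionalEquality
  open import Defs hiding (c)
  open Theta

  ∣p-q∣≤ : ∀ p q η → p ≤ q + η → q ≤ p + η → ∣ p - q ∣ ≤ η
  ∣p-q∣≤ p q η h k with ∣p∣≡p∨∣p∣≡-p (p - q)
  ... | inj₁ e = subst (_≤ η) (sym e) (p≤q+r⇒p-q≤r p q η h)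
  ... | inj₂ e = subst (_≤ η) (sym (trans e (solve 2 (λ p q → :- (p :- q) := q :- p) refl p q))) (p≤q+r⇒p-q≤r q p η k)
    where open +-*-Solver

  div48 : ∀ m → ∃[ u ] 48 ℕ.* u ℕ.≤ m × m ℕ.< 48 ℕ.* suc u
  div48 m = u , subst (ℕ._≤ m) (ℕ.*-comm u 48) (ℕ.m/n*n≤m m 48)
    , (begin-strict
        m                       ≡⟨ ℕ.m≡m%n+[m/n]*n m 48 ⟩
        m ℕ.% 48 ℕ.+ u ℕ.* 48   <⟨ ℕ.+-monoˡ-< (u ℕ.* 48) (ℕ.m%n<n m 48) ⟩
        48 ℕ.+ u ℕ.* 48         ≡⟨ ℕ.*-comm (suc u) 48 ⟩
        48 ℕ.* suc u            ∎)
    where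
    open ℕ.≤-Reasoning
    u = m ℕ./ 48

  add-halves : ∀ p q r η → p ≤ q + ½ * η → q ≤ r + ½ * η → p ≤ r + η
  add-halves p q r η a b = ≤-trans a (≤-trans (+-monoˡ-≤ (½ * η) b)
    (≤-reflexive (trans (+-assoc r (½ * η) (½ * η)) (cong (r +_) (½+½ η)))))
  n≤1+2m : ∀ ε n m → ε ℕ.≤ 1 → n ≡ m ℕ.+ (m ℕ.+ ε) → n ℕ.≤ suc (2 ℕ.* m)
  n≤1+2m ε n m ε≤1 n≡ = ℕ.≤-trans (ℕ.≤-reflexive n≡) (ℕ.≤-trans (ℕ.+-monoʳ-≤ m (ℕ.+-monoʳ-≤ m ε≤1))
    (ℕ.≤-reflexive (trans (cong (m ℕ.+_) (ℕ.+-comm m 1)) (trans (ℕ.+-suc m m) (cong (λ x → suc (m ℕ.+ x)) (sym (ℕ.+-identityʳ m)))))))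
  -- The error K(K+1)w/M is made independent of the theta value w through w ≤ 5.
  cancel-lower : ∀ M K w v h → 0 ℕ.< M → fromℕ M * w ≤ fromℕ M * v + fromℕ (K ℕ.* suc K) * w →
    w ≤ fromℕ 5 → fromℕ (K ℕ.* suc K ℕ.* 5) ≤ fromℕ M * h → w ≤ v + h
  cancel-lower M K w v h 0<M a w≤5 b = *-cancelˡ-≤-pos (fromℕ M) {{positive (0<fromℕ 0<M)}} (begin
    fromℕ M * w                                   ≤⟨ a ⟩
    fromℕ M * v + fromℕ (K ℕ.* suc K) * w         ≤⟨ +-monoʳ-≤ (fromℕ M * v) (*-monoˡ-≤-nonNeg (fromℕ k) {{nonNegative (0≤fromℕ k)}} w≤5) ⟩
    fromℕ M * v + fromℕ (K ℕ.* suc K) * fromℕ 5   ≡⟨ cong (fromℕ M * v +_) (fromℕ-homo-* k 5) ⟨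
    fromℕ M * v + fromℕ (K ℕ.* suc K ℕ.* 5)       ≤⟨ +-monoʳ-≤ (fromℕ M * v) b ⟩
    fromℕ M * v + fromℕ M * h                     ≡⟨ *-distribˡ-+ (fromℕ M) v h ⟨
    fromℕ M * (v + h)                             ∎)
    where
    open ≤-Reasoning
    k = K ℕ.* suc K
  cancel-upper : ∀ T u q c v w h → 0 ℕ.< T → 0 ℕ.< u → fromℕ T * v ≤ fromℕ T * w + fromℕ q →
    q ℕ.* u ℕ.≤ c ℕ.* T → fromℕ c ≤ fromℕ u * h → v ≤ w + h
  cancel-upper T u q c v w h 0<T 0<u a b d = *-cancelˡ-≤-pos (fromℕ T) {{positive (0<fromℕ 0<T)}} (begin
    fromℕ T * v               ≤⟨ a ⟩
    fromℕ T * w + fromℕ q     ≤⟨ +-monoʳ-≤ (fromℕ T * w) q≤ ⟩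
    fromℕ T * w + fromℕ T * h ≡⟨ *-distribˡ-+ (fromℕ T) w h ⟨
    fromℕ T * (w + h)         ∎)
    where
    open ≤-Reasoning
    open +-*-Solver using (solve; _:=_; _:*_)
    q≤ : fromℕ q ≤ fromℕ T * h
    q≤ = *-cancelʳ-≤-pos (fromℕ u) {{positive (0<fromℕ 0<u)}} (begin
      fromℕ q * fromℕ u          ≡⟨ fromℕ-homo-* q u ⟨
      fromℕ (q ℕ.* u)            ≤⟨ fromℕ-mono-≤ b ⟩
      fromℕ (c ℕ.* T)            ≡⟨ fromℕ-homo-* c T ⟩
      fromℕ c * fromℕ T          ≤⟨ *-monoʳ-≤-nonNeg (fromℕ T) {{nonNegative (0≤fromℕ T)}} d ⟩
      fromℕ u * h * fromℕ T      ≡⟨ solve 3 (λ u h t → u :* h :* t := t :* h :* u) refl (fromℕ u) h (fromℕ T) ⟩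
      fromℕ T * h * fromℕ u      ∎)

  private
    c₀ : ℕ
    c₀ = 2 ℕ.* 96 ℕ.^ 3

  -- One half of η pays for the theta tail beyond K, the other for the error in `ratio-lower` or
  -- `ratio-upper`. In the threshold for m, N₁ serves the lower and N₂ the upper error, while c₀
  -- secures 2n² ≤ 2^t; the 48 converts a bound for u into one for m.
  ratio-close : ∀ η K N₁ N₂ → tail K < ½ * η →
    (∀ m → N₁ ℕ.≤ m → fromℕ (K ℕ.* suc K ℕ.* 5) ≤ fromℕ m * (½ * η)) → (∀ u → N₂ ℕ.≤ u → fromℕ c₀ ≤ fromℕ u * (½ * η)) →
    ∀ {n m ε b} (ε≤1 : ε ℕ.≤ 1) (n≡ : n ≡ m ℕ.+ (m ℕ.+ ε))
    (classes : Bijection (setoid (Fin b)) (bicoloredGraphs n)) {v} → v * Z {n} {m} {ε} ε≤1 n≡ ≡ fromℕ (b ℕ.* n !) →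
    suc K ℕ.+ N₁ ℕ.+ 48 ℕ.* (N₂ ℕ.+ c₀) ℕ.≤ m → ∀ j → K ℕ.≤ j → ∣ v - theta ε j ∣ ≤ η
  ratio-close η K N₁ N₂ tl ev₁ ev₂ {n} {m} {ε} ε≤1 n≡ classes {v} v≡ N≤m j K≤j = ∣p-q∣≤ v (theta ε j) η
      (add-halves v (theta ε m′) (theta ε j) η upper
        (≤-trans (theta-tail {ε} ε≤1 {K} {m′} K≤m′) (+-mono-≤ (theta-mono {ε} ε≤1 {K} {j} K≤j) (<⇒≤ tl))))
      (add-halves (theta ε j) (theta ε K) v η (≤-trans (theta-tail {ε} ε≤1 {K} {j} K≤j) (+-monoʳ-≤ (theta ε K) (<⇒≤ tl))) lower)
    where
    m′ = m ℕ.+ ε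
    u = proj₁ (div48 m)
    48u≤m : 48 ℕ.* u ℕ.≤ m
    48u≤m = proj₁ (proj₂ (div48 m))
    m< : m ℕ.< 48 ℕ.* suc u
    m< = proj₂ (proj₂ (div48 m))
    sK+N₁≤m : suc K ℕ.+ N₁ ℕ.≤ m
    sK+N₁≤m = ℕ.≤-trans (ℕ.m≤m+n (suc K ℕ.+ N₁) _) N≤m
    K<m : K ℕ.< m
    K<m = ℕ.≤-trans (ℕ.m≤m+n (suc K) N₁) sK+N₁≤m
    N₂+c₀≤u : N₂ ℕ.+ c₀ ℕ.≤ u
    N₂+c₀≤u = ℕ.≤-pred (ℕ.*-cancelˡ-< 48 (N₂ ℕ.+ c₀) (suc u) (ℕ.≤-<-trans (ℕ.≤-trans (ℕ.m≤n+m _ (suc K ℕ.+ N₁)) N≤m) m<))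
    n≤ : n ℕ.≤ suc (2 ℕ.* m)
    n≤ = n≤1+2m ε n m ε≤1 n≡
    K≤m′ : K ℕ.≤ m′
    K≤m′ = ℕ.≤-trans (ℕ.<⇒≤ K<m) (ℕ.m≤m+n m ε)
    lower : theta ε K ≤ v + ½ * η
    lower = cancel-lower m K (theta ε K) v (½ * η) (ℕ.≤-trans (s≤s z≤n) K<m)
      (ratio-lower {n} {m} {ε} ε≤1 n≡ classes {v} v≡ {K} (ℕ.<⇒≤ K<m)) (theta≤5 {ε} ε≤1 K) (ev₁ m (ℕ.≤-trans (ℕ.m≤n+m N₁ (suc K)) sK+N₁≤m))
    upper : v ≤ theta ε m′ + ½ * η
    upper = cancel-upper (2 ℕ.^ (u ℕ.* 4)) (suc u) (2 ℕ.* n ℕ.* n ℕ.* suc n) c₀ v (theta ε m′) (½ * η) (ℕ.m^n>0 2 (u ℕ.* 4)) (s≤s z≤n)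
      (ratio-upper {n} {m} {ε} ε≤1 n≡ classes {v} v≡ (u ℕ.* 4) (Growth.12t≤m {m} {n} {u} n≤ 48u≤m m<)
        (Growth.2n²≤T {m} {n} {u} n≤ 48u≤m m< (ℕ.≤-trans (ℕ.m≤n+m c₀ N₂) N₂+c₀≤u)))
      (Growth.growth {m} {n} {u} n≤ 48u≤m m<) (ev₂ (suc u) (ℕ.m≤n⇒m≤1+n (ℕ.≤-trans (ℕ.m≤m+n N₂ c₀) N₂+c₀≤u)))

  -- N and K are chosen before n and ε, so they serve both parities. The distance is to `theta ε j`
  -- for all late j, which stands in for the distance to the limit.
  ratio-limit : ∀ η → 0ℚ < η → ∃[ N ] ∃[ K ] ∀ {n m ε b} (ε≤1 : ε ℕ.≤ 1) (n≡ : n ≡ m ℕ.+ (m ℕ.+ ε))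
    (classes : Bijection (setoid (Fin b)) (bicoloredGraphs n)) {v} → v * Z {n} {m} {ε} ε≤1 n≡ ≡ fromℕ (b ℕ.* n !) →
    N ℕ.≤ m → ∀ j → K ℕ.≤ j → ∣ v - theta ε j ∣ ≤ η
  ratio-limit η 0<η =
    let 0<h      = 0<½*ε 0<η
        K , tl   = tail<ε (½ * η) 0<h
        N₁ , ev₁ = eventually-≤ (K ℕ.* suc K ℕ.* 5) (½ * η) 0<h
        N₂ , ev₂ = eventually-≤ c₀ (½ * η) 0<h
    in  suc K ℕ.+ N₁ ℕ.+ 48 ℕ.* (N₂ ℕ.+ c₀) , K , ratio-close η K N₁ N₂ tl ev₁ ev₂

-- Rational sequences with the same limiting behavior, powers of roots of 2, and the series over ℤ

module Sequences where
  open import Data.Nat.Base as ℕ using (ℕ; zero; suc; z≤n; s≤s)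
  import Data.Nat.Properties as ℕ
  import Data.Integer.Base as ℤ
  import Data.Integer.Properties as ℤ
  open import Data.Rational.Base
  open import Data.Rational.Properties hiding (_≟_; _≤?_)
  open import Data.Rational.Solver using (module +-*-Solver)
  open import Data.Product.Base using (∃-syntax; _×_; _,_; proj₁; proj₂)
  open import Relation.Binary.PropositionalEquality
  open import Defs hiding (c)
  open Theta

  infix 4 _≍_

  -- For Cauchy sequences this is equality of the reals they represent. The index is that of the
  -- rational approximations, not the number of vertices.
  record _≍_ (s t : ℕ → ℚ) : Set where
    constructor asymptotic
    field
      close : ∀ η → 0ℚ < η → ∃[ J ] ∀ j → J ℕ.≤ j → ∣ s j - t j ∣ < η

  open _≍_ public

  record Bounded (s : ℕ → ℚ) : Set where
    constructor bounded-by
    field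
      bound : ∃[ B ] 0ℚ < B × ∃[ J ] ∀ j → J ℕ.≤ j → ∣ s j ∣ < B

  open Bounded public

  0<1 : 0ℚ < 1ℚ
  0<1 = *<* (ℤ.+<+ (s≤s z≤n))

  ≍-reflexive : ∀ {s t} → (∀ j → s j ≡ t j) → s ≍ t
  ≍-reflexive {s} {t} eq = asymptotic λ η 0<η → 0 , λ j _ → subst (_< η) (cong ∣_∣ (sym (trans (cong (_- t j) (eq j)) (+-inverseʳ (t j))))) 0<η

  ≍-trans : ∀ {s t u} → s ≍ t → t ≍ u → s ≍ u
  ≍-trans {s} {t} {u} p q = asymptotic λ η 0<η →
    let I , f = close p (½ * η) (0<½*ε 0<η)
        J , g = close q (½ * η) (0<½*ε 0<η)
    in I ℕ.⊔ J , λ j h → ∣p-r∣<ε (s j) (t j) (u j) η (f j (ℕ.m⊔n≤o⇒m≤o I J h)) (g j (ℕ.m⊔n≤o⇒n≤o I J h))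

  ≍-+ : ∀ {s s′ t t′} → s ≍ s′ → t ≍ t′ → (λ j → s j + t j) ≍ (λ j → s′ j + t′ j)
  ≍-+ {s} {s′} {t} {t′} p q = asymptotic λ η 0<η →
    let I , f = close p (½ * η) (0<½*ε 0<η)
        J , g = close q (½ * η) (0<½*ε 0<η)
    in I ℕ.⊔ J , λ j h → ≤-<-trans
      (subst (λ z → ∣ z ∣ ≤ ∣ s j - s′ j ∣ + ∣ t j - t′ j ∣)
        (solve 4 (λ a b c d → (a :- b) :+ (c :- d) := (a :+ c) :- (b :+ d)) refl (s j) (s′ j) (t j) (t′ j))
        (∣p+q∣≤∣p∣+∣q∣ (s j - s′ j) (t j - t′ j)))
      (subst (∣ s j - s′ j ∣ + ∣ t j - t′ j ∣ <_) (½+½ η)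
        (+-mono-< (f j (ℕ.m⊔n≤o⇒m≤o I J h)) (g j (ℕ.m⊔n≤o⇒n≤o I J h))))
    where open +-*-Solver

  ≍-* : ∀ {s s′ t t′} → Bounded s → Bounded t′ → s ≍ s′ → t ≍ t′ → (λ j → s j * t j) ≍ (λ j → s′ j * t′ j)
  ≍-* {s} {s′} {t} {t′} (bounded-by (A , 0<A , L , a)) (bounded-by (B , 0<B , M , b)) p q = asymptotic λ η 0<η →
    let d , 0<d , Ad≡ = shrink {½ * η} {A} (0<½*ε 0<η) 0<A
        e , 0<e , Be≡ = shrink {½ * η} {B} (0<½*ε 0<η) 0<B
        I , f = close p e 0<e
        J , g = close q d 0<d
    in (L ℕ.⊔ M) ℕ.⊔ (I ℕ.⊔ J) , λ j h →
      let h₁ = ℕ.m⊔n≤o⇒m≤o (L ℕ.⊔ M) (I ℕ.⊔ J) h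
          h₂ = ℕ.m⊔n≤o⇒n≤o (L ℕ.⊔ M) (I ℕ.⊔ J) h
      in *-close (s j) (s′ j) (t j) (t′ j) A B d e η 0<A 0<B
        (a j (ℕ.m⊔n≤o⇒m≤o L M h₁)) (b j (ℕ.m⊔n≤o⇒n≤o L M h₁))
        (g j (ℕ.m⊔n≤o⇒n≤o I J h₂)) (f j (ℕ.m⊔n≤o⇒m≤o I J h₂)) Ad≡ Be≡

  bounded-≤ : ∀ {s} B → (∀ j → 0ℚ ≤ s j × s j ≤ B) → Bounded s
  bounded-≤ {s} B h = bounded-by (B + 1ℚ , ≤-<-trans (≤-trans (proj₁ (h 0)) (proj₂ (h 0))) B<B+1 , 0
    , λ j _ → ≤-<-trans (subst (_≤ B) (sym (0≤p⇒∣p∣≡p (proj₁ (h j)))) (proj₂ (h j))) B<B+1)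
    where
    B<B+1 : B < B + 1ℚ
    B<B+1 = subst (_< B + 1ℚ) (+-identityʳ B) (+-monoʳ-< B 0<1)

  bounded-≍ : ∀ {s t} → s ≍ t → Bounded t → Bounded s
  bounded-≍ {s} {t} p (bounded-by (B , 0<B , J , b)) =
    let I , f = close p B 0<B in bounded-by (B + B , +-mono-< 0<B 0<B , I ℕ.⊔ J , λ j h → ≤-<-trans
      (subst (λ z → ∣ z ∣ ≤ ∣ s j - t j ∣ + ∣ t j ∣) (solve 2 (λ s t → (s :- t) :+ t := s) refl (s j) (t j))
        (∣p+q∣≤∣p∣+∣q∣ (s j - t j) (t j)))
      (+-mono-< (f j (ℕ.m⊔n≤o⇒m≤o I J h)) (b j (ℕ.m⊔n≤o⇒n≤o I J h))))
    where open +-*-Solver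

  bounded-const : ∀ a → Bounded (λ _ → a)
  bounded-const a = bounded-by (∣ a ∣ + 1ℚ , ≤-<-trans (0≤∣p∣ a) lt , 0 , λ _ _ → lt)
    where
    lt : ∣ a ∣ < ∣ a ∣ + 1ℚ
    lt = subst (_< ∣ a ∣ + 1ℚ) (+-identityʳ ∣ a ∣) (+-monoʳ-< ∣ a ∣ 0<1)

  ≍-pow : ∀ {s a} → s ≍ (λ _ → a) → ∀ n → (λ j → pow (s j) n) ≍ (λ _ → pow a n)
  ≍-pow p zero    = ≍-reflexive λ _ → refl
  ≍-pow {s} {a} p (suc n) = ≍-* (bounded-≍ p (bounded-const a)) (bounded-const (pow a n)) p (≍-pow p n)

  ≍-squeeze : ∀ {s t} M → 0ℚ < M → (∀ j → t j ≤ s j × s j ≤ t j + M * δ j) → s ≍ t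
  ≍-squeeze {s} {t} M 0<M h = asymptotic λ η 0<η →
    let d , 0<d , Md≡η = shrink {η} {M} 0<η 0<M
        N , a = archimedean d 0<d
    in N , λ j k → subst (_< η) (sym (0≤p⇒∣p∣≡p (0≤s-t j)))
      (≤-<-trans (p≤q+r⇒p-q≤r (s j) (t j) (M * δ j) (proj₂ (h j)))
        (subst (M * δ j <_) Md≡η (*-monoʳ-<-pos M {{positive 0<M}} (a j k))))
    where
    0≤s-t : ∀ j → 0ℚ ≤ s j - t j
    0≤s-t j = subst (_≤ s j - t j) (+-inverseʳ (t j)) (+-monoˡ-≤ (- t j) (proj₁ (h j)))

  *-cancelʳ-pos : ∀ {x y} D .{{_ : Positive D}} → x * D ≡ y * D → x ≡ y
  *-cancelʳ-pos D e = ≤-antisym (*-cancelʳ-≤-pos D (≤-reflexive e)) (*-cancelʳ-≤-pos D (≤-reflexive (sym e)))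

  pow-pow : ∀ x k l → pow (pow x k) l ≡ pow x (l ℕ.* k)
  pow-pow x k zero    = refl
  pow-pow x k (suc l) = trans (cong (pow x k *_) (pow-pow x k l)) (sym (pow-+ x k (l ℕ.* k)))

  pow-mono : ∀ {x y} n → 0ℚ ≤ x → x ≤ y → pow x n ≤ pow y n
  pow-mono zero    _   _   = ≤-refl
  pow-mono (suc n) 0≤x x≤y = *-mono (0≤pow n 0≤x) (≤-trans 0≤x x≤y) x≤y (pow-mono n 0≤x x≤y)

  -- A mean value bound for powers on [0 , B]. The factor B^n instead of B^(n-1) is harmless because
  -- 1 ≤ B, and it spares a predecessor in the induction.
  pow-increment : ∀ B y d n → 1ℚ ≤ B → 0ℚ ≤ y → 0ℚ ≤ d → y + d ≤ B → pow (y + d) n ≤ pow y n + fromℕ n * pow B n * d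
  pow-increment B y d zero    _   _   _   _ = p≤p+q 1ℚ _ (≤-reflexive (sym (trans (cong (_* d) (*-zeroˡ 1ℚ)) (*-zeroˡ d))))
  pow-increment B y d (suc n) 1≤B 0≤y 0≤d x≤B = begin
    x * pow x n                                      ≤⟨ *-monoˡ-≤-nonNeg x {{nonNegative 0≤x}} (pow-increment B y d n 1≤B 0≤y 0≤d x≤B) ⟩
    x * (Y + N * P * d)                              ≡⟨ solve 5 (λ y d Y N P → (y :+ d) :* (Y :+ N :* P :* d) := y :* Y :+ (d :* Y :+ (y :+ d) :* (N :* P :* d))) refl y d Y N P ⟩
    y * Y + (d * Y + x * (N * P * d))                ≤⟨ +-monoʳ-≤ (y * Y) (+-mono-≤ (*-monoˡ-≤-nonNeg d {{nonNegative 0≤d}} Y≤BP) (*-monoʳ-≤-nonNeg (N * P * d) {{nonNegative 0≤NPd}} x≤B)) ⟩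
    y * Y + (d * (B * P) + B * (N * P * d))          ≡⟨ solve 6 (λ y Y d B P N → y :* Y :+ (d :* (B :* P) :+ B :* (N :* P :* d)) := y :* Y :+ (con 1ℚ :+ N) :* (B :* P) :* d) refl y Y d B P N ⟩
    y * Y + (1ℚ + N) * (B * P) * d                   ≡⟨ cong (λ z → y * Y + z * (B * P) * d) (fromℕ-homo-+ 1 n) ⟨
    y * Y + fromℕ (suc n) * (B * P) * d              ∎
    where
    open ≤-Reasoning
    open +-*-Solver using (solve; _:=_; _:+_; _:*_; con)
    x = y + d
    Y = pow y n
    P = pow B n
    N = fromℕ n
    0≤x : 0ℚ ≤ x
    0≤x = ≤-trans 0≤y (p≤p+q y d 0≤d)
    0≤B : 0ℚ ≤ B
    0≤B = ≤-trans 0≤1 1≤B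
    0≤NPd : 0ℚ ≤ N * P * d
    0≤NPd = 0≤* (0≤* (0≤fromℕ n) (0≤pow n 0≤B)) 0≤d
    Y≤BP : Y ≤ B * P
    Y≤BP = ≤-trans (pow-mono n 0≤y (≤-trans (p≤p+q y d 0≤d) x≤B))
      (subst (_≤ B * P) (*-identityˡ P) (*-monoʳ-≤-nonNeg P {{nonNegative (0≤pow n 0≤B)}} 1≤B))

  -- From rs = 1 follows s - 1/2 = -(s/2)(r - 2), and s/2 ≤ 1.
  inverse-close : ∀ r s → 0ℚ ≤ s → s ≤ 1ℚ → r * s ≡ 1ℚ → ∣ s - ½ ∣ ≤ ∣ r - fromℕ 2 ∣
  inverse-close r s 0≤s s≤1 rs≡1 = begin
    ∣ s - ½ ∣                          ≡⟨ cong (λ x → ∣ s - ½ * x ∣) rs≡1 ⟨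
    ∣ s - ½ * (r * s) ∣                ≡⟨ cong ∣_∣ (solve 2 (λ r s → s :- con ½ :* (r :* s) := :- (con ½ :* s) :* (r :- con (fromℕ 2))) refl r s) ⟩
    ∣ - (½ * s) * (r - fromℕ 2) ∣      ≡⟨ ∣p*q∣≡∣p∣*∣q∣ (- (½ * s)) (r - fromℕ 2) ⟩
    ∣ - (½ * s) ∣ * ∣ r - fromℕ 2 ∣    ≡⟨ cong (_* ∣ r - fromℕ 2 ∣) (trans (∣-p∣≡∣p∣ (½ * s)) (0≤p⇒∣p∣≡p (0≤* {½} {s} 0≤½ 0≤s))) ⟩
    ½ * s * ∣ r - fromℕ 2 ∣            ≤⟨ *-monoʳ-≤-nonNeg ∣ r - fromℕ 2 ∣ {{nonNegative (0≤∣p∣ (r - fromℕ 2))}}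
                                            (*-mono {½} {1ℚ} {s} {1ℚ} 0≤s 0≤1 (*≤* (ℤ.+≤+ (s≤s z≤n))) s≤1) ⟩
    1ℚ * ∣ r - fromℕ 2 ∣               ≡⟨ *-identityˡ ∣ r - fromℕ 2 ∣ ⟩
    ∣ r - fromℕ 2 ∣                    ∎
    where
    open ≤-Reasoning
    open +-*-Solver using (solve; _:=_; _:-_; _:*_; :-_; con)

  -- Since A is the least admissible numerator, (A - 1)/(j + 1) has its (q+1)-th power below 2.
  -- Adding 1/(j + 1) raises the power by at most the increment on [0 , 2].
  ceiling-upper : ∀ q A j → (∀ b → b ℕ.< A → b ℕ.^ suc q ℕ.< 2 ℕ.* suc j ℕ.^ suc q) → suc j ℕ.≤ A →
    ℤ.+ A / suc j ≤ fromℕ 2 → pow (ℤ.+ A / suc j) (suc q) ≤ fromℕ 2 + fromℕ (suc q) * pow (fromℕ 2) (suc q) * δ j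
  ceiling-upper q (suc a) j least _ ρ≤2 = subst (λ x → pow x (suc q) ≤ fromℕ 2 + fromℕ (suc q) * pow (fromℕ 2) (suc q) * δ j) y+δ≡
    (≤-trans (pow-increment (fromℕ 2) y (δ j) (suc q) (fromℕ-mono-≤ (s≤s z≤n)) 0≤y (<⇒≤ (*<* (ℤ.+<+ (s≤s z≤n))))
      (subst (_≤ fromℕ 2) (sym y+δ≡) ρ≤2)) (+-monoˡ-≤ (fromℕ (suc q) * pow (fromℕ 2) (suc q) * δ j) y^≤2))
    where
    open +-*-Solver using (solve; _:=_; _:+_; _:*_)
    y D : ℚ
    y = ℤ.+ a / suc j
    D = fromℕ (suc j)
    y+δ≡ : y + δ j ≡ ℤ.+ suc a / suc j
    y+δ≡ = *-cancelʳ-pos D (trans (*-distribʳ-+ D y (δ j)) (trans (cong₂ _+_ (a/d*d≡a a j) (δ*suc j))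
      (trans (trans (+-comm (fromℕ a) 1ℚ) (sym (fromℕ-homo-+ 1 a))) (sym (a/d*d≡a (suc a) j)))))
    0≤y : 0ℚ ≤ y
    0≤y = *-cancelʳ-≤-pos D (subst₂ _≤_ (sym (*-zeroˡ D)) (sym (a/d*d≡a a j)) (0≤fromℕ a))
    y^≤2 : pow y (suc q) ≤ fromℕ 2
    y^≤2 = *-cancelʳ-≤-pos (fromℕ (suc j ℕ.^ suc q)) {{positive (0<fromℕ (ℕ.m^n>0 (suc j) (suc q)))}} (subst₂ _≤_
      (trans (sym (pow-fromℕ a (suc q))) (trans (cong (λ z → pow z (suc q)) (sym (a/d*d≡a a j)))
        (trans (pow-* y D (suc q)) (cong (pow y (suc q) *_) (pow-fromℕ (suc j) (suc q))))))
      (fromℕ-homo-* 2 (suc j ℕ.^ suc q))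
      (fromℕ-mono-≤ (ℕ.<⇒≤ (least a ℕ.≤-refl))))

  module Root (q : ℕ) where

    ρ σ : ℕ → ℚ
    ρ = rootSeq q
    σ j = recip (ρ j)

    private
      ceil≤2d : ∀ j → ⌈ suc j ·2^1/1+ q ⌉ ℕ.≤ 2 ℕ.* suc j
      ceil≤2d j = ℕ.≮⇒≥ λ lt → ℕ.<⇒≱ (⌈·2^1/⌉-least (suc j) q (2 ℕ.* suc j) lt)
        (subst (2 ℕ.* suc j ℕ.^ suc q ℕ.≤_) (sym (^-*-distribˡ 2 (suc j) (suc q)))
          (ℕ.*-monoˡ-≤ (suc j ℕ.^ suc q) (ℕ.m≤m*n 2 (2 ℕ.^ q) {{ℕ.m^n≢0 2 q}})))

    ρ≤2 : ∀ j → ρ j ≤ fromℕ 2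
    ρ≤2 j = *-cancelʳ-≤-pos (fromℕ (suc j)) (subst₂ _≤_ (sym (a/d*d≡a _ j)) (fromℕ-homo-* 2 (suc j)) (fromℕ-mono-≤ (ceil≤2d j)))

    0≤ρ : ∀ j → 0ℚ ≤ ρ j
    0≤ρ j = ≤-trans 0≤1 (1≤rootSeq q j)

    ρ^-upper : ∀ j → pow (ρ j) (suc q) ≤ fromℕ 2 + fromℕ (suc q) * pow (fromℕ 2) (suc q) * δ j
    ρ^-upper j = ceiling-upper q ⌈ suc j ·2^1/1+ q ⌉ j (⌈·2^1/⌉-least (suc j) q) (d≤ceil (suc j) q) (ρ≤2 j)

    ρ^≍2 : (λ j → pow (ρ j) (suc q)) ≍ (λ _ → fromℕ 2)
    ρ^≍2 = ≍-squeeze (fromℕ (suc q) * pow (fromℕ 2) (suc q)) 0<M λ j → 2≤rootSeq^ q j , ρ^-upper j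
      where
      0<M : 0ℚ < fromℕ (suc q) * pow (fromℕ 2) (suc q)
      0<M = subst (0ℚ <_) (trans (fromℕ-homo-* (suc q) (2 ℕ.^ suc q)) (cong (fromℕ (suc q) *_) (sym (pow-fromℕ 2 (suc q)))))
        (0<fromℕ (ℕ.*-mono-≤ (s≤s (z≤n {q})) (ℕ.m^n>0 2 (suc q))))

    ρ^*σ^ : ∀ j n → pow (ρ j) n * pow (σ j) n ≡ 1ℚ
    ρ^*σ^ j n = trans (sym (pow-* (ρ j) (σ j) n)) (trans (cong (λ x → pow x n) (ρσ≡1 q j)) (pow-1 n))

    σ^≍½ : (λ j → pow (σ j) (suc q)) ≍ (λ _ → ½)
    σ^≍½ = asymptotic λ η 0<η → let J , f = close ρ^≍2 η 0<η in J , λ j h → ≤-<-trans (closer j) (f j h)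
      where
      closer : ∀ j → ∣ pow (σ j) (suc q) - ½ ∣ ≤ ∣ pow (ρ j) (suc q) - fromℕ 2 ∣
      closer j = inverse-close (pow (ρ j) (suc q)) (pow (σ j) (suc q)) (0≤pow (suc q) (0≤σ q j))
        (pow≤1 (suc q) (0≤σ q j) (σ≤1 q j)) (ρ^*σ^ j (suc q))

    -- The exponent -(l + r/(q+1)) becomes the integer -l after multiplication by the root to the
    -- power r. A common factor ρ^r thus makes all terms of a series rational in the limit.
    σ^*ρ^≍ : ∀ l r → (λ j → pow (σ j) (l ℕ.* suc q ℕ.+ r) * pow (ρ j) r) ≍ (λ _ → pow ½ l)
    σ^*ρ^≍ l r = ≍-trans (≍-reflexive λ j → eq j) (≍-pow σ^≍½ l)
      where
      open +-*-Solver
      eq : ∀ j → pow (σ j) (l ℕ.* suc q ℕ.+ r) * pow (ρ j) r ≡ pow (pow (σ j) (suc q)) l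
      eq j = trans (cong (_* pow (ρ j) r) (pow-+ (σ j) (l ℕ.* suc q) r))
        (trans (solve 3 (λ a b c → a :* b :* c := a :* (c :* b)) refl (pow (σ j) (l ℕ.* suc q)) (pow (σ j) r) (pow (ρ j) r))
        (trans (cong (pow (σ j) (l ℕ.* suc q) *_) (ρ^*σ^ j r)) (trans (*-identityʳ _) (sym (pow-pow (σ j) (suc q) l)))))

    bounded-ρ^ : ∀ r → Bounded (λ j → pow (ρ j) r)
    bounded-ρ^ r = bounded-≤ (pow (fromℕ 2) r) λ j → 0≤pow r (0≤ρ j) , pow-mono r (0≤ρ j) (ρ≤2 j)

    module _ {ε r} (ε≤1 : ε ℕ.≤ 1) (a : ℤ.ℤ → ℝ) (summable : Summable a)
             (a₀ : (λ j → seq (a (ℤ.+ 0)) j * pow (ρ j) r) ≍ (λ _ → 1ℚ))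
             (a₊ : ∀ K → (λ j → seq (a (ℤ.+ suc K)) j * pow (ρ j) r) ≍ (λ _ → pow ½ (left ε K)))
             (a₋ : ∀ K → (λ j → seq (a ℤ.-[1+ K ]) j * pow (ρ j) r) ≍ (λ _ → pow ½ (right ε K))) where

      partialSum≍theta : ∀ K → (λ j → seq (partialSum a K) j * pow (ρ j) r) ≍ (λ _ → theta ε K)
      partialSum≍theta zero    = a₀
      partialSum≍theta (suc K) = ≍-trans
        (≍-reflexive λ j → solve 4 (λ s x y t → (s :+ (x :+ y)) :* t := s :* t :+ (x :* t :+ y :* t)) refl
          (seq (partialSum a K) j) (seq (a (ℤ.+ suc K)) j) (seq (a ℤ.-[1+ K ]) j) (pow (ρ j) r))
        (≍-+ (partialSum≍theta K) (≍-+ (a₊ K) (a₋ K)))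
        where open +-*-Solver

      -- The sum is compared with `theta ε j` through a fixed K. Half of η covers the theta terms
      -- between K and j; a quarter each covers the distance of the series to its K-th partial sum,
      -- scaled by the bounded ρ^r, and that of this partial sum to `theta ε K`.
      ∑ℤ≍theta : (λ j → seq (∑ℤ a summable) j * pow (ρ j) r) ≍ theta ε
      ∑ℤ≍theta = asymptotic λ η 0<η →
        let h                 = ½ * (½ * η)
            0<h               = 0<½*ε (0<½*ε 0<η)
            B , 0<B , J₀ , b  = bound (bounded-ρ^ r)
            d , 0<d , Bd≡h    = shrink {h} {B} 0<h 0<B
            N , f             = ⟶-lim (partialSum a) summable d 0<d
            N′ , tl           = tail<ε (½ * η) (0<½*ε 0<η)
            K                 = N ℕ.⊔ N′
            J₁ , g            = <ᴿ⇒< {∣ partialSum a K -ᴿ ∑ℤ a summable ∣ᴿ} {d} (f K (ℕ.m≤m⊔n N N′))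
            J₂ , k            = close (partialSum≍theta K) h 0<h
        in K ℕ.⊔ (J₀ ℕ.⊔ (J₁ ℕ.⊔ J₂)) , λ j l →
        let l₀ = ℕ.m⊔n≤o⇒n≤o K (J₀ ℕ.⊔ (J₁ ℕ.⊔ J₂)) l
            l₁ = ℕ.m⊔n≤o⇒n≤o J₀ (J₁ ℕ.⊔ J₂) l₀
        in ∣p-r∣<ε (seq (∑ℤ a summable) j * pow (ρ j) r) (theta ε K) (theta ε j) η
            (∣p-r∣<ε (seq (∑ℤ a summable) j * pow (ρ j) r) (seq (partialSum a K) j * pow (ρ j) r) (theta ε K) (½ * η)
              (scale (seq (partialSum a K) j) (seq (∑ℤ a summable) j) (pow (ρ j) r) B d h 0<B Bd≡h
                (b j (ℕ.m⊔n≤o⇒m≤o J₀ (J₁ ℕ.⊔ J₂) l₀)) (g j (ℕ.m⊔n≤o⇒m≤o J₁ J₂ l₁)))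
              (k j (ℕ.m⊔n≤o⇒n≤o J₁ J₂ l₁)))
            (≤-<-trans (theta-close K j (ℕ.m⊔n≤o⇒m≤o K (J₀ ℕ.⊔ (J₁ ℕ.⊔ J₂)) l)) (≤-<-trans (tail-antitone N′ K (ℕ.m≤n⊔m N N′)) tl))
        where
        scale : ∀ p s t B d h → 0ℚ < B → B * d ≡ h → ∣ t ∣ < B → ∣ p - s ∣ < d → ∣ s * t - p * t ∣ < h
        scale p s t B d h 0<B Bd≡h t<B ps<d = subst₂ _<_
          (trans (sym (∣p*q∣≡∣p∣*∣q∣ t (p - s))) (trans (sym (∣-p∣≡∣p∣ (t * (p - s))))
            (cong ∣_∣ (solve 3 (λ p s t → :- (t :* (p :- s)) := s :* t :- p :* t) refl p s t))))
          Bd≡h (*-mono-≤-< {∣ t ∣} {B} (0≤∣p∣ (p - s)) t<B 0<B ps<d)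
          where open +-*-Solver
        tail-antitone : ∀ K L → K ℕ.≤ L → tail L ≤ tail K
        tail-antitone K L K≤L = *-monoˡ-≤-nonNeg (fromℕ 4) (pow-½-antitone K≤L)
        theta-close : ∀ K j → K ℕ.≤ j → ∣ theta ε K - theta ε j ∣ ≤ tail K
        theta-close K j K≤j = RatioLimit.∣p-q∣≤ (theta ε K) (theta ε j) (tail K)
          (≤-trans (theta-mono {ε} ε≤1 {K} {j} K≤j) (p≤p+q (theta ε j) (tail K) (0≤tail K)))
          (theta-tail {ε} ε≤1 {K} {j} K≤j)

-- The constants c(n) and 2^(n²/4) for even and for odd n

module Parity where
  open import Data.Bool.Base using (true; false; if_then_else_)
  open import Data.Nat.Base as ℕ using (ℕ; zero; suc; z≤n; s≤s; ⌊_/2⌋; ⌈_/2⌉)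
  import Data.Nat.Properties as ℕ
  import Data.Nat.Solver as ℕSolver
  open import Data.Nat.Coprimality using (Coprime; coprime-+; 1-coprimeTo) renaming (sym to coprime-sym)
  open import Data.Nat.Divisibility using (_∣_; _∣?_; divides)
  open import Data.Integer.Base as ℤ using (+_; -[1+_])
  open import Data.Rational.Base
  open import Data.Rational.Properties hiding (_≟_; _≤?_)
  open import Data.Rational.Solver using (module +-*-Solver)
  open import Data.Product.Base using (∃-syntax; _,_)
  open import Data.Sum.Base using (_⊎_; inj₁; inj₂)
  open import Relation.Nullary.Decidable using (does; dec-true; dec-false)
  open import Relation.Nullary.Negation using (¬_)
  open import Relation.Binary.PropositionalEquality
  open import Defs
  open Theta
  open Sequences

  module _ (q : ℕ) where
    open Root q

    term-limit : ∀ r l N (s : ℕ → ℚ) → (∀ j → s j ≡ pow (σ j) N) → N ≡ l ℕ.* suc q ℕ.+ r →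
                 (λ j → s j * pow (ρ j) r) ≍ (λ _ → pow ½ l)
    term-limit r l N s eq refl = ≍-trans (≍-reflexive λ j → cong (_* pow (ρ j) r) (eq j)) (σ^*ρ^≍ l r)

  seq-2^-cong : ∀ {x y} → x ≡ y → ∀ j → seq (2^ x) j ≡ seq (2^ y) j
  seq-2^-cong refl j = refl

  seq-2^-neg : ∀ N q .(cp : Coprime (suc N) (suc q)) j → seq (2^ mkℚ -[1+ N ] q cp) j ≡ pow (recip (rootSeq q j)) (suc N)
  seq-2^-neg N q cp j = seq-^ᴿ (inverse (root2 q) (root2≉0 q)) (suc N) j

  -- `2^_` reads the numerator and denominator of a reduced fraction, so the quarters in the odd
  -- case have to be exhibited in lowest terms.
  coprime-4 : ∀ l → Coprime (suc (l ℕ.* 4)) 4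
  coprime-4 zero    = 1-coprimeTo 4
  coprime-4 (suc l) = coprime-+ (coprime-4 l)

  quarters : ∀ l → + suc (l ℕ.* 4) / 4 ≡ mkℚ (+ suc (l ℕ.* 4)) 3 (coprime-4 l)
  quarters l = normalize-coprime (coprime-4 l)

  -- (a + 1/2)² = a(a + 1) + 1/4.
  half-square : ∀ a → - ((fromℕ a + ½) * (fromℕ a + ½)) ≡ - mkℚ (+ suc (suc a ℕ.* a ℕ.* 4)) 3 (coprime-4 (suc a ℕ.* a))
  half-square a = cong -_ square
    where
    open ≡-Reasoning
    open +-*-Solver using (solve; _:=_; _:+_; _:*_; con)
    l = suc a ℕ.* a
    square : (fromℕ a + ½) * (fromℕ a + ½) ≡ mkℚ (+ suc (l ℕ.* 4)) 3 (coprime-4 l)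
    square = *-cancelʳ-pos (fromℕ 4) (begin
      (fromℕ a + ½) * (fromℕ a + ½) * fromℕ 4          ≡⟨ solve 1 (λ x → (x :+ con ½) :* (x :+ con ½) :* con (fromℕ 4)
                                                            := con 1ℚ :+ (con 1ℚ :+ x) :* x :* con (fromℕ 4)) refl (fromℕ a) ⟩
      1ℚ + (1ℚ + fromℕ a) * fromℕ a * fromℕ 4          ≡⟨ cong (λ z → 1ℚ + z * fromℕ a * fromℕ 4) (fromℕ-homo-+ 1 a) ⟨
      1ℚ + fromℕ (suc a) * fromℕ a * fromℕ 4           ≡⟨ cong (λ z → 1ℚ + z * fromℕ 4) (fromℕ-homo-* (suc a) a) ⟨
      1ℚ + fromℕ l * fromℕ 4                           ≡⟨ cong (λ z → 1ℚ + z) (fromℕ-homo-* l 4) ⟨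
      1ℚ + fromℕ (l ℕ.* 4)                             ≡⟨ fromℕ-homo-+ 1 (l ℕ.* 4) ⟨
      fromℕ (suc (l ℕ.* 4))                            ≡⟨ a/d*d≡a (suc (l ℕ.* 4)) 3 ⟨
      (+ suc (l ℕ.* 4) / 4) * fromℕ 4                  ≡⟨ cong (_* fromℕ 4) (quarters l) ⟩
      mkℚ (+ suc (l ℕ.* 4)) 3 (coprime-4 l) * fromℕ 4  ∎)

  even-sum : (λ j → seq (∑ℤ (λ k → 2^ (- ((k / 1) * (k / 1)))) evenSummable) j * pow (rootSeq 0 j) 0) ≍ theta 0
  even-sum = Root.∑ℤ≍theta 0 {0} {0} z≤n (λ k → 2^ (- ((k / 1) * (k / 1)))) evenSummable (≍-reflexive λ _ → refl)
    (λ K → term-limit 0 0 (left 0 K) (suc K ℕ.* suc K) (seq (2^ (- ((+ suc K / 1) * (+ suc K / 1)))))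
      (even-term K (+ suc K) (square (+ suc K / 1) K (fromℤ≡/1 (+ suc K))))
      (ℕSolver.+-*-Solver.solve 1 (λ k → (con 1 :+ k) :* (con 1 :+ k) := (con 1 :+ k) :* (con 1 :+ k :+ con 0) :* con 1 :+ con 0) refl K))
    (λ K → term-limit 0 0 (right 0 K) (suc K ℕ.* suc K) (seq (2^ (- ((-[1+ K ] / 1) * (-[1+ K ] / 1)))))
      (even-term K -[1+ K ] (trans (sym (neg-square (-[1+ K ] / 1))) (square (- (-[1+ K ] / 1)) K (cong -_ (fromℤ≡/1 -[1+ K ])))))
      (ℕSolver.+-*-Solver.solve 1 (λ k → (con 1 :+ k) :* (con 1 :+ k) := (con 1 :+ k) :* (con 1 :+ k) :* con 1 :+ con 0) refl K))
    where
    open ℕSolver.+-*-Solver using (_:=_; _:+_; _:*_; con)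
    square : ∀ x K → x ≡ fromℕ (suc K) → - (x * x) ≡ - fromℕ (suc K ℕ.* suc K)
    square x K refl = sym (cong -_ (fromℕ-homo-* (suc K) (suc K)))
    even-term : ∀ K k → - ((k / 1) * (k / 1)) ≡ - fromℕ (suc K ℕ.* suc K) →
                ∀ j → seq (2^ (- ((k / 1) * (k / 1)))) j ≡ pow (recip (rootSeq 0 j)) (suc K ℕ.* suc K)
    even-term K k eq j = trans (seq-2^-cong eq j)
      (seq-2^-neg (K ℕ.+ K ℕ.* suc K) 0 (coprime-sym (1-coprimeTo (suc K ℕ.* suc K))) j)

  odd-term : ∀ k a l → l ≡ suc a ℕ.* a → - ((k / 1 + ½) * (k / 1 + ½)) ≡ - ((fromℕ a + ½) * (fromℕ a + ½)) →
             (λ j → seq (2^ (- ((k / 1 + ½) * (k / 1 + ½)))) j * pow (rootSeq 3 j) 1) ≍ (λ _ → pow ½ l)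
  odd-term k a l refl eq = term-limit 3 1 l (suc (l ℕ.* 4)) (seq (2^ (- ((k / 1 + ½) * (k / 1 + ½)))))
    (λ j → trans (seq-2^-cong (trans eq (half-square a)) j) (seq-2^-neg (l ℕ.* 4) 3 (coprime-4 l) j))
    (ℕ.+-comm 1 (l ℕ.* 4))

  odd-sum : (λ j → seq (∑ℤ (λ k → 2^ (- ((k / 1 + ½) * (k / 1 + ½)))) oddSummable) j * pow (rootSeq 3 j) 1) ≍ theta 1
  odd-sum = Root.∑ℤ≍theta 3 {1} {1} (s≤s z≤n) (λ k → 2^ (- ((k / 1 + ½) * (k / 1 + ½)))) oddSummable
    (odd-term (+ 0) 0 0 refl refl)
    (λ K → odd-term (+ suc K) (suc K) (left 1 K) (trans (ℕ.*-comm (suc K) _) (cong (ℕ._* suc K) (ℕ.+-comm (suc K) 1)))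
      (cong (λ x → - ((x + ½) * (x + ½))) (fromℤ≡/1 (+ suc K))))
    -- Since -(K + 1) + 1/2 = -(K + 1/2), the term at -(K + 1) equals the one at K.
    (λ K → odd-term -[1+ K ] K (right 1 K) refl
      (trans (cong (λ x → - ((x + ½) * (x + ½))) (trans (fromℤ≡/1 -[1+ K ]) (cong -_ (fromℕ-homo-+ 1 K))))
        (solve 1 (λ x → :- ((:- (con 1ℚ :+ x) :+ con ½) :* (:- (con 1ℚ :+ x) :+ con ½)) := :- ((x :+ con ½) :* (x :+ con ½))) refl (fromℕ K))))
    where open +-*-Solver

  -- All that is later needed of the parity of n, with x for c(n) and y for 2^(n²/4). The exponent
  -- n²/4 is m(m + ε) + r/(q+1), where q = r = 0 for even n and q = 3, r = 1 for odd n; multiplying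
  -- c(n) by the same root to the power r gives the theta series.
  record Halves (n : ℕ) (x y : ℝ) : Set where
    field
      m ε q r   : ℕ
      ε≤1       : ε ℕ.≤ 1
      ⌊⌋≡m     : ⌊ n /2⌋ ≡ m
      ⌈⌉≡m+ε : ⌈ n /2⌉ ≡ m ℕ.+ ε
      total     : n ≡ m ℕ.+ (m ℕ.+ ε)
      sum-limit : (λ j → seq x j * pow (rootSeq q j) r) ≍ theta ε
      power     : ∀ j → seq y j ≡ pow (rootSeq q j) (m ℕ.* (m ℕ.+ ε) ℕ.* suc q ℕ.+ r)

  half? : ∀ n → (∃[ k ] n ≡ k ℕ.+ k) ⊎ (∃[ k ] n ≡ suc (k ℕ.+ k))
  half? zero    = inj₁ (0 , refl)
  half? (suc n) with half? n
  ... | inj₁ (k , eq) = inj₂ (k , cong suc eq)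
  ... | inj₂ (k , eq) = inj₁ (suc k , cong suc (trans eq (sym (ℕ.+-suc k k))))

  private
    2∣k+k : ∀ k → 2 ∣ k ℕ.+ k
    2∣k+k k = divides k (solve 1 (λ k → k :+ k := k :* con 2) refl k)
      where open ℕSolver.+-*-Solver

    if-true : ∀ {b} {x y : ℝ} → b ≡ true → (if b then x else y) ≡ x
    if-true refl = refl

    if-false : ∀ {b} {x y : ℝ} → b ≡ false → (if b then x else y) ≡ y
    if-false refl = refl

    c-even : ∀ n → 2 ∣ n → c n ≡ ∑ℤ (λ k → 2^ (- ((k / 1) * (k / 1)))) evenSummable
    c-even n p = if-true {does (2 ∣? n)} {∑ℤ (λ k → 2^ (- ((k / 1) * (k / 1)))) evenSummable} {∑ℤ (λ k → 2^ (- ((k / 1 + ½) * (k / 1 + ½)))) oddSummable} (dec-true (2 ∣? n) p)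

    c-odd : ∀ n → ¬ 2 ∣ n → c n ≡ ∑ℤ (λ k → 2^ (- ((k / 1 + ½) * (k / 1 + ½)))) oddSummable
    c-odd n ¬p = if-false {does (2 ∣? n)} {∑ℤ (λ k → 2^ (- ((k / 1) * (k / 1)))) evenSummable} {∑ℤ (λ k → 2^ (- ((k / 1 + ½) * (k / 1 + ½)))) oddSummable} (dec-false (2 ∣? n) ¬p)

    sum-even : ∀ n → 2 ∣ n → (λ j → seq (c n) j * pow (rootSeq 0 j) 0) ≍ theta 0
    sum-even n p = subst (λ x → (λ j → seq x j * pow (rootSeq 0 j) 0) ≍ theta 0) (sym (c-even n p)) even-sum

    sum-odd : ∀ n → ¬ 2 ∣ n → (λ j → seq (c n) j * pow (rootSeq 3 j) 1) ≍ theta 1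
    sum-odd n p = subst (λ x → (λ j → seq x j * pow (rootSeq 3 j) 1) ≍ theta 1) (sym (c-odd n p)) odd-sum

    power-even : ∀ N M → N ≡ M ℕ.* 4 → ∀ j → seq (2^ (+ N / 4)) j ≡ pow (rootSeq 0 j) M
    power-even N M refl j = trans (seq-2^-cong exponent j) (seq-^ᴿ (root2 0) M j)
      where
      exponent : + (M ℕ.* 4) / 4 ≡ fromℕ M
      exponent = *-cancelʳ-pos (fromℕ 4) (trans (a/d*d≡a (M ℕ.* 4) 3) (fromℕ-homo-* M 4))

    power-odd : ∀ N M → N ≡ suc (M ℕ.* 4) → ∀ j → seq (2^ (+ N / 4)) j ≡ pow (rootSeq 3 j) (suc (M ℕ.* 4))
    power-odd N M refl j = trans (seq-2^-cong (quarters M) j) (seq-^ᴿ (root2 3) (suc (M ℕ.* 4)) j)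

  halves-even : ∀ k {x y} → (λ j → seq x j * pow (rootSeq 0 j) 0) ≍ theta 0 →
    (∀ M → (k ℕ.+ k) ℕ.^ 2 ≡ M ℕ.* 4 → ∀ j → seq y j ≡ pow (rootSeq 0 j) M) → Halves (k ℕ.+ k) x y
  halves-even k sum power = record
    { m = k ; ε = 0 ; q = 0 ; r = 0 ; ε≤1 = z≤n
    ; ⌊⌋≡m      = sym (ℕ.n≡⌊n+n/2⌋ k)
    ; ⌈⌉≡m+ε    = trans (sym (ℕ.n≡⌈n+n/2⌉ k)) (sym (ℕ.+-identityʳ k))
    ; total     = cong (k ℕ.+_) (sym (ℕ.+-identityʳ k))
    ; sum-limit = sum
    ; power     = power (k ℕ.* (k ℕ.+ 0) ℕ.* 1 ℕ.+ 0) (solve 1 (λ k → (k :+ k) :^ 2 := (k :* (k :+ con 0) :* con 1 :+ con 0) :* con 4) refl k)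
    }
    where open ℕSolver.+-*-Solver

  halves-odd : ∀ k {x y} → (λ j → seq x j * pow (rootSeq 3 j) 1) ≍ theta 1 →
    (∀ M → suc (k ℕ.+ k) ℕ.^ 2 ≡ suc (M ℕ.* 4) → ∀ j → seq y j ≡ pow (rootSeq 3 j) (suc (M ℕ.* 4))) → Halves (suc (k ℕ.+ k)) x y
  halves-odd k sum power = record
    { m = k ; ε = 1 ; q = 3 ; r = 1 ; ε≤1 = s≤s z≤n
    ; ⌊⌋≡m      = sym (ℕ.n≡⌈n+n/2⌉ k)
    ; ⌈⌉≡m+ε    = trans (cong suc (sym (ℕ.n≡⌊n+n/2⌋ k))) (ℕ.+-comm 1 k)
    ; total     = trans (sym (ℕ.+-suc k k)) (cong (k ℕ.+_) (ℕ.+-comm 1 k))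
    ; sum-limit = sum
    ; power     = λ j → trans (power (k ℕ.* (k ℕ.+ 1)) (solve 1 (λ k → (con 1 :+ (k :+ k)) :^ 2 := con 1 :+ k :* (k :+ con 1) :* con 4) refl k) j)
        (cong (pow (rootSeq 3 j)) (ℕ.+-comm 1 (k ℕ.* (k ℕ.+ 1) ℕ.* 4)))
    }
    where open ℕSolver.+-*-Solver

  halves : ∀ n → Halves n (c n) (2^ (+ (n ℕ.^ 2) / 4))
  halves n = by-half n (half? n)
    where
    odd : ∀ k → ¬ 2 ∣ suc (k ℕ.+ k)
    odd k (divides l eq) = ℕ.even≢odd l k (trans (ℕ.*-comm 2 l) (trans (sym eq) (cong (λ x → suc (k ℕ.+ x)) (sym (ℕ.+-identityʳ k)))))
    by-half : ∀ n → (∃[ k ] n ≡ k ℕ.+ k) ⊎ (∃[ k ] n ≡ suc (k ℕ.+ k)) → Halves n (c n) (2^ (+ (n ℕ.^ 2) / 4))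
    by-half _ (inj₁ (k , refl)) = halves-even k {c (k ℕ.+ k)} {2^ (+ ((k ℕ.+ k) ℕ.^ 2) / 4)}
      (sum-even (k ℕ.+ k) (2∣k+k k)) (power-even ((k ℕ.+ k) ℕ.^ 2))
    by-half _ (inj₂ (k , refl)) = halves-odd k {c (suc (k ℕ.+ k))} {2^ (+ (suc (k ℕ.+ k) ℕ.^ 2) / 4)}
      (sum-odd (suc (k ℕ.+ k)) (odd k)) (power-odd (suc (k ℕ.+ k) ℕ.^ 2))

-- The quotient of the count by the estimate

module Quotient where
  open import Data.Nat.Base as ℕ using (ℕ; suc; z≤n; s≤s; ⌊_/2⌋; ⌈_/2⌉; _!)
  import Data.Nat.Properties as ℕ
  open import Data.Nat.Properties using (_!*_!≢0)
  open import Data.Nat.Combinatorics renaming (_C_ to C) using ()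
  import Data.Integer.Base as ℤ
  open import Data.Rational.Base
  open import Data.Rational.Properties hiding (_≟_; _≤?_)
  open import Data.Rational.Solver using (module +-*-Solver)
  open import Data.Fin.Base using (Fin)
  open import Data.Product.Base using (∃-syntax; _,_; proj₁; proj₂)
  open import Function.Bundles using (Bijection)
  open import Relation.Binary.PropositionalEquality
  open import Defs hiding (b̃)
  open Theta
  open RatioLimit using (ratio-limit)
  open Sequences
  open Parity
  open Estimates using (C-!)

  1/D*D : ∀ D .{{_ : ℕ.NonZero D}} → (ℤ.+ 1 / D) * fromℕ D ≡ 1ℚ
  1/D*D (suc d) = a/d*d≡a 1 d

  0<1/D : ∀ D .{{_ : ℕ.NonZero D}} → 0ℚ < ℤ.+ 1 / D
  0<1/D (suc d) = *-cancelʳ-<-nonNeg (fromℕ (suc d)) (subst₂ _<_ (sym (*-zeroˡ (fromℕ (suc d)))) (sym (a/d*d≡a 1 d)) 0<1)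

  2^*½^ : ∀ M → pow (fromℕ 2) M * pow ½ M ≡ 1ℚ
  2^*½^ M = trans (sym (pow-* (fromℕ 2) ½ M)) (pow-1 M)

  0<* : ∀ {p q} → 0ℚ < p → 0ℚ < q → 0ℚ < p * q
  0<* {p} {q} 0<p 0<q = subst (_< p * q) (*-zeroʳ p) (*-monoʳ-<-pos p {{positive 0<p}} 0<q)

  bounded-theta : ∀ {ε} → ε ℕ.≤ 1 → Bounded (theta ε)
  bounded-theta {ε} ε≤1 = bounded-≤ (fromℕ 5) λ j → ≤-trans 0≤1 (1≤theta {ε} ε≤1 j) , theta≤5 {ε} ε≤1 j

  -- The difference X/Y - 1 is (v - u)/u, and u ≥ 1/2 costs a factor 2. The bound on u also keeps Y
  -- away from 0, where `recip` has its default value.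
  quotient-close : ∀ {X Y β v u η} → 0ℚ < β → X ≡ β * v → Y ≡ β * u → ½ ≤ u → ∣ v - u ∣ ≤ ½ * η → ∣ X * recip Y - 1ℚ ∣ ≤ η
  quotient-close {β = β} {v} {u} {η} 0<β refl refl ½≤u v-u = *-cancelʳ-≤-pos (β * ½) (begin
    ∣ t ∣ * (β * ½)            ≤⟨ *-monoˡ-≤-nonNeg ∣ t ∣ {{nonNegative (0≤∣p∣ t)}} β½≤ ⟩
    ∣ t ∣ * ∣ y ∣              ≡⟨ ∣p*q∣≡∣p∣*∣q∣ t y ⟨
    ∣ t * y ∣                  ≡⟨ cong ∣_∣ t*y≡ ⟩
    ∣ β * (v - u) ∣            ≡⟨ ∣p*q∣≡∣p∣*∣q∣ β (v - u) ⟩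
    ∣ β ∣ * ∣ v - u ∣          ≡⟨ cong (_* ∣ v - u ∣) (0≤p⇒∣p∣≡p (<⇒≤ 0<β)) ⟩
    β * ∣ v - u ∣              ≤⟨ *-monoˡ-≤-nonNeg β {{nonNegative (<⇒≤ 0<β)}} v-u ⟩
    β * (½ * η)                ≡⟨ solve 3 (λ b h e → b :* (h :* e) := e :* (b :* h)) refl β ½ η ⟩
    η * (β * ½)                ∎)
    where
    open ≤-Reasoning
    open +-*-Solver using (solve; _:=_; _:-_; _:*_; con)
    y = β * u
    t = β * v * recip y - 1ℚ
    0<β½ : 0ℚ < β * ½
    0<β½ = 0<* {β} {½} 0<β (*<* (ℤ.+<+ (s≤s z≤n)))
    instance _ = positive 0<β½
    β½≤y : β * ½ ≤ y
    β½≤y = *-monoˡ-≤-nonNeg β {{nonNegative (<⇒≤ 0<β)}} ½≤u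
    β½≤ : β * ½ ≤ ∣ y ∣
    β½≤ = ≤-trans β½≤y (p≤∣p∣ y)
    t*y≡ : t * y ≡ β * (v - u)
    t*y≡ = trans (solve 4 (λ a r y o → (a :* r :- o) :* y := a :* (y :* r) :- o :* y) refl (β * v) (recip y) y 1ℚ)
      (trans (cong (λ z → β * v * z - 1ℚ * y) (recip-inverse y 0<β½ β½≤))
        (solve 3 (λ b v u → b :* v :* con 1ℚ :- con 1ℚ :* (b :* u) := b :* (v :- u)) refl β v u))

  module _ {n : ℕ} {x y : ℝ} (H : Halves n x y) where

    open Halves H

    M : ℕ
    M = m ℕ.* (m ℕ.+ ε)

    -- Approximations of c(n) 2^(n²/4) / 2^M: what remains of the estimate when its integral power
    -- of 2 and the factorials are removed.
    profile-seq : ℕ → ℚ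
    profile-seq j = seq x j * seq y j * pow ½ M

    profile-seq≍theta : profile-seq ≍ theta ε
    profile-seq≍theta = ≍-trans (≍-reflexive rearrange) (≍-trans
      (≍-* (bounded-≍ sum-limit (bounded-theta ε≤1)) (bounded-const 1ℚ) sum-limit powers)
      (≍-reflexive λ j → *-identityʳ (theta ε j)))
      where
      open Root q
      powers : (λ j → pow (pow (ρ j) (suc q)) M * pow ½ M) ≍ (λ _ → 1ℚ)
      powers = ≍-trans (≍-* (bounded-≍ (≍-pow ρ^≍2 M) (bounded-const (pow (fromℕ 2) M))) (bounded-const (pow ½ M)) (≍-pow ρ^≍2 M) (≍-reflexive λ _ → refl))
        (≍-reflexive λ _ → 2^*½^ M)
      rearrange : ∀ j → seq x j * seq y j * pow ½ M ≡ seq x j * pow (ρ j) r * (pow (pow (ρ j) (suc q)) M * pow ½ M)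
      rearrange j = trans (cong (λ z → seq x j * z * pow ½ M) (trans (power j) (trans (pow-+ (ρ j) (M ℕ.* suc q) r)
          (cong (_* pow (ρ j) r) (sym (pow-pow (ρ j) (suc q) M))))))
        (solve 4 (λ s a b h → s :* (a :* b) :* h := s :* b :* (a :* h)) refl (seq x j) (pow (pow (ρ j) (suc q)) M) (pow (ρ j) r) (pow ½ M))
        where open +-*-Solver

    -- The theta sums are at least 1. This one bound yields both apartness of the estimate from 0
    -- and control of the quotient.
    half-below : ∃[ J ] ∀ j → J ℕ.≤ j → ½ ≤ profile-seq j
    half-below = let J , f = close profile-seq≍theta ½ (*<* (ℤ.+<+ (s≤s z≤n))) in J , λ j h →
      below (profile-seq j) (theta ε j) (f j h) (1≤theta {ε} ε≤1 j)
      where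
      below : ∀ u θ → ∣ u - θ ∣ < ½ → 1ℚ ≤ θ → ½ ≤ u
      below u θ h 1≤θ = ≤-trans (+-monoˡ-≤ (- ½) 1≤θ) (p≤q+r⇒p-q≤r θ ½ u
        (subst (θ ≤_) (+-comm u ½) (<⇒≤ (p-q<r⇒p<q+r θ u ½ (≤-<-trans (p≤∣p∣ (θ - u)) (subst (_< ½) (∣p-q∣-sym u θ) h))))))

    module _ (D : ℕ) .{{D≢0 : ℕ.NonZero D}} where

      scale : ℚ
      scale = (ℤ.+ 1 / D) * pow (fromℕ 2) M

      0<scale : 0ℚ < scale
      0<scale = 0<* (0<1/D D) (subst (0ℚ <_) (sym (pow-fromℕ 2 M)) (0<fromℕ (ℕ.m^n>0 2 M)))

      denominator : ∀ j → seq ((x /ᴿ D) *ᴿ y) j ≡ scale * profile-seq j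
      denominator j = trans (sym (*-identityʳ _)) (trans (cong (seq x j * (ℤ.+ 1 / D) * seq y j *_) (sym (2^*½^ M)))
        (solve 5 (λ s d z t h → s :* d :* z :* (t :* h) := d :* t :* (s :* z :* h)) refl (seq x j) (ℤ.+ 1 / D) (seq y j) (pow (fromℕ 2) M) (pow ½ M)))
        where open +-*-Solver

      denominator≉0 : (x /ᴿ D) *ᴿ y ≉0
      denominator≉0 = scale * ½ , 0<* {scale} {½} 0<scale (*<* (ℤ.+<+ (s≤s z≤n))) , proj₁ half-below , λ j h →
        subst₂ _≤_ (sym (+-identityˡ (scale * ½))) (cong ∣_∣ (sym (denominator j)))
          (≤-trans (*-monoˡ-≤-nonNeg scale {{nonNegative (<⇒≤ 0<scale)}} (proj₂ half-below j h)) (p≤∣p∣ (scale * profile-seq j)))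

      numerator : ℕ → ℚ
      numerator b = fromℕ b * fromℕ D * pow ½ M

      scale*numerator : ∀ b → ℤ.+ b / 1 ≡ scale * numerator b
      scale*numerator b = trans (fromℤ≡/1 (ℤ.+ b)) (sym (trans
        (solve 5 (λ i t b d h → i :* t :* (b :* d :* h) := b :* ((i :* d) :* (t :* h))) refl (ℤ.+ 1 / D) (pow (fromℕ 2) M) (fromℕ b) (fromℕ D) (pow ½ M))
        (trans (cong₂ (λ u v → fromℕ b * (u * v)) (1/D*D D) (2^*½^ M)) (*-identityʳ (fromℕ b)))))
        where open +-*-Solver

      -- C(n,m) m! (m + ε)! = n!, so `numerator` b is the normalized count b n!/Z of the ratio
      -- bounds.
      numerator*Z : D ≡ m ! ℕ.* (m ℕ.+ ε) ! → ∀ b → numerator b * Z {n} {m} {ε} ε≤1 total ≡ fromℕ (b ℕ.* n !)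
      numerator*Z D≡ b = begin
        fromℕ b * fromℕ D * pow ½ M * fromℕ (C n m ℕ.* 2 ℕ.^ M)          ≡⟨ cong (fromℕ b * fromℕ D * pow ½ M *_) (trans (fromℕ-homo-* (C n m) (2 ℕ.^ M)) (cong (fromℕ (C n m) *_) (sym (pow-fromℕ 2 M)))) ⟩
        fromℕ b * fromℕ D * pow ½ M * (fromℕ (C n m) * pow (fromℕ 2) M)  ≡⟨ solve 5 (λ b d h k t → b :* d :* h :* (k :* t) := b :* (k :* d) :* (t :* h)) refl (fromℕ b) (fromℕ D) (pow ½ M) (fromℕ (C n m)) (pow (fromℕ 2) M) ⟩
        fromℕ b * (fromℕ (C n m) * fromℕ D) * (pow (fromℕ 2) M * pow ½ M)  ≡⟨ trans (cong (fromℕ b * (fromℕ (C n m) * fromℕ D) *_) (2^*½^ M)) (*-identityʳ (fromℕ b * (fromℕ (C n m) * fromℕ D))) ⟩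
        fromℕ b * (fromℕ (C n m) * fromℕ D)                              ≡⟨ cong (fromℕ b *_) (fromℕ-homo-* (C n m) D) ⟨
        fromℕ b * fromℕ (C n m ℕ.* D)                                    ≡⟨ fromℕ-homo-* b (C n m ℕ.* D) ⟨
        fromℕ (b ℕ.* (C n m ℕ.* D))                                      ≡⟨ cong (λ z → fromℕ (b ℕ.* z)) (trans (cong (C n m ℕ.*_) D≡) (C-! m (m ℕ.+ ε) (sym total))) ⟩
        fromℕ (b ℕ.* n !)                                                ∎
        where
        open ≡-Reasoning
        open +-*-Solver using (solve; _:=_; _:*_)

      -- Count and estimate are each within η of `theta ε j`, hence within 2η of each other; the
      -- denominator, at least 1/2, doubles this.
      quotient-limit : ∀ b η → 0ℚ < η → (K : ℕ) → (∀ j → K ℕ.≤ j → ∣ numerator b - theta ε j ∣ ≤ η) →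
        ∃[ J ] ∀ j → J ℕ.≤ j → ∣ (ℤ.+ b / 1) * recip (seq ((x /ᴿ D) *ᴿ y) j) - 1ℚ ∣ ≤ (η + η) + (η + η)
      quotient-limit b η 0<η K h =
        let J , f = close profile-seq≍theta η 0<η
            I , g = half-below
        in K ℕ.⊔ (J ℕ.⊔ I) , λ j k →
        let k′ = ℕ.m⊔n≤o⇒n≤o K (J ℕ.⊔ I) k in
        quotient-close {ℤ.+ b / 1} {seq ((x /ᴿ D) *ᴿ y) j} {scale} {numerator b} {profile-seq j} 0<scale (scale*numerator b) (denominator j)
          (g j (ℕ.m⊔n≤o⇒n≤o J I k′))
          (subst (∣ numerator b - profile-seq j ∣ ≤_) (halve (η + η))
            (≤-trans (∣p-r∣-triangle (numerator b) (theta ε j) (profile-seq j))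
              (+-mono-≤ (h j (ℕ.m⊔n≤o⇒m≤o K (J ℕ.⊔ I) k))
                (subst (_≤ η) (∣p-q∣-sym (profile-seq j) (theta ε j)) (<⇒≤ (f j (ℕ.m⊔n≤o⇒m≤o J I k′)))))))
        where
        halve : ∀ x → x ≡ ½ * (x + x)
        halve = solve 1 (λ x → x := con ½ :* (x :+ x)) refl
          where open +-*-Solver

  module _ (b : ℕ → ℕ) (classes : ∀ n → Bijection (setoid (Fin (b n))) (bicoloredGraphs n)) where

    private
      D : ℕ → ℕ
      D n = ⌊ n /2⌋ ! ℕ.* ⌈ n /2⌉ !

      estimate : ℕ → ℝ
      estimate n = (c n /ᴿ D n) {{⌊ n /2⌋ !* ⌈ n /2⌉ !≢0}} *ᴿ 2^ (ℤ.+ (n ℕ.^ 2) / 4)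

      estimate≉0 : ∀ n → estimate n ≉0
      estimate≉0 n = denominator≉0 (halves n) (D n) {{⌊ n /2⌋ !* ⌈ n /2⌉ !≢0}}

      large : ∀ {n} (H : Halves n (c n) (2^ (ℤ.+ (n ℕ.^ 2) / 4))) N → N ℕ.+ N ℕ.≤ n → N ℕ.≤ Halves.m H
      large {n} H N h = subst₂ ℕ._≤_ (sym (ℕ.n≡⌊n+n/2⌋ N)) (Halves.⌊⌋≡m H) (ℕ.⌊n/2⌋-mono h)

    count∼estimate : (λ n → fromℚ (ℤ.+ (b n) / 1)) ∼ estimate
    count∼estimate = estimate≉0 , λ η 0<η →
      -- With h = η/8 the quotient error 4h is η/2. The other half of η is the positive gap that
      -- `_<ᴿ_` demands.
      let h         = ½ * (½ * (½ * η))
          0<h       = 0<½*ε {½ * (½ * η)} (0<½*ε {½ * η} (0<½*ε 0<η))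
          N , K , f = ratio-limit h 0<h
      -- From n ≥ 2N follows ⌊n/2⌋ ≥ N.
      in N ℕ.+ N , λ n N≤n →
      let H     = halves n
          nz    = ⌊ n /2⌋ !* ⌈ n /2⌉ !≢0
          D≡    = cong₂ (λ s t → s ! ℕ.* t !) (Halves.⌊⌋≡m H) (Halves.⌈⌉≡m+ε H)
          J , g = quotient-limit H (D n) {{nz}} (b n) h 0<h K
                    (f {n} {Halves.m H} {Halves.ε H} {b n} (Halves.ε≤1 H) (Halves.total H) (classes n) {numerator H (D n) {{nz}} (b n)} (numerator*Z H (D n) {{nz}} D≡ (b n)) (large H N N≤n))
      in ½ * η , 0<½*ε 0<η , J , λ j J≤j → halves-sum η (g j J≤j)
      where
      halves-sum : ∀ {t} η → let h = ½ * (½ * (½ * η)) in t ≤ (h + h) + (h + h) → t + ½ * η ≤ η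
      halves-sum {t} η t≤ = subst (t + ½ * η ≤_)
        (solve 1 (λ η → let h = con ½ :* (con ½ :* (con ½ :* η)) in (h :+ h) :+ (h :+ h) :+ con ½ :* η := η) refl η)
        (+-monoˡ-≤ (½ * η) t≤)
        where open +-*-Solver

open import Data.Nat.Base as ℕ using (ℕ; ⌊_/2⌋; ⌈_/2⌉; _!)
open import Data.Nat.Properties using (_!*_!≢0)
open import Data.Integer.Base using (+_)
open import Data.Rational.Base using (_/_)
open import Defs using (b̃; c; fromℚ; _/ᴿ_; _*ᴿ_; 2^_; _∼_)

module _ where
  open import Data.Fin.Base using (Fin)
  open import Data.Product.Base using (proj₂)
  open import Function.Bundles using (Bijection)
  open import Relation.Binary.PropositionalEquality using (setoid)
  open import Defs using (bicoloredGraphs; unlabeledFinite)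

  unlabelled : ∀ n → Bijection (setoid (Fin (b̃ n))) (bicoloredGraphs n)
  unlabelled n = proj₂ (unlabeledFinite n)

lemma3p8 : (λ n → fromℚ (+ (b̃ n) / 1)) ∼
    (λ n → (c n /ᴿ (⌊ n /2⌋ ! ℕ.* ⌈ n /2⌉ !)) {{⌊ n /2⌋ !* ⌈ n /2⌉ !≢0}} *ᴿ 2^ (+ (n ℕ.^ 2) / 4))
lemma3p8 = Quotient.count∼estimate b̃ unlabelled
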